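{- Let $p$ be an odd prime, let $1\leq H\leq (p-1)/2$ be an integer and let $t\in\mathbb{F}_p^{*}$. Then \[ N_3([-H,H];t)=(1+o(1))\frac{(2H+1)^9}{p} \] provided $H=\omega(p^{3/5})$.
   Context: $\mathbb{F}_p=\mathbb{Z}/p\mathbb{Z}$, and $[-H,H]$ denotes the set of residues modulo $p$ of the integers in $[-H,H]$ (which has $2H+1$ elements since $H\le (p-1)/2$). For a set $\mathcal{A}\subseteq\mathbb{F}_p$ and $t\in\mathbb{F}_p$, $N_3(\mathcal{A};t)$ denotes the number of $3\times 3$ matrices with all entries in $\mathcal{A}$ whose determinant equals $t$ in $\mathbb{F}_p$. Asymptotics refer to $p\to\infty$; $H=\omega(p^{3/5})$ means $H/p^{3/5}\to\infty$, and $o(1)$ denotes a quantity tending to $0$. -}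

module Defs where

open import Data.Nat as ℕ using (ℕ; zero; suc)
open import Data.Nat.Divisibility using (_∣?_)
open import Data.Integer as ℤ using (ℤ; +_; -[1+_]; ∣_∣)
open import Data.Fin using (Fin; zero; suc)
open import Data.List using (List; []; _∷_; map; concatMap; length; filter; upTo)

-- The integers -H, ..., H (2H+1 of them); as residues mod p these are the
-- set [-H,H] ⊆ F_p when H ≤ (p-1)/2.
interval : ℕ → List ℤ
interval H = map (λ i → (+ i) ℤ.- (+ H)) (upTo (suc (2 ℕ.* H)))

allFuns : {A : Set} → List A → (n : ℕ) → List (Fin n → A)
allFuns xs zero = (λ ()) ∷ []
allFuns xs (suc n) =
  concatMap (λ x → map (λ f → λ { zero → x ; (suc i) → f i }) (allFuns xs n)) xs

Matrix3 : Set
Matrix3 = Fin 3 → Fin 3 → ℤ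

matrices3 : List ℤ → List Matrix3
matrices3 xs = allFuns (allFuns xs 3) 3

i0 i1 i2 : Fin 3
i0 = zero
i1 = suc zero
i2 = suc (suc zero)

det3 : Matrix3 → ℤ
det3 M =
    M i0 i0 ℤ.* (M i1 i1 ℤ.* M i2 i2 ℤ.- M i1 i2 ℤ.* M i2 i1)
  ℤ.- M i0 i1 ℤ.* (M i1 i0 ℤ.* M i2 i2 ℤ.- M i1 i2 ℤ.* M i2 i0)
  ℤ.+ M i0 i2 ℤ.* (M i1 i0 ℤ.* M i2 i1 ℤ.- M i1 i1 ℤ.* M i2 i0)

N3 : (p H t : ℕ) → ℕ
N3 p H t = length (filter (λ M → p ∣? ∣ det3 M ℤ.- (+ t) ∣) (matrices3 (interval H)))

{-# OPTIONS --safe #-}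

-- Write n = 2H + 1 and let v be the vector of 2 × 2 minors of the last two rows,
-- so that the determinant is r · v for the first row r.  If v₁ ≠ 0, then
-- r · v = t says that the point r lies on a plane which determines v (as t ≠ 0).
-- Cauchy–Schwarz over all planes of F_p³ bounds the deviation of p N from n⁹ by
-- p² (n³ #{v = v′})^(1/2).  Given v and the last two columns of the rows, their
-- first entries are unique, so #{v = v′} ≤ n² E with E = #{v₁ = v₁′}.  Reading
-- v₁ = v₁′ as a point-plane incidence too gives p E ≤ n⁸ + p² n² #{ab = cd},
-- where a divisor sum over the integers yields #{ab = cd} ≪ n⁴ p^(-4/5), hence
-- p E ≪ n⁸.  The squared deviation is thus ≪ p³ n¹³, which is o(n¹⁸) as soon as
-- n⁵ / p³ → ∞; the matrices with v₁ = 0 contribute only O(n⁷) to N.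
module Submission where

open import Defs
open import Data.Nat using (ℕ; suc; _+_; _*_; _^_; _≤_; _<_; _%_; ∣_-_∣)
open import Data.Nat.Primality using (Prime; euclidsLemma; prime⇒nonZero)
open import Data.Product using (Σ; _×_; _,_; proj₁; proj₂; ∃)
open import Relation.Binary.PropositionalEquality hiding (J)

open import Data.Fin using (Fin)
open import Data.Integer as ℤ using (ℤ; +_; -[1+_]; ∣_∣)
import Data.Integer.Divisibility.Signed as Signed
import Data.Integer.DivMod as ℤ
import Data.Integer.Properties as ℤ
import Data.Integer.Tactic.RingSolver as ℤ
open import Data.Nat
  using (zero; pred; _∸_; _/_; z≤n; s≤s; NonZero; ≢-nonZero; >-nonZero; >-nonZero⁻¹)
open import Data.List using (List; []; _∷_; map; concatMap; length; filter; upTo; _++_; cartesianProduct)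
open import Data.List.Membership.Propositional using (_∈_)
open import Data.List.Membership.Propositional.Properties
  using (∈-map⁺; ∈-map⁻; ∈-upTo⁺; ∈-upTo⁻; ∈-cartesianProduct⁺; ∈-cartesianProduct⁻)
open import Data.List.Properties using (length-map; length-upTo)
open import Data.List.Relation.Unary.All using (All; []; _∷_)
open import Data.List.Relation.Unary.AllPairs as AllPairs using (AllPairs; []; _∷_)
import Data.List.Relation.Unary.AllPairs.Properties as AllPairs
open import Data.List.Relation.Unary.Any using (here; there)
open import Data.List.Relation.Unary.Unique.Propositional using (Unique)
open import Data.List.Relation.Unary.Unique.Propositional.Properties using (map⁺; upTo⁺; cartesianProduct⁺)
open import Data.Nat.Coprimality as Coprime
  using (Coprime; GCD≡1⇒coprime; coprime-divisor; coprime-Bézout; prime⇒coprime)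
import Data.Nat.Divisibility as ℕ
open import Data.Nat.Divisibility using (divides; _∣?_; ∣⇒≤)
open import Data.Nat.DivMod using (m/n*n≤m; /-monoˡ-≤; m*n/n≡m)
open import Data.Nat.GCD
  using (gcd; gcd[m,n]∣m; gcd[m,n]∣n; gcd[m,n]≢0; gcd-GCD; GCD; GCD-*; module Bézout)
open import Data.Nat.Properties
open import Data.Nat.Tactic.RingSolver using (solve-∀)
open import Data.Product.Properties using (≡-dec)
open import Data.Sum using (_⊎_; inj₁; inj₂)
open import Function using (_∘_)
open import Relation.Binary.Definitions using (DecidableEquality)
open import Relation.Nullary using (¬_; Dec; yes; no; contradiction)
open import Relation.Nullary.Decidable using (_×-dec_; map′; ¬?)
open import Relation.Unary using (Decidable)

-- No characters or Fourier analysis are involved. The planes are normalised to r + s a + t b = c,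
-- so that a point lies on exactly p² of the p³ planes and two points that differ modulo p share at
-- most p of them; these two facts alone give the variance of the number of points on a plane. The
-- price is that planes with vanishing first coefficient are absent, which is why rows with v₁ = 0
-- have to be counted by hand. Points and planes form lists with repetition, and coincidences
-- replace cardinalities in the bound. This is what lets it serve twice: in v₁ = v₁′ one minor is
-- bilinear in two pairs of entries, while the other is a difference of two products. One product
-- goes to the point and the other to the plane, so that both lists repeat only according to a b = c
-- d. A cruder value of E would not do: the squared deviation is at most p⁴ n⁵ E, and only E ≪ n⁸ /
-- p, the size expected of random values, leads from there to the exponent 3/5.

private variable
  A B : Set
  Φ Ψ : Set

-- Finite sums of natural numbers and Cauchy-Schwarz.

∑ : List A → (A → ℕ) → ℕ
∑ []       f = 0
∑ (x ∷ xs) f = f x + ∑ xs f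

infix 5 ∑
syntax ∑ xs (λ x → e) = ∑[ x ∈ xs ] e

∑-mono∈ : (xs : List A) {f g : A → ℕ} → (∀ {x} → x ∈ xs → f x ≤ g x) → ∑ xs f ≤ ∑ xs g
∑-mono∈ []       f≤g = z≤n
∑-mono∈ (x ∷ xs) f≤g = +-mono-≤ (f≤g (here refl)) (∑-mono∈ xs (f≤g ∘ there))

∑-mono : (xs : List A) {f g : A → ℕ} → (∀ x → f x ≤ g x) → ∑ xs f ≤ ∑ xs g
∑-mono xs f≤g = ∑-mono∈ xs λ {x} _ → f≤g x

∑-cong : (xs : List A) {f g : A → ℕ} → (∀ x → f x ≡ g x) → ∑ xs f ≡ ∑ xs g
∑-cong []       f≡g = refl
∑-cong (x ∷ xs) f≡g = cong₂ _+_ (f≡g x) (∑-cong xs f≡g)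

∑-const : (xs : List A) (c : ℕ) → ∑[ _ ∈ xs ] c ≡ length xs * c
∑-const []       c = refl
∑-const (x ∷ xs) c = cong (λ z → c + z) (∑-const xs c)

∑-≤-const : (xs : List A) {f : A → ℕ} (c : ℕ) → (∀ x → f x ≤ c) → ∑ xs f ≤ length xs * c
∑-≤-const xs c f≤c = ≤-trans (∑-mono xs f≤c) (≤-reflexive (∑-const xs c))

∑-+ : (xs : List A) (f g : A → ℕ) → ∑[ x ∈ xs ] (f x + g x) ≡ ∑ xs f + ∑ xs g
∑-+ []       f g = refl
∑-+ (x ∷ xs) f g = trans (cong (λ z → f x + g x + z) (∑-+ xs f g)) (lemma (f x) (g x) (∑ xs f) (∑ xs g))
  where
  lemma : ∀ a b c d → a + b + (c + d) ≡ a + c + (b + d)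
  lemma = solve-∀

∑∑-+ : (xs : List A) (ys : List B) (f g : A → B → ℕ) →
       ∑[ x ∈ xs ] ∑[ y ∈ ys ] (f x y + g x y) ≡ (∑[ x ∈ xs ] ∑ ys (f x)) + (∑[ x ∈ xs ] ∑ ys (g x))
∑∑-+ xs ys f g = trans (∑-cong xs λ x → ∑-+ ys (f x) (g x)) (∑-+ xs _ _)

∑-*ˡ : (xs : List A) (c : ℕ) (f : A → ℕ) → ∑[ x ∈ xs ] (c * f x) ≡ c * ∑ xs f
∑-*ˡ []       c f = sym (*-zeroʳ c)
∑-*ˡ (x ∷ xs) c f = trans (cong (λ z → c * f x + z) (∑-*ˡ xs c f)) (sym (*-distribˡ-+ c (f x) (∑ xs f)))

∑-*ʳ : (xs : List A) (c : ℕ) (f : A → ℕ) → ∑[ x ∈ xs ] (f x * c) ≡ ∑ xs f * c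
∑-*ʳ []       c f = refl
∑-*ʳ (x ∷ xs) c f = trans (cong (λ z → f x * c + z) (∑-*ʳ xs c f)) (sym (*-distribʳ-+ c (f x) (∑ xs f)))

∑-*-∑ : (xs : List A) (ys : List B) (f : A → ℕ) (g : B → ℕ) →
        ∑[ x ∈ xs ] ∑[ y ∈ ys ] (f x * g y) ≡ ∑ xs f * ∑ ys g
∑-*-∑ xs ys f g = trans (∑-cong xs λ x → ∑-*ˡ ys (f x) g) (∑-*ʳ xs (∑ ys g) f)

∑-swap : (xs : List A) (ys : List B) (f : A → B → ℕ) →
         ∑[ x ∈ xs ] ∑[ y ∈ ys ] f x y ≡ ∑[ y ∈ ys ] ∑[ x ∈ xs ] f x y
∑-swap []       ys f = sym (trans (∑-const ys 0) (*-zeroʳ (length ys)))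
∑-swap (x ∷ xs) ys f = trans (cong (λ z → ∑ ys (f x) + z) (∑-swap xs ys f))
                             (sym (∑-+ ys (f x) λ y → ∑ xs λ x′ → f x′ y))

∑-++ : (xs ys : List A) (f : A → ℕ) → ∑ (xs ++ ys) f ≡ ∑ xs f + ∑ ys f
∑-++ []       ys f = refl
∑-++ (x ∷ xs) ys f = trans (cong (λ z → f x + z) (∑-++ xs ys f)) (sym (+-assoc (f x) _ _))

∑-map : (h : A → B) (xs : List A) (f : B → ℕ) → ∑ (map h xs) f ≡ ∑ xs (f ∘ h)
∑-map h []       f = refl
∑-map h (x ∷ xs) f = cong (λ z → f (h x) + z) (∑-map h xs f)

∑-concatMap : (h : A → List B) (xs : List A) (f : B → ℕ) →
              ∑ (concatMap h xs) f ≡ ∑[ x ∈ xs ] ∑ (h x) f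
∑-concatMap h []       f = refl
∑-concatMap h (x ∷ xs) f = trans (∑-++ (h x) _ f) (cong (λ z → ∑ (h x) f + z) (∑-concatMap h xs f))

∑-× : (xs : List A) (ys : List B) (f : A × B → ℕ) →
      ∑ (cartesianProduct xs ys) f ≡ ∑[ x ∈ xs ] ∑[ y ∈ ys ] f (x , y)
∑-× []       ys f = refl
∑-× (x ∷ xs) ys f = trans (∑-++ (map (x ,_) ys) _ f)
                          (cong₂ _+_ (∑-map (x ,_) ys f) (∑-× xs ys f))

∑-≥-term : {xs : List A} {x : A} (f : A → ℕ) → x ∈ xs → f x ≤ ∑ xs f
∑-≥-term f (here refl) = m≤m+n _ _
∑-≥-term f (there x∈)  = ≤-trans (∑-≥-term f x∈) (m≤n+m _ _)

∑-≡0⊎∃ : (xs : List A) (f : A → ℕ) → ∑ xs f ≡ 0 ⊎ ∃ λ x → x ∈ xs × f x ≢ 0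
∑-≡0⊎∃ []       f = inj₁ refl
∑-≡0⊎∃ (x ∷ xs) f with f x ≟ 0 | ∑-≡0⊎∃ xs f
... | no fx≢0  | _                      = inj₂ (x , here refl , fx≢0)
... | yes _    | inj₂ (y , y∈xs , fy≢0) = inj₂ (y , there y∈xs , fy≢0)
... | yes fx≡0 | inj₁ ∑≡0               = inj₁ (cong₂ _+_ fx≡0 ∑≡0)

∣∑-∑∣≤∑∣-∣ : (xs : List A) (f g : A → ℕ) → ∣ ∑ xs f - ∑ xs g ∣ ≤ ∑[ x ∈ xs ] ∣ f x - g x ∣
∣∑-∑∣≤∑∣-∣ []       f g = z≤n
∣∑-∑∣≤∑∣-∣ (x ∷ xs) f g = begin
  ∣ a + b - c + d ∣                     ≤⟨ ∣-∣-triangle (a + b) (a + d) (c + d) ⟩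
  ∣ a + b - a + d ∣ + ∣ a + d - c + d ∣ ≡⟨ cong₂ _+_ (∣m+n-m+o∣≡∣n-o∣ a b d) (∣m+o-n+o∣ a c d) ⟩
  ∣ b - d ∣ + ∣ a - c ∣                 ≡⟨ +-comm ∣ b - d ∣ ∣ a - c ∣ ⟩
  ∣ a - c ∣ + ∣ b - d ∣                 ≤⟨ +-monoʳ-≤ ∣ a - c ∣ (∣∑-∑∣≤∑∣-∣ xs f g) ⟩
  ∣ a - c ∣ + (∑[ x ∈ xs ] ∣ f x - g x ∣) ∎
  where
  open ≤-Reasoning
  a = f x
  b = ∑ xs f
  c = g x
  d = ∑ xs g
  ∣m+o-n+o∣ : ∀ m n o → ∣ m + o - n + o ∣ ≡ ∣ m - n ∣
  ∣m+o-n+o∣ m n o = trans (cong₂ ∣_-_∣ (+-comm m o) (+-comm n o)) (∣m+n-m+o∣≡∣n-o∣ o m n)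

-- The square of a difference with its cross term moved to the other side, so that everything stays
-- natural. Both Cauchy-Schwarz and the variance expand squares in this form.
∣m-n∣²+2mn : ∀ m n → ∣ m - n ∣ * ∣ m - n ∣ + 2 * (m * n) ≡ m * m + n * n
∣m-n∣²+2mn m n with ≤-total m n
... | inj₁ m≤n with d , refl ← m≤n⇒∃[o]m+o≡n m≤n =
  trans (cong (λ z → z * z + 2 * (m * (m + d))) (∣m-m+n∣≡n m d)) (lemma m d)
  where
  lemma : ∀ m d → d * d + 2 * (m * (m + d)) ≡ m * m + (m + d) * (m + d)
  lemma = solve-∀
... | inj₂ n≤m with d , refl ← m≤n⇒∃[o]m+o≡n n≤m =
  trans (cong (λ z → z * z + 2 * ((n + d) * n)) (trans (∣-∣-comm (n + d) n) (∣m-m+n∣≡n n d))) (lemma n d)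
  where
  lemma : ∀ n d → d * d + 2 * ((n + d) * n) ≡ (n + d) * (n + d) + n * n
  lemma = solve-∀

2mn≤m²+n² : ∀ m n → 2 * (m * n) ≤ m * m + n * n
2mn≤m²+n² m n = ≤-trans (m≤n+m (2 * (m * n)) (∣ m - n ∣ * ∣ m - n ∣)) (≤-reflexive (∣m-n∣²+2mn m n))

-- Sum 2 (f x g y) (f y g x) ≤ (f x g y)² + (f y g x)² over all pairs (x , y).
cauchy-schwarz : (xs : List A) (f g : A → ℕ) →
  (∑[ x ∈ xs ] (f x * g x)) * (∑[ x ∈ xs ] (f x * g x)) ≤
  (∑[ x ∈ xs ] (f x * f x)) * (∑[ x ∈ xs ] (g x * g x))
cauchy-schwarz xs f g = *-cancelˡ-≤ 2 (begin
  2 * (S * S)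
    ≡⟨ cong (2 *_) (sym (∑-*-∑ xs xs _ _)) ⟩
  2 * (∑[ x ∈ xs ] ∑[ y ∈ xs ] ((f x * g x) * (f y * g y)))
    ≡⟨ sym (trans (∑-cong xs λ x → ∑-*ˡ xs 2 _) (∑-*ˡ xs 2 _)) ⟩
  (∑[ x ∈ xs ] ∑[ y ∈ xs ] (2 * ((f x * g x) * (f y * g y))))
    ≤⟨ ∑-mono xs (λ x → ∑-mono xs λ y → pointwise (f x) (g x) (f y) (g y)) ⟩
  (∑[ x ∈ xs ] ∑[ y ∈ xs ] ((f x * f x) * (g y * g y) + (g x * g x) * (f y * f y)))
    ≡⟨ trans (∑-cong xs λ x → ∑-+ xs _ _) (∑-+ xs _ _) ⟩
  (∑[ x ∈ xs ] ∑[ y ∈ xs ] ((f x * f x) * (g y * g y))) +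
  (∑[ x ∈ xs ] ∑[ y ∈ xs ] ((g x * g x) * (f y * f y)))
    ≡⟨ cong₂ _+_ (∑-*-∑ xs xs _ _) (∑-*-∑ xs xs _ _) ⟩
  F * G + G * F
    ≡⟨ lemma F G ⟩
  2 * (F * G) ∎)
  where
  open ≤-Reasoning
  S = ∑[ x ∈ xs ] (f x * g x)
  F = ∑[ x ∈ xs ] (f x * f x)
  G = ∑[ x ∈ xs ] (g x * g x)
  lemma : ∀ a b → a * b + b * a ≡ 2 * (a * b)
  lemma = solve-∀
  lhs : ∀ a b c d → 2 * ((a * d) * (b * c)) ≡ 2 * ((a * b) * (c * d))
  lhs = solve-∀
  rhs : ∀ a b c d → (a * d) * (a * d) + (b * c) * (b * c) ≡ (a * a) * (d * d) + (b * b) * (c * c)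
  rhs = solve-∀
  pointwise : ∀ a b c d → 2 * ((a * b) * (c * d)) ≤ (a * a) * (d * d) + (b * b) * (c * c)
  pointwise a b c d = subst₂ _≤_ (lhs a b c d) (rhs a b c d) (2mn≤m²+n² (a * d) (b * c))

-- Indicators and counting.

𝟙 : Dec Φ → ℕ
𝟙 (yes _) = 1
𝟙 (no _)  = 0

𝟙≤1 : (Φ? : Dec Φ) → 𝟙 Φ? ≤ 1
𝟙≤1 (yes _) = ≤-refl
𝟙≤1 (no _)  = z≤n

𝟙-≤ : (Φ? : Dec Φ) {n : ℕ} → (Φ → 1 ≤ n) → 𝟙 Φ? ≤ n
𝟙-≤ (yes p) 1≤n = 1≤n p
𝟙-≤ (no _)  _   = z≤n

𝟙-true : (Φ? : Dec Φ) → Φ → 𝟙 Φ? ≡ 1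
𝟙-true (yes _) _ = refl
𝟙-true (no ¬p) p = contradiction p ¬p

𝟙-false : (Φ? : Dec Φ) → ¬ Φ → 𝟙 Φ? ≡ 0
𝟙-false (yes p) ¬p = contradiction p ¬p
𝟙-false (no _)  _  = refl

𝟙≢0 : (Φ? : Dec Φ) → 𝟙 Φ? ≢ 0 → Φ
𝟙≢0 (yes p) _   = p
𝟙≢0 (no _)  1≢0 = contradiction refl 1≢0

𝟙-mono : (Φ? : Dec Φ) (Ψ? : Dec Ψ) → (Φ → Ψ) → 𝟙 Φ? ≤ 𝟙 Ψ?
𝟙-mono Φ? Ψ? Φ⇒Ψ = 𝟙-≤ Φ? λ p → ≤-reflexive (sym (𝟙-true Ψ? (Φ⇒Ψ p)))

𝟙-cong : (Φ? : Dec Φ) (Ψ? : Dec Ψ) → (Φ → Ψ) → (Ψ → Φ) → 𝟙 Φ? ≡ 𝟙 Ψ?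
𝟙-cong Φ? Ψ? Φ⇒Ψ Ψ⇒Φ = ≤-antisym (𝟙-mono Φ? Ψ? Φ⇒Ψ) (𝟙-mono Ψ? Φ? Ψ⇒Φ)

𝟙-× : (Φ? : Dec Φ) (Ψ? : Dec Ψ) → 𝟙 (Φ? ×-dec Ψ?) ≡ 𝟙 Φ? * 𝟙 Ψ?
𝟙-× (yes _) (yes _) = refl
𝟙-× (yes _) (no _)  = refl
𝟙-× (no _)  _       = refl

length-filter : {P : A → Set} (P? : Decidable P) (xs : List A) →
                length (filter P? xs) ≡ ∑[ x ∈ xs ] 𝟙 (P? x)
length-filter P? []       = refl
length-filter P? (x ∷ xs) with P? x
... | yes _ = cong suc (length-filter P? xs)
... | no _  = length-filter P? xs

-- Pairwise exclusion is assumed instead of distinct entries, so that the same count covers lists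
-- without repetition and lists whose entries are pairwise incongruent.
∑-𝟙-unique : {P : A → Set} (P? : Decidable P) {xs : List A} →
             AllPairs (λ x y → ¬ (P x × P y)) xs → ∑[ x ∈ xs ] 𝟙 (P? x) ≤ 1
∑-𝟙-unique P? []                  = z≤n
∑-𝟙-unique P? (_∷_ {x} {xs} ¬Px ¬P) with P? x
... | no _  = ∑-𝟙-unique P? ¬P
... | yes px = ≤-reflexive (cong suc (none ¬Px))
  where
  none : ∀ {ys} → All (λ y → ¬ (_ × _)) ys → ∑[ y ∈ ys ] 𝟙 (P? y) ≡ 0
  none []           = refl
  none (¬py ∷ ¬pys) = cong₂ _+_ (𝟙-false (P? _) λ py → ¬py (px , py)) (none ¬pys)

m²≤n²⇒m≤n : ∀ {m n} → m * m ≤ n * n → m ≤ n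
m²≤n²⇒m≤n {m} {n} m²≤n² with m ≤? n
... | yes m≤n = m≤n
... | no m≰n  = contradiction m²≤n² (<⇒≱ (*-mono-< (≰⇒> m≰n) (≰⇒> m≰n)))

length-× : (xs : List A) (ys : List B) → length (cartesianProduct xs ys) ≡ length xs * length ys
length-× xs ys = trans (sym (length≡∑1 (cartesianProduct xs ys))) (trans (∑-× xs ys (λ _ → 1))
  (trans (∑-cong xs λ _ → length≡∑1 ys) (∑-const xs (length ys))))
  where
  length≡∑1 : {C : Set} (zs : List C) → ∑[ _ ∈ zs ] 1 ≡ length zs
  length≡∑1 zs = trans (∑-const zs 1) (*-identityʳ _)

∑-filter : {P : A → Set} (P? : Decidable P) (xs : List A) (f : A → ℕ) →
           ∑ (filter P? xs) f ≡ ∑[ x ∈ xs ] (𝟙 (P? x) * f x)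
∑-filter P? []       f = refl
∑-filter P? (x ∷ xs) f with P? x
... | yes _ = cong₂ _+_ (sym (*-identityˡ (f x))) (∑-filter P? xs f)
... | no _  = ∑-filter P? xs f

length-interval : ∀ H → length (interval H) ≡ 2 * H + 1
length-interval H = trans (length-map _ (upTo (suc (2 * H)))) (trans (length-upTo _) (+-comm 1 (2 * H)))

-- Congruences, residues and inverses modulo p.

module Residues (p : ℕ) where

  infix 4 _≋_ _≋?_

  -- Wrapped in a record so that `x` and `y` can be inferred from a congruence; a bare divisibility
  -- mentions only their difference.
  record _≋_ (x y : ℤ) : Set where
    constructor mod
    field p∣x-y : + p Signed.∣ x ℤ.- y

  abstract
    _≋?_ : (x y : ℤ) → Dec (x ≋ y)
    x ≋? y = map′ (λ d → mod (Signed.∣ᵤ⇒∣ d)) (λ { (mod d) → Signed.∣⇒∣ᵤ d }) (p ∣? ∣ x ℤ.- y ∣)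

  -- Nearly all congruences below are certified in this way or by `≋-lin₂`: the difference of the
  -- two sides is an explicit combination of differences already known to vanish modulo p, and the
  -- polynomial identity is left to the ring solver over ℤ.
  ≋-lin₁ : ∀ {a b x y} → a ≋ b → (k : ℤ) → x ℤ.- y ≡ k ℤ.* (a ℤ.- b) → x ≋ y
  ≋-lin₁ (mod (Signed.divides q e)) k eq = mod (Signed.divides (k ℤ.* q)
    (trans eq (trans (cong (k ℤ.*_) e) (sym (ℤ.*-assoc k q (+ p))))))

  ≋-lin₂ : ∀ {a b c d x y} → a ≋ b → c ≋ d → (k l : ℤ) →
           x ℤ.- y ≡ k ℤ.* (a ℤ.- b) ℤ.+ l ℤ.* (c ℤ.- d) → x ≋ y
  ≋-lin₂ (mod (Signed.divides q e)) (mod (Signed.divides r f)) k l eq = mod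
    (Signed.divides (k ℤ.* q ℤ.+ l ℤ.* r)
    (trans eq (trans (cong₂ ℤ._+_ (cong (k ℤ.*_) e) (cong (l ℤ.*_) f)) (lemma k l q r (+ p)))))
    where
    lemma : ∀ k l q r p → k ℤ.* (q ℤ.* p) ℤ.+ l ℤ.* (r ℤ.* p) ≡ (k ℤ.* q ℤ.+ l ℤ.* r) ℤ.* p
    lemma = ℤ.solve-∀

  ≋-reflexive : ∀ {x y} → x ≡ y → x ≋ y
  ≋-reflexive {x} refl = mod (Signed.divides (+ 0) (ℤ.+-inverseʳ x))

  ≋-refl : ∀ {x} → x ≋ x
  ≋-refl = ≋-reflexive refl

  ≋-sym : ∀ {x y} → x ≋ y → y ≋ x
  ≋-sym {x} {y} x≋y = ≋-lin₁ x≋y ℤ.-1ℤ (lemma x y)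
    where
    lemma : ∀ x y → y ℤ.- x ≡ ℤ.-1ℤ ℤ.* (x ℤ.- y)
    lemma = ℤ.solve-∀

  ≋-trans : ∀ {x y z} → x ≋ y → y ≋ z → x ≋ z
  ≋-trans {x} {y} {z} x≋y y≋z = ≋-lin₂ x≋y y≋z ℤ.1ℤ ℤ.1ℤ (lemma x y z)
    where
    lemma : ∀ x y z → x ℤ.- z ≡ ℤ.1ℤ ℤ.* (x ℤ.- y) ℤ.+ ℤ.1ℤ ℤ.* (y ℤ.- z)
    lemma = ℤ.solve-∀

  ≋-+ : ∀ {x y z w} → x ≋ y → z ≋ w → x ℤ.+ z ≋ y ℤ.+ w
  ≋-+ {x} {y} {z} {w} x≋y z≋w = ≋-lin₂ x≋y z≋w ℤ.1ℤ ℤ.1ℤ (lemma x y z w)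
    where
    lemma : ∀ x y z w → (x ℤ.+ z) ℤ.- (y ℤ.+ w) ≡ ℤ.1ℤ ℤ.* (x ℤ.- y) ℤ.+ ℤ.1ℤ ℤ.* (z ℤ.- w)
    lemma = ℤ.solve-∀

  ≋-* : ∀ {x y z w} → x ≋ y → z ≋ w → x ℤ.* z ≋ y ℤ.* w
  ≋-* {x} {y} {z} {w} x≋y z≋w = ≋-lin₂ x≋y z≋w z y (lemma x y z w)
    where
    lemma : ∀ x y z w → x ℤ.* z ℤ.- y ℤ.* w ≡ z ℤ.* (x ℤ.- y) ℤ.+ y ℤ.* (z ℤ.- w)
    lemma = ℤ.solve-∀

  Distinct : List ℤ → Set
  Distinct = AllPairs (λ x y → ¬ x ≋ y)

  ∑-𝟙-distinct : ∀ {xs} → Distinct xs → {P : ℤ → Set} (P? : Decidable P) →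
                 (∀ {x y} → P x → P y → x ≋ y) → ∑[ x ∈ xs ] 𝟙 (P? x) ≤ 1
  ∑-𝟙-distinct d P? P⇒≋ = ∑-𝟙-unique P? (AllPairs.map (λ { x≉y (px , py) → x≉y (P⇒≋ px py) }) d)

  -- The difference lies strictly between 0 and p in absolute value, so p cannot divide it. The
  -- shift `c` is - H for the interval and 0 for the residues.
  small-difference : ∀ {i j} → i < j → j < p → (c : ℤ) → ¬ + i ℤ.+ c ≋ + j ℤ.+ c
  small-difference {i} {j} i<j j<p c (mod d) with k , refl ← m≤n⇒∃[o]m+o≡n i<j =
    <⇒≱ (≤-<-trans (s≤s (m≤n+m k i)) j<p)
        (∣⇒≤ (subst (λ z → p ℕ.∣ z) difference (Signed.∣⇒∣ᵤ d)))
    where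
    lemma : ∀ i k c → (i ℤ.+ c) ℤ.- (ℤ.1ℤ ℤ.+ i ℤ.+ k ℤ.+ c) ≡ ℤ.- (ℤ.1ℤ ℤ.+ k)
    lemma = ℤ.solve-∀
    difference : ∣ (+ i ℤ.+ c) ℤ.- (+ (suc i + k) ℤ.+ c) ∣ ≡ suc k
    difference = cong ∣_∣ (lemma (+ i) (+ k) c)

  distinct-interval : ∀ {H} → 2 * H + 1 ≤ p → Distinct (interval H)
  distinct-interval {H} n≤p = AllPairs.map⁺ (AllPairs.applyUpTo⁺₁ _ (suc (2 * H))
    λ i<j j<n → small-difference i<j (<-≤-trans j<n (≤-trans (≤-reflexive (+-comm 1 (2 * H))) n≤p))
      (ℤ.- + H))

  residues : List ℤ
  residues = map +_ (upTo p)

  length-residues : length residues ≡ p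
  length-residues = trans (length-map +_ (upTo p)) (length-upTo p)

  distinct-residues : Distinct residues
  distinct-residues = AllPairs.map⁺ (AllPairs.applyUpTo⁺₁ _ p λ {i} {j} i<j j<p i≋j →
    small-difference i<j j<p ℤ.0ℤ (≋-+ i≋j (≋-refl {ℤ.0ℤ})))

  residue : .{{NonZero p}} → ∀ z → ∃ λ r → r ∈ residues × z ≋ r
  residue z = + (z ℤ.%ℕ p) , ∈-map⁺ +_ (∈-upTo⁺ (ℤ.n%ℕd<d z p)) ,
    mod (Signed.divides (z ℤ./ℕ p) (trans (cong (ℤ._- + (z ℤ.%ℕ p)) (ℤ.a≡a%ℕn+[a/ℕn]*n z p))
      (lemma (+ (z ℤ.%ℕ p)) _)))
    where
    lemma : ∀ r q → r ℤ.+ q ℤ.- r ≡ q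
    lemma = ℤ.solve-∀

  ∑-residue≡1 : .{{NonZero p}} → ∀ z → ∑[ w ∈ residues ] 𝟙 (z ≋? w) ≡ 1
  ∑-residue≡1 z with r , r∈ , z≋r ← residue z = ≤-antisym
    (∑-𝟙-distinct distinct-residues (z ≋?_) λ z≋x z≋y → ≋-trans (≋-sym z≋x) z≋y)
    (≤-trans (≤-reflexive (sym (𝟙-true (z ≋? r) z≋r))) (∑-≥-term (λ w → 𝟙 (z ≋? w)) r∈))

  multiplicativeEnergy : List ℤ → ℕ
  multiplicativeEnergy I = ∑[ a ∈ I ] ∑[ b ∈ I ] ∑[ c ∈ I ] ∑[ d ∈ I ] 𝟙 (a ℤ.* b ≋? c ℤ.* d)

  module Field (p-prime : Prime p) where

    instance
      p≢0 : NonZero p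
      p≢0 = prime⇒nonZero p-prime

    *-≋0 : ∀ {x y} → x ℤ.* y ≋ ℤ.0ℤ → x ≋ ℤ.0ℤ ⊎ y ≋ ℤ.0ℤ
    *-≋0 {x} {y} (mod d) with euclidsLemma ∣ x ∣ ∣ y ∣ p-prime
      (subst (p ℕ.∣_) (trans (cong ∣_∣ (ℤ.+-identityʳ (x ℤ.* y))) (ℤ.abs-* x y)) (Signed.∣⇒∣ᵤ d))
    ... | inj₁ p∣x = inj₁ (mod (Signed.∣ᵤ⇒∣ (subst (λ z → p ℕ.∣ ∣ z ∣) (sym (ℤ.+-identityʳ x)) p∣x)))
    ... | inj₂ p∣y = inj₂ (mod (Signed.∣ᵤ⇒∣ (subst (λ z → p ℕ.∣ ∣ z ∣) (sym (ℤ.+-identityʳ y)) p∣y)))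

    *-cancelˡ-≋ : ∀ {c x y} → ¬ c ≋ ℤ.0ℤ → c ℤ.* x ≋ c ℤ.* y → x ≋ y
    *-cancelˡ-≋ {c} {x} {y} c≉0 cx≋cy with *-≋0 {c} {x ℤ.- y} (≋-lin₁ cx≋cy ℤ.1ℤ (lemma c x y))
      where
      lemma : ∀ c x y → c ℤ.* (x ℤ.- y) ℤ.- ℤ.0ℤ ≡ ℤ.1ℤ ℤ.* (c ℤ.* x ℤ.- c ℤ.* y)
      lemma = ℤ.solve-∀
    ... | inj₁ c≋0   = contradiction c≋0 c≉0
    ... | inj₂ x-y≋0 = ≋-lin₁ x-y≋0 ℤ.1ℤ (lemma x y)
      where
      lemma : ∀ x y → x ℤ.- y ≡ ℤ.1ℤ ℤ.* (x ℤ.- y ℤ.- ℤ.0ℤ)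
      lemma = ℤ.solve-∀

    ∑-𝟙-linear : ∀ {xs} → Distinct xs → ∀ c d → ¬ c ≋ ℤ.0ℤ → ∑[ x ∈ xs ] 𝟙 (c ℤ.* x ≋? d) ≤ 1
    ∑-𝟙-linear distinct c d c≉0 = ∑-𝟙-distinct distinct (λ x → c ℤ.* x ≋? d)
      λ cx≋d cy≋d → *-cancelˡ-≋ c≉0 (≋-trans cx≋d (≋-sym cy≋d))

    inverse : ∀ c → ¬ c ≋ ℤ.0ℤ → ∃ λ u → c ℤ.* u ≋ ℤ.1ℤ
    inverse c c≉0 with r , r∈ , c≋r ← residue c with ∈-map⁻ +_ r∈
    ... | zero  , _  , refl = contradiction c≋r c≉0
    ... | suc m , m∈ , refl with coprime-Bézout {p} {suc m} (prime⇒coprime p-prime (∈-upTo⁻ m∈))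
    -- Here 1 + y m = x p with the residue m of `c`, so the inverse is - y; in the other case 1 + x
    -- p = y m, and it is y.
    ...   | Bézout.+- x y eq = ℤ.- + y , ≋-lin₂ c≋r p≋0 (ℤ.- + y) (ℤ.- + x) (begin
      c ℤ.* ℤ.- + y ℤ.- ℤ.1ℤ
        ≡⟨ lemma₁ c (+ y) (+ suc m) ⟩
      ℤ.- + y ℤ.* (c ℤ.- + suc m) ℤ.- (ℤ.1ℤ ℤ.+ + y ℤ.* + suc m)
        ≡⟨ cong (λ z → ℤ.- + y ℤ.* (c ℤ.- + suc m) ℤ.- z) eqᶻ ⟩
      ℤ.- + y ℤ.* (c ℤ.- + suc m) ℤ.- + x ℤ.* + p
        ≡⟨ lemma₂ (ℤ.- + y ℤ.* (c ℤ.- + suc m)) (+ x) (+ p) ⟩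
      ℤ.- + y ℤ.* (c ℤ.- + suc m) ℤ.+ ℤ.- + x ℤ.* (+ p ℤ.- ℤ.0ℤ) ∎)
      where
      open ≡-Reasoning
      p≋0 : + p ≋ ℤ.0ℤ
      p≋0 = mod (Signed.divides ℤ.1ℤ (trans (ℤ.+-identityʳ _) (sym (ℤ.*-identityˡ _))))
      eqᶻ : ℤ.1ℤ ℤ.+ + y ℤ.* + suc m ≡ + x ℤ.* + p
      eqᶻ = trans (cong (λ z → ℤ.1ℤ ℤ.+ z) (sym (ℤ.pos-* y (suc m)))) (trans (cong +_ eq) (ℤ.pos-* x p))
      lemma₁ : ∀ c y m → c ℤ.* ℤ.- y ℤ.- ℤ.1ℤ ≡ ℤ.- y ℤ.* (c ℤ.- m) ℤ.- (ℤ.1ℤ ℤ.+ y ℤ.* m)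
      lemma₁ = ℤ.solve-∀
      lemma₂ : ∀ a x p → a ℤ.- x ℤ.* p ≡ a ℤ.+ ℤ.- x ℤ.* (p ℤ.- ℤ.0ℤ)
      lemma₂ = ℤ.solve-∀
    ...   | Bézout.-+ x y eq = + y , ≋-lin₂ c≋r p≋0 (+ y) (+ x) (begin
      c ℤ.* + y ℤ.- ℤ.1ℤ
        ≡⟨ lemma₁ c (+ y) (+ suc m) ⟩
      + y ℤ.* (c ℤ.- + suc m) ℤ.+ (+ y ℤ.* + suc m ℤ.- ℤ.1ℤ)
        ≡⟨ cong (λ z → + y ℤ.* (c ℤ.- + suc m) ℤ.+ (z ℤ.- ℤ.1ℤ)) (sym eqᶻ) ⟩
      + y ℤ.* (c ℤ.- + suc m) ℤ.+ (ℤ.1ℤ ℤ.+ + x ℤ.* + p ℤ.- ℤ.1ℤ)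
        ≡⟨ lemma₂ (+ y ℤ.* (c ℤ.- + suc m)) (+ x) (+ p) ⟩
      + y ℤ.* (c ℤ.- + suc m) ℤ.+ + x ℤ.* (+ p ℤ.- ℤ.0ℤ) ∎)
      where
      open ≡-Reasoning
      p≋0 : + p ≋ ℤ.0ℤ
      p≋0 = mod (Signed.divides ℤ.1ℤ (trans (ℤ.+-identityʳ _) (sym (ℤ.*-identityˡ _))))
      eqᶻ : ℤ.1ℤ ℤ.+ + x ℤ.* + p ≡ + y ℤ.* + suc m
      eqᶻ = trans (cong (λ z → ℤ.1ℤ ℤ.+ z) (sym (ℤ.pos-* x p))) (trans (cong +_ eq) (ℤ.pos-* y (suc m)))
      lemma₁ : ∀ c y m → c ℤ.* y ℤ.- ℤ.1ℤ ≡ y ℤ.* (c ℤ.- m) ℤ.+ (y ℤ.* m ℤ.- ℤ.1ℤ)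
      lemma₁ = ℤ.solve-∀
      lemma₂ : ∀ a x p → a ℤ.+ (ℤ.1ℤ ℤ.+ x ℤ.* p ℤ.- ℤ.1ℤ) ≡ a ℤ.+ x ℤ.* (p ℤ.- ℤ.0ℤ)
      lemma₂ = ℤ.solve-∀

-- Incidences between points and planes of F_p³.

ℤ³ : Set
ℤ³ = ℤ × ℤ × ℤ

module Incidence (p : ℕ) (p-prime : Prime p) where
  open Residues p
  open Field p-prime

  -- The first coordinate of the point carries coefficient 1. Hence a plane has only one triple of
  -- parameters modulo p, and `_≋³_` is equality of points and of planes alike.
  _≋³_ _on_ : ℤ³ → ℤ³ → Set
  (a , b , c) ≋³ (a′ , b′ , c′) = a ≋ a′ × b ≋ b′ × c ≋ c′
  (r , s , t) on (a , b , c) = r ℤ.+ s ℤ.* a ℤ.+ t ℤ.* b ≋ c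

  _≋³?_ : ∀ v w → Dec (v ≋³ w)
  (a , b , c) ≋³? (a′ , b′ , c′) = a ≋? a′ ×-dec b ≋? b′ ×-dec c ≋? c′

  _on?_ : ∀ v w → Dec (v on w)
  (r , s , t) on? (a , b , c) = r ℤ.+ s ℤ.* a ℤ.+ t ℤ.* b ≋? c

  incidences : List ℤ³ → List ℤ³ → ℕ
  incidences X Y = ∑[ x ∈ X ] ∑[ y ∈ Y ] 𝟙 (x on? y)

  coincidences : List ℤ³ → ℕ
  coincidences X = ∑[ x ∈ X ] ∑[ y ∈ X ] 𝟙 (x ≋³? y)

  residues³ : List ℤ³
  residues³ = cartesianProduct residues (cartesianProduct residues residues)

  ∑-residues³ : (f : ℤ³ → ℕ) → ∑ residues³ f ≡
    ∑[ a ∈ residues ] ∑[ b ∈ residues ] ∑[ c ∈ residues ] f (a , b , c)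
  ∑-residues³ f = trans (∑-× residues _ f) (∑-cong residues λ a → ∑-× residues residues _)

  ∑-residues-const : (c : ℕ) → ∑[ _ ∈ residues ] c ≡ p * c
  ∑-residues-const c = trans (∑-const residues c) (cong (_* c) length-residues)

  ∑-residues³≡1 : ∀ v → ∑[ w ∈ residues³ ] 𝟙 (v ≋³? w) ≡ 1
  ∑-residues³≡1 (x , y , z) = begin
    (∑[ w ∈ residues³ ] 𝟙 ((x , y , z) ≋³? w))
      ≡⟨ ∑-residues³ _ ⟩
    (∑[ a ∈ residues ] ∑[ b ∈ residues ] ∑[ c ∈ residues ] 𝟙 (x ≋? a ×-dec y ≋? b ×-dec z ≋? c))
      ≡⟨ ∑-cong residues (λ a → ∑-cong residues λ b → ∑-cong residues λ c →
           trans (𝟙-× (x ≋? a) _) (cong (𝟙 (x ≋? a) *_) (𝟙-× (y ≋? b) (z ≋? c)))) ⟩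
    (∑[ a ∈ residues ] ∑[ b ∈ residues ] ∑[ c ∈ residues ] (𝟙 (x ≋? a) * (𝟙 (y ≋? b) * 𝟙 (z ≋? c))))
      ≡⟨ ∑-cong residues (λ a → trans (∑-cong residues λ b → ∑-*ˡ residues (𝟙 (x ≋? a)) _)
           (∑-*ˡ residues (𝟙 (x ≋? a)) _)) ⟩
    (∑[ a ∈ residues ] (𝟙 (x ≋? a) * (∑[ b ∈ residues ] ∑[ c ∈ residues ] (𝟙 (y ≋? b) * 𝟙 (z ≋? c)))))
      ≡⟨ ∑-*ʳ residues _ _ ⟩
    (∑[ a ∈ residues ] 𝟙 (x ≋? a)) * (∑[ b ∈ residues ] ∑[ c ∈ residues ] (𝟙 (y ≋? b) * 𝟙 (z ≋? c)))
      ≡⟨ cong₂ _*_ (∑-residue≡1 x) (trans (∑-*-∑ residues residues _ _)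
           (cong₂ _*_ (∑-residue≡1 y) (∑-residue≡1 z))) ⟩
    1 ∎
    where open ≡-Reasoning

  multiplicity : List ℤ³ → ℤ³ → ℕ
  multiplicity Y w = ∑[ y ∈ Y ] 𝟙 (y ≋³? w)

  points-on : List ℤ³ → ℤ³ → ℕ
  points-on X w = ∑[ x ∈ X ] 𝟙 (x on? w)

  -- Cauchy-Schwarz runs over each plane of F_p³ once, whereas `Y` may repeat planes modulo p.
  -- Grouping `Y` by residue classes moves between the two; since an entry is replaced by its
  -- representative, `f` has to respect congruence.
  ∑-multiplicity : ∀ Y {f : ℤ³ → ℕ} → (∀ {v w} → v ≋³ w → f v ≡ f w) →
                   ∑[ w ∈ residues³ ] (multiplicity Y w * f w) ≡ ∑ Y f
  ∑-multiplicity Y {f} f-cong = begin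
    (∑[ w ∈ residues³ ] (multiplicity Y w * f w))
      ≡⟨ ∑-cong residues³ (λ w → sym (∑-*ʳ Y (f w) _)) ⟩
    (∑[ w ∈ residues³ ] ∑[ y ∈ Y ] (𝟙 (y ≋³? w) * f w))
      ≡⟨ ∑-swap residues³ Y _ ⟩
    (∑[ y ∈ Y ] ∑[ w ∈ residues³ ] (𝟙 (y ≋³? w) * f w))
      ≡⟨ ∑-cong Y (λ y → ∑-cong residues³ λ w → transfer y w (y ≋³? w)) ⟩
    (∑[ y ∈ Y ] ∑[ w ∈ residues³ ] (𝟙 (y ≋³? w) * f y))
      ≡⟨ ∑-cong Y (λ y → trans (∑-*ʳ residues³ (f y) _)
           (trans (cong (_* f y) (∑-residues³≡1 y)) (*-identityˡ (f y)))) ⟩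
    ∑ Y f ∎
    where
    open ≡-Reasoning
    transfer : ∀ y w (d : Dec (y ≋³ w)) → 𝟙 d * f w ≡ 𝟙 d * f y
    transfer y w (yes y≋w) = cong (1 *_) (sym (f-cong y≋w))
    transfer y w (no _)    = refl

  on-resp : ∀ x {v w} → v ≋³ w → x on v → x on w
  on-resp (r , s , t) (a≋ , b≋ , c≋) x-on-v = ≋-trans
    (≋-+ (≋-+ (≋-refl {r}) (≋-* (≋-refl {s}) (≋-sym a≋))) (≋-* (≋-refl {t}) (≋-sym b≋)))
      (≋-trans x-on-v c≋)

  ≋³-sym : ∀ {v w} → v ≋³ w → w ≋³ v
  ≋³-sym (a≋ , b≋ , c≋) = ≋-sym a≋ , ≋-sym b≋ , ≋-sym c≋

  ≋³-trans : ∀ {u v w} → u ≋³ v → v ≋³ w → u ≋³ w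
  ≋³-trans (a≋ , b≋ , c≋) (d≋ , e≋ , f≋) = ≋-trans a≋ d≋ , ≋-trans b≋ e≋ , ≋-trans c≋ f≋

  points-on-cong : ∀ X {v w} → v ≋³ w → points-on X v ≡ points-on X w
  points-on-cong X v≋w = ∑-cong X λ x →
    𝟙-cong (x on? _) (x on? _) (on-resp x v≋w) (on-resp x (≋³-sym v≋w))

  -- For a given point, every choice of a and b leaves exactly one residue c, so the point lies on
  -- p² planes.
  ∑-points-on : ∀ X → ∑ residues³ (points-on X) ≡ p * p * length X
  ∑-points-on X = begin
    (∑[ w ∈ residues³ ] ∑[ x ∈ X ] 𝟙 (x on? w))
      ≡⟨ ∑-swap residues³ X _ ⟩
    (∑[ x ∈ X ] ∑[ w ∈ residues³ ] 𝟙 (x on? w))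
      ≡⟨ ∑-cong X (λ x → trans (∑-residues³ _) (trans
           (∑-cong residues λ a → trans (∑-cong residues λ b → ∑-residue≡1 _) (∑-residues-const 1))
           (∑-residues-const (p * 1)))) ⟩
    (∑[ x ∈ X ] (p * (p * 1)))
      ≡⟨ ∑-const X _ ⟩
    length X * (p * (p * 1))
      ≡⟨ lemma (length X) p ⟩
    p * p * length X ∎
    where
    open ≡-Reasoning
    lemma : ∀ l p → l * (p * (p * 1)) ≡ p * p * l
    lemma = solve-∀

  ∑-coefficient-unique : ∀ {c c′} r r′ → ¬ c ≋ c′ →
    ∑[ x ∈ residues ] 𝟙 (r ℤ.+ c ℤ.* x ≋? r′ ℤ.+ c′ ℤ.* x) ≤ 1
  ∑-coefficient-unique {c} {c′} r r′ c≉c′ = ≤-trans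
    (∑-mono residues λ x → 𝟙-mono _ ((c ℤ.- c′) ℤ.* x ≋? r′ ℤ.- r) λ h →
      ≋-lin₁ h ℤ.1ℤ (lemma c c′ r r′ x))
    (∑-𝟙-linear distinct-residues (c ℤ.- c′) (r′ ℤ.- r) λ h → c≉c′ (≋-lin₁ h ℤ.1ℤ (lemma′ c c′)))
    where
    lemma : ∀ c c′ r r′ x → (c ℤ.- c′) ℤ.* x ℤ.- (r′ ℤ.- r) ≡
            ℤ.1ℤ ℤ.* ((r ℤ.+ c ℤ.* x) ℤ.- (r′ ℤ.+ c′ ℤ.* x))
    lemma = ℤ.solve-∀
    lemma′ : ∀ c c′ → c ℤ.- c′ ≡ ℤ.1ℤ ℤ.* (c ℤ.- c′ ℤ.- ℤ.0ℤ)
    lemma′ = ℤ.solve-∀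

  value : ℤ³ → ℤ → ℤ → ℤ
  value (r , s , t) a b = r ℤ.+ s ℤ.* a ℤ.+ t ℤ.* b

  -- Equating the two values gives one affine equation in (a , b). If `t` or `s` differs modulo p,
  -- it solves for b or for a and has at most p solutions. Otherwise only the constants `r` and `r′`
  -- remain: they disagree everywhere unless v and w coincide, when p² is the trivial bound.
  ∑-common-line : ∀ v w → ∑[ a ∈ residues ] ∑[ b ∈ residues ] 𝟙 (value v a b ≋? value w a b) ≤
                  p + p * p * 𝟙 (v ≋³? w)
  ∑-common-line v@(r , s , t) w@(r′ , s′ , t′) with t ≋? t′ | s ≋? s′ | v ≋³? w
  ... | no t≉t′ | _ | d = ≤-trans (∑-≤-const residues 1 λ a → ∑-coefficient-unique (r ℤ.+ s ℤ.* a)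
    (r′ ℤ.+ s′ ℤ.* a) t≉t′)
    (≤-trans (≤-reflexive (trans (*-identityʳ _) length-residues)) (m≤m+n p _))
  ... | yes t≋t′ | no s≉s′ | d = begin
    (∑[ a ∈ residues ] ∑[ b ∈ residues ] 𝟙 (value v a b ≋? value w a b))
      ≡⟨ ∑-swap residues residues _ ⟩
    (∑[ b ∈ residues ] ∑[ a ∈ residues ] 𝟙 (value v a b ≋? value w a b))
      ≤⟨ ∑-≤-const residues 1 (λ b → ≤-trans
           (∑-mono residues λ a → 𝟙-mono _ _ λ h → ≋-lin₂ h (≋-refl {ℤ.0ℤ}) ℤ.1ℤ ℤ.0ℤ
             (lemma r s t r′ s′ t′ a b))
           (∑-coefficient-unique (r ℤ.+ t ℤ.* b) (r′ ℤ.+ t′ ℤ.* b) s≉s′)) ⟩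
    length residues * 1
      ≡⟨ trans (*-identityʳ _) length-residues ⟩
    p
      ≤⟨ m≤m+n p _ ⟩
    p + p * p * 𝟙 d ∎
    where
    open ≤-Reasoning
    lemma : ∀ r s t r′ s′ t′ a b → (r ℤ.+ t ℤ.* b ℤ.+ s ℤ.* a) ℤ.- (r′ ℤ.+ t′ ℤ.* b ℤ.+ s′ ℤ.* a) ≡
      ℤ.1ℤ ℤ.* ((r ℤ.+ s ℤ.* a ℤ.+ t ℤ.* b) ℤ.- (r′ ℤ.+ s′ ℤ.* a ℤ.+ t′ ℤ.* b)) ℤ.+
        ℤ.0ℤ ℤ.* (ℤ.0ℤ ℤ.- ℤ.0ℤ)
    lemma = ℤ.solve-∀
  ... | yes t≋t′ | yes s≋s′ | yes v≋w = ≤-trans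
    (∑-≤-const residues p λ a → ≤-trans (∑-≤-const residues 1 λ b → 𝟙≤1 _)
      (≤-reflexive (trans (*-identityʳ _) length-residues)))
    (≤-trans (≤-reflexive (trans (cong (_* p) length-residues) (sym (*-identityʳ (p * p))))) (m≤n+m _ p))
  ... | yes t≋t′ | yes s≋s′ | no v≉w = ≤-trans
    (≤-reflexive (trans (∑-cong residues λ a → trans (∑-cong residues λ b → 𝟙-false _ (r≉r′ a b))
      (trans (∑-const residues 0) (*-zeroʳ (length residues))))
      (trans (∑-const residues 0) (*-zeroʳ (length residues))))) z≤n
    where
    lemma : ∀ r s t r′ s′ t′ a b → r ℤ.- r′ ≡
      ℤ.1ℤ ℤ.* ((r ℤ.+ s ℤ.* a ℤ.+ t ℤ.* b) ℤ.- (r′ ℤ.+ s′ ℤ.* a ℤ.+ t′ ℤ.* b)) ℤ.+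
      ℤ.-1ℤ ℤ.* ((s ℤ.* a ℤ.+ t ℤ.* b) ℤ.- (s′ ℤ.* a ℤ.+ t′ ℤ.* b))
    lemma = ℤ.solve-∀
    r≉r′ : ∀ a b → ¬ value v a b ≋ value w a b
    r≉r′ a b h = v≉w
      ( ≋-lin₂ h (≋-+ (≋-* s≋s′ (≋-refl {a})) (≋-* t≋t′ (≋-refl {b}))) ℤ.1ℤ ℤ.-1ℤ
        (lemma r s t r′ s′ t′ a b)
      , s≋s′ , t≋t′)

  ∑-points-on² : ∀ X → ∑[ w ∈ residues³ ] (points-on X w * points-on X w) ≤
                 p * (length X * length X) + p * p * coincidences X
  ∑-points-on² X = begin
    (∑[ w ∈ residues³ ] (points-on X w * points-on X w))
      ≡⟨ ∑-cong residues³ (λ w → sym (∑-*-∑ X X _ _)) ⟩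
    (∑[ w ∈ residues³ ] ∑[ x ∈ X ] ∑[ y ∈ X ] (𝟙 (x on? w) * 𝟙 (y on? w)))
      ≡⟨ trans (∑-swap residues³ X _) (∑-cong X λ x → ∑-swap residues³ X _) ⟩
    (∑[ x ∈ X ] ∑[ y ∈ X ] ∑[ w ∈ residues³ ] (𝟙 (x on? w) * 𝟙 (y on? w)))
      ≤⟨ ∑-mono X (λ x → ∑-mono X λ y → common-planes x y) ⟩
    (∑[ x ∈ X ] ∑[ y ∈ X ] (p + p * p * 𝟙 (x ≋³? y)))
      ≡⟨ ∑-cong X (λ x → trans (∑-+ X _ _) (cong₂ _+_ (∑-const X p) (∑-*ˡ X (p * p) _))) ⟩
    (∑[ x ∈ X ] (length X * p + p * p * (∑[ y ∈ X ] 𝟙 (x ≋³? y))))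
      ≡⟨ trans (∑-+ X _ _) (cong₂ _+_ (∑-const X (length X * p)) (∑-*ˡ X (p * p) λ x →
           ∑[ y ∈ X ] 𝟙 (x ≋³? y))) ⟩
    length X * (length X * p) + p * p * coincidences X
      ≡⟨ cong (_+ p * p * coincidences X) (lemma (length X) p) ⟩
    p * (length X * length X) + p * p * coincidences X ∎
    where
    open ≤-Reasoning
    lemma : ∀ l p → l * (l * p) ≡ p * (l * l)
    lemma = solve-∀
    common-planes : ∀ x y → ∑[ w ∈ residues³ ] (𝟙 (x on? w) * 𝟙 (y on? w)) ≤ p + p * p * 𝟙 (x ≋³? y)
    common-planes x y = begin
      (∑[ w ∈ residues³ ] (𝟙 (x on? w) * 𝟙 (y on? w)))
        ≡⟨ ∑-residues³ _ ⟩
      (∑[ a ∈ residues ] ∑[ b ∈ residues ] ∑[ c ∈ residues ]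
        (𝟙 (value x a b ≋? c) * 𝟙 (value y a b ≋? c)))
        ≤⟨ ∑-mono residues (λ a → ∑-mono residues λ b → common-value (value x a b) (value y a b)) ⟩
      (∑[ a ∈ residues ] ∑[ b ∈ residues ] 𝟙 (value x a b ≋? value y a b))
        ≤⟨ ∑-common-line x y ⟩
      p + p * p * 𝟙 (x ≋³? y) ∎
      where
      common-value : ∀ u v → ∑[ c ∈ residues ] (𝟙 (u ≋? c) * 𝟙 (v ≋? c)) ≤ 𝟙 (u ≋? v)
      common-value u v = begin
        (∑[ c ∈ residues ] (𝟙 (u ≋? c) * 𝟙 (v ≋? c)))
          ≤⟨ ∑-mono residues (λ c → pointwise c) ⟩
        (∑[ c ∈ residues ] (𝟙 (u ≋? c) * 𝟙 (u ≋? v)))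
          ≡⟨ ∑-*ʳ residues (𝟙 (u ≋? v)) _ ⟩
        (∑[ c ∈ residues ] 𝟙 (u ≋? c)) * 𝟙 (u ≋? v)
          ≡⟨ trans (cong (_* 𝟙 (u ≋? v)) (∑-residue≡1 u)) (*-identityˡ _) ⟩
        𝟙 (u ≋? v) ∎
        where
        pointwise : ∀ c → 𝟙 (u ≋? c) * 𝟙 (v ≋? c) ≤ 𝟙 (u ≋? c) * 𝟙 (u ≋? v)
        pointwise c with u ≋? c
        ... | no _    = z≤n
        ... | yes u≋c = *-monoʳ-≤ 1 (𝟙-mono (v ≋? c) (u ≋? v) λ v≋c → ≋-trans u≋c (≋-sym v≋c))

  -- With l points the mean over the p³ planes is l / p. In the expansion of the squares the terms
  -- p³ l² cancel, and what survives is p⁴ times the number of coincidences. The cross term is added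
  -- to both sides instead of being subtracted.
  variance : ∀ X → ∑[ w ∈ residues³ ] (∣ p * points-on X w - length X ∣ * ∣ p * points-on X w - length X
    ∣) ≤
             p * p * (p * p) * coincidences X
  variance X = +-cancelʳ-≤ (2 * (p * l * S)) _ _ (begin
    (∑[ w ∈ residues³ ] (φ w * φ w)) + 2 * (p * l * S)
      ≡⟨ cong (λ z → V + z) (trans (sym (*-assoc 2 (p * l) S)) (sym (∑-*ˡ residues³ (2 * (p * l)) P))) ⟩
    V + (∑[ w ∈ residues³ ] (2 * (p * l) * P w))
      ≡⟨ sym (∑-+ residues³ _ _) ⟩
    (∑[ w ∈ residues³ ] (φ w * φ w + 2 * (p * l) * P w))
      ≡⟨ ∑-cong residues³ (λ w → trans (cong (λ z → φ w * φ w + z) (lemma₁ p l (P w)))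
           (trans (∣m-n∣²+2mn (p * P w) l) (lemma₂ p l (P w)))) ⟩
    (∑[ w ∈ residues³ ] (p * p * (P w * P w) + l * l))
      ≡⟨ trans (∑-+ residues³ _ _) (cong₂ _+_ (∑-*ˡ residues³ (p * p) _)
           (trans (∑-residues³ _) (trans (∑-cong residues λ _ →
             trans (∑-cong residues λ _ → ∑-residues-const _) (∑-residues-const _))
             (∑-residues-const _)))) ⟩
    p * p * (∑[ w ∈ residues³ ] (P w * P w)) + p * (p * (p * (l * l)))
      ≤⟨ +-monoˡ-≤ _ (*-monoʳ-≤ (p * p) (∑-points-on² X)) ⟩
    p * p * (p * (l * l) + p * p * coincidences X) + p * (p * (p * (l * l)))
      ≡⟨ lemma₃ p l (coincidences X) ⟩
    p * p * (p * p) * coincidences X + 2 * (p * l * (p * p * l))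
      ≡⟨ cong (λ z → p * p * (p * p) * coincidences X + 2 * (p * l * z)) (sym (∑-points-on X)) ⟩
    p * p * (p * p) * coincidences X + 2 * (p * l * S) ∎)
    where
    open ≤-Reasoning
    P = points-on X
    S = ∑ residues³ P
    l = length X
    φ : ℤ³ → ℕ
    φ w = ∣ p * P w - l ∣
    V = ∑[ w ∈ residues³ ] (φ w * φ w)
    lemma₁ : ∀ p l x → 2 * (p * l) * x ≡ 2 * (p * x * l)
    lemma₁ = solve-∀
    lemma₂ : ∀ p l x → p * x * (p * x) + l * l ≡ p * p * (x * x) + l * l
    lemma₂ = solve-∀
    lemma₃ : ∀ p l c → p * p * (p * (l * l) + p * p * c) + p * (p * (p * (l * l))) ≡
             p * p * (p * p) * c + 2 * (p * l * (p * p * l))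
    lemma₃ = solve-∀

  -- The deviation is a sum over all planes of multiplicity in `Y` times the centred number of
  -- points. Cauchy-Schwarz separates the two factors: the squared multiplicities add up to the
  -- coincidences of `Y`, and the other factor is the variance.
  incidence-bound : ∀ X Y →
    ∣ p * incidences X Y - length X * length Y ∣ * ∣ p * incidences X Y - length X * length Y ∣ ≤
    p * p * (p * p) * (coincidences X * coincidences Y)
  incidence-bound X Y = begin
    ∣ p * incidences X Y - length X * length Y ∣ * ∣ p * incidences X Y - length X * length Y ∣
      ≤⟨ *-mono-≤ deviation deviation ⟩
    (∑[ w ∈ residues³ ] (f w * φ w)) * (∑[ w ∈ residues³ ] (f w * φ w))
      ≤⟨ cauchy-schwarz residues³ f φ ⟩
    (∑[ w ∈ residues³ ] (f w * f w)) * (∑[ w ∈ residues³ ] (φ w * φ w))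
      ≤⟨ *-mono-≤ (≤-reflexive f²) (variance X) ⟩
    coincidences Y * (p * p * (p * p) * coincidences X)
      ≡⟨ lemma (p * p * (p * p)) (coincidences X) (coincidences Y) ⟩
    p * p * (p * p) * (coincidences X * coincidences Y) ∎
    where
    open ≤-Reasoning
    f φ : ℤ³ → ℕ
    f = multiplicity Y
    φ w = ∣ p * points-on X w - length X ∣
    lemma : ∀ q x y → y * (q * x) ≡ q * (x * y)
    lemma = solve-∀
    f² : ∑[ w ∈ residues³ ] (f w * f w) ≡ coincidences Y
    f² = trans (∑-multiplicity Y λ v≋w → ∑-cong Y λ y → 𝟙-cong (y ≋³? _) (y ≋³? _)
                  (λ y≋v → ≋³-trans y≋v v≋w) (λ y≋w → ≋³-trans y≋w (≋³-sym v≋w)))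
               (∑-swap Y Y _)
    total : p * incidences X Y ≡ ∑[ w ∈ residues³ ] (f w * (p * points-on X w))
    total = sym (trans (∑-multiplicity Y λ v≋w → cong (p *_) (points-on-cong X v≋w))
      (trans (∑-*ˡ Y p _) (cong (p *_) (∑-swap Y X _))))
    mean : length X * length Y ≡ ∑[ w ∈ residues³ ] (f w * length X)
    mean = sym (trans (∑-multiplicity Y λ _ → refl) (trans (∑-const Y _) (*-comm (length Y) _)))
    deviation : ∣ p * incidences X Y - length X * length Y ∣ ≤ ∑[ w ∈ residues³ ] (f w * φ w)
    deviation = begin
      ∣ p * incidences X Y - length X * length Y ∣
        ≡⟨ cong₂ ∣_-_∣ total mean ⟩
      ∣ ∑[ w ∈ residues³ ] (f w * (p * points-on X w)) - ∑[ w ∈ residues³ ] (f w * length X) ∣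
        ≤⟨ ∣∑-∑∣≤∑∣-∣ residues³ _ _ ⟩
      (∑[ w ∈ residues³ ] ∣ f w * (p * points-on X w) - f w * length X ∣)
        ≡⟨ ∑-cong residues³ (λ w → sym (*-distribˡ-∣-∣ (f w) _ _)) ⟩
      (∑[ w ∈ residues³ ] (f w * φ w)) ∎

-- Divisor sums and the integer equation a b = c d.

-- Double counting of related pairs: each solution accounts for at least one of them, and each `y`
-- for at most `f y`. With a relation in place of a map, parametrisations need not be unique.
∑-transport : {P : A → Set} {R : A → B → Set} (P? : Decidable P) (R? : ∀ x y → Dec (R x y))
  {xs : List A} {ys : List B} (f : B → ℕ) →
  (∀ {x} → x ∈ xs → P x → ∃ λ y → y ∈ ys × R x y) →
  (∀ y → ∑[ x ∈ xs ] 𝟙 (R? x y) ≤ f y) →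
  ∑[ x ∈ xs ] 𝟙 (P? x) ≤ ∑ ys f
∑-transport P? R? {xs} {ys} f total few = begin
  (∑[ x ∈ xs ] 𝟙 (P? x))
    ≤⟨ ∑-mono∈ xs (λ {x} x∈ → 𝟙-≤ (P? x) λ px → witness x (total x∈ px)) ⟩
  (∑[ x ∈ xs ] ∑[ y ∈ ys ] 𝟙 (R? x y))
    ≡⟨ ∑-swap xs ys _ ⟩
  (∑[ y ∈ ys ] ∑[ x ∈ xs ] 𝟙 (R? x y))
    ≤⟨ ∑-mono ys few ⟩
  ∑ ys f ∎
  where
  open ≤-Reasoning
  witness : ∀ x → (∃ λ y → y ∈ ys × _) → 1 ≤ ∑[ y ∈ ys ] 𝟙 (R? x y)
  witness x (y , y∈ , r) = ≤-trans (≤-reflexive (sym (𝟙-true (R? x y) r)))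
    (∑-≥-term (λ y → 𝟙 (R? x y)) y∈)

∑-𝟙-≡ : (_≟ᴬ_ : DecidableEquality A) {xs : List A} → Unique xs → ∀ y → ∑[ x ∈ xs ] 𝟙 (x ≟ᴬ y) ≤ 1
∑-𝟙-≡ _≟ᴬ_ unique y = ∑-𝟙-unique (_≟ᴬ y) (AllPairs.map (λ { x≢x′ (refl , refl) → x≢x′ refl }) unique)

∑-upTo-𝟙 : {P : ℕ → Set} (P? : Decidable P) (h : ℕ → ℕ) (n m : ℕ) → (∀ {x} → P x → h x < m) →
           (∀ {x y} → P x → P y → h x ≡ h y → x ≡ y) → ∑[ x ∈ upTo n ] 𝟙 (P? x) ≤ m
∑-upTo-𝟙 P? h n m h< h-injective = ≤-trans
  (∑-transport P? (λ x y → P? x ×-dec h x ≟ y) {upTo n} {upTo m} (λ _ → 1)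
    (λ {x} _ px → h x , ∈-upTo⁺ (h< px) , px , refl)
    (λ y → ∑-𝟙-unique _ (AllPairs.map
      (λ { x≢x′ ((px , e) , (px′ , e′)) → x≢x′ (h-injective px px′ (trans e (sym e′))) }) (upTo⁺ n))))
  (≤-reflexive (trans (∑-const (upTo m) 1) (trans (*-identityʳ _) (length-upTo m))))

digits : ∀ s j {g} → 1 ≤ g → g < s ^ j → ∃ λ i → i < j × s ^ i ≤ g × g < s ^ suc i
digits s zero    1≤g g<1 = contradiction g<1 (≤⇒≯ 1≤g)
digits s (suc j) {g} 1≤g g<s^ with g <? s ^ j
... | no g≮s^j  = j , ≤-refl , ≮⇒≥ g≮s^j , g<s^
... | yes g<s^j with i , i<j , bounds ← digits s j 1≤g g<s^j = i , m≤n⇒m≤1+n i<j , bounds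

-- Lattice points under the hyperbola g u < n: the summatory divisor function, together with the
-- points on the axes g = 0 and u = 0.
divisorSum : ℕ → ℕ
divisorSum n = ∑[ g ∈ upTo n ] ∑[ u ∈ upTo n ] 𝟙 (g * u <? n)

-- Split g ≥ 1 into the blocks [s^i , s^(i+1)): in each, s^i u ≤ g u < n leaves at
-- most n / s^i values u ≥ 1.
divisorSum-bound : ∀ n s j → n ≤ s ^ j → divisorSum n ≤ 2 * n + j * (s * n)
divisorSum-bound n s j n≤s^j = begin
  divisorSum n
    ≤⟨ ∑-mono∈ (upTo n) (λ g∈ → ∑-mono (upTo n) λ u → 𝟙-≤ (_ <? n) (pointwise _ u (∈-upTo⁻ g∈))) ⟩
  (∑[ g ∈ upTo n ] ∑[ u ∈ upTo n ] (𝟙 (g ≟ 0) + 𝟙 (u ≟ 0) + (∑[ i ∈ upTo j ] (low i g * high i u))))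
    ≡⟨ trans (∑∑-+ (upTo n) (upTo n) _ _)
         (cong (λ z → z + (∑[ g ∈ upTo n ] ∑[ u ∈ upTo n ] ∑[ i ∈ upTo j ] (low i g * high i u)))
         (∑∑-+ (upTo n) (upTo n) (λ g _ → 𝟙 (g ≟ 0)) λ _ u → 𝟙 (u ≟ 0))) ⟩
  (∑[ g ∈ upTo n ] ∑[ u ∈ upTo n ] 𝟙 (g ≟ 0)) + (∑[ g ∈ upTo n ] ∑[ u ∈ upTo n ] 𝟙 (u ≟ 0)) +
  (∑[ g ∈ upTo n ] ∑[ u ∈ upTo n ] ∑[ i ∈ upTo j ] (low i g * high i u))
    ≤⟨ +-mono-≤ (+-mono-≤ (≤-trans (≤-reflexive (∑-swap (upTo n) (upTo n) λ g _ → 𝟙 (g ≟ 0))) column)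
         column) blocks ⟩
  n + n + j * (s * n)
    ≡⟨ cong (λ z → z + j * (s * n)) (cong (λ z → n + z) (sym (+-identityʳ n))) ⟩
  2 * n + j * (s * n) ∎
  where
  open ≤-Reasoning
  low high : ℕ → ℕ → ℕ
  low i g = 𝟙 (g <? s ^ suc i)
  high i u = 𝟙 (1 ≤? u ×-dec u * s ^ i <? n)

  column : ∑[ _ ∈ upTo n ] ∑[ u ∈ upTo n ] 𝟙 (u ≟ 0) ≤ n
  column = ≤-trans (∑-≤-const (upTo n) 1 λ _ → ∑-𝟙-≡ _≟_ (upTo⁺ n) 0)
                   (≤-reflexive (trans (*-identityʳ _) (length-upTo n)))

  pointwise : ∀ g u → g < n → g * u < n → 1 ≤
    𝟙 (g ≟ 0) + 𝟙 (u ≟ 0) + (∑[ i ∈ upTo j ] (low i g * high i u))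
  pointwise zero      u         _   _    = s≤s z≤n
  pointwise (suc g-1) zero      _   _    = s≤s z≤n
  pointwise g@(suc _) u@(suc _) g<n gu<n with i , i<j , s^i≤g , g<s^ ← digits s j {g} (s≤s z≤n)
    (<-≤-trans g<n n≤s^j) =
    ≤-trans (≤-reflexive (sym (cong₂ _*_ (𝟙-true (g <? s ^ suc i) g<s^)
               (𝟙-true (1 ≤? u ×-dec u * s ^ i <? n)
                 (s≤s z≤n , ≤-<-trans (≤-trans (*-monoʳ-≤ u s^i≤g) (≤-reflexive (*-comm u g))) gu<n)))))
            (∑-≥-term (λ i → low i g * high i u) (∈-upTo⁺ i<j))

  high-count : ∀ i → s ^ i * (∑[ u ∈ upTo n ] high i u) ≤ n
  high-count i with s ^ i in eq
  ... | zero        = z≤n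
  ... | S@(suc S-1) = begin
    S * (∑[ u ∈ upTo n ] 𝟙 (1 ≤? u ×-dec u * S <? n))
      ≤⟨ *-monoʳ-≤ S (∑-upTo-𝟙 (λ u → 1 ≤? u ×-dec u * S <? n) pred n (pred n / S) pred<
           pred-injective′) ⟩
    S * (pred n / S)
      ≡⟨ *-comm S (pred n / S) ⟩
    pred n / S * S
      ≤⟨ m/n*n≤m (pred n) S ⟩
    pred n
      ≤⟨ pred[n]≤n ⟩
    n ∎
    where
    -- Counting u - 1 instead of u excludes u = 0. Otherwise the count would be one larger, and
    -- after multiplication by S it would no longer stay below n for large blocks.
    pred< : ∀ {u} → 1 ≤ u × u * S < n → pred u < pred n / S
    pred< {suc u} (_ , uS<n) = ≤-trans (≤-reflexive (sym (m*n/n≡m (suc u) S)))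
      (/-monoˡ-≤ S (<⇒≤pred uS<n))
    pred-injective′ : ∀ {u v} → 1 ≤ u × u * S < n → 1 ≤ v × v * S < n → pred u ≡ pred v → u ≡ v
    pred-injective′ {suc _} {suc _} _ _ = cong suc

  blocks : ∑[ g ∈ upTo n ] ∑[ u ∈ upTo n ] ∑[ i ∈ upTo j ] (low i g * high i u) ≤ j * (s * n)
  blocks = begin
    (∑[ g ∈ upTo n ] ∑[ u ∈ upTo n ] ∑[ i ∈ upTo j ] (low i g * high i u))
      ≡⟨ trans (∑-cong (upTo n) λ g → ∑-swap (upTo n) (upTo j) _) (∑-swap (upTo n) (upTo j) _) ⟩
    (∑[ i ∈ upTo j ] ∑[ g ∈ upTo n ] ∑[ u ∈ upTo n ] (low i g * high i u))
      ≡⟨ ∑-cong (upTo j) (λ i → ∑-*-∑ (upTo n) (upTo n) (low i) (high i)) ⟩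
    (∑[ i ∈ upTo j ] (∑ (upTo n) (low i) * ∑ (upTo n) (high i)))
      ≤⟨ ∑-≤-const (upTo j) (s * n) block ⟩
    length (upTo j) * (s * n)
      ≡⟨ cong (_* (s * n)) (length-upTo j) ⟩
    j * (s * n) ∎
    where
    block : ∀ i → ∑ (upTo n) (low i) * ∑ (upTo n) (high i) ≤ s * n
    block i = begin
      ∑ (upTo n) (low i) * ∑ (upTo n) (high i)
        ≤⟨ *-monoˡ-≤ (∑ (upTo n) (high i)) (∑-upTo-𝟙 (_<? s ^ suc i) (λ g → g) n (s ^ suc i) (λ g< → g<)
             λ _ _ e → e) ⟩
      s * s ^ i * ∑ (upTo n) (high i)
        ≡⟨ *-assoc s (s ^ i) _ ⟩
      s * (s ^ i * ∑ (upTo n) (high i))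
        ≤⟨ *-monoʳ-≤ s (high-count i) ⟩
      s * n ∎

Factorisation : ℕ → (a b c d : ℕ) → Set
Factorisation n a b c d = ∃ λ g → ∃ λ u → ∃ λ w → ∃ λ h →
  (g < n × u < n × w < n × h < n) × a ≡ g * u × b ≡ w * h × c ≡ g * w × d ≡ u * h

-- For c > 0 take g = gcd(a , c), a = g u and c = g w. Then u b = w d with u and w coprime, so w
-- divides b, and h is the quotient.
factorisation : ∀ {n a b c d} → 1 < n → a < n → b < n → c < n → d < n → a * b ≡ c * d →
  Factorisation n a b c d
factorisation {a = zero} {b} {zero} {d} 1<n a<n b<n c<n d<n _ =
  0 , d , b , 1 , (a<n , d<n , b<n , 1<n) , refl , sym (*-identityʳ b) , refl , sym (*-identityʳ d)
factorisation {a = a@(suc _)} {b} {zero} {d} 1<n a<n b<n c<n d<n ab≡0 =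
  a , 1 , 0 , d , (a<n , 1<n , c<n , d<n) , sym (*-identityʳ a) , m*n≡0⇒m≡0 b a
    (trans (*-comm b a) ab≡0) ,
  sym (*-zeroʳ a) , sym (*-identityˡ d)
factorisation {n} {a} {b} {c@(suc _)} {d} 1<n a<n b<n c<n d<n ab≡cd = result
  where
  g : ℕ
  g = gcd a c
  instance
    g≢0 : NonZero g
    g≢0 = ≢-nonZero (gcd[m,n]≢0 a c (inj₂ λ ()))
  coprime : ∀ u w → a ≡ u * g → c ≡ w * g → Coprime u w
  coprime u w a≡ug c≡wg = GCD≡1⇒coprime (GCD-* (subst₂ (λ x y → GCD x y (1 * g)) a≡ug c≡wg
    (subst (GCD a c) (sym (*-identityˡ g)) (gcd-GCD a c))))
  ub≡wd : ∀ u w → a ≡ u * g → c ≡ w * g → u * b ≡ w * d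
  ub≡wd u w a≡ug c≡wg = *-cancelˡ-≡ (u * b) (w * d) g (begin
    g * (u * b) ≡⟨ lemma g u b ⟩
    u * g * b   ≡⟨ cong (_* b) (sym a≡ug) ⟩
    a * b       ≡⟨ ab≡cd ⟩
    c * d       ≡⟨ cong (_* d) c≡wg ⟩
    w * g * d   ≡⟨ sym (lemma g w d) ⟩
    g * (w * d) ∎)
    where
    open ≡-Reasoning
    lemma : ∀ x y z → x * (y * z) ≡ y * x * z
    lemma = solve-∀
  factor< : ∀ {x y z} → .{{NonZero z}} → x ≡ y * z → x < n → y < n
  factor< {y = y} {z} refl x<n = ≤-<-trans (m≤m*n y z) x<n
  rearrange : ∀ x y z → x * (y * z) ≡ z * (x * y)
  rearrange = solve-∀
  result : Factorisation n a b c d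
  result
    with divides u a≡ug ← gcd[m,n]∣m a c | divides w@(suc _) c≡wg ← gcd[m,n]∣n a c
    with divides h b≡hw ← coprime-divisor {w} {u} {b} (Coprime.sym (coprime u w a≡ug c≡wg))
      (divides d (trans (ub≡wd u w a≡ug c≡wg) (*-comm w d)))
    = g , u , w , h ,
      (≤-<-trans (∣⇒≤ (gcd[m,n]∣n a c)) c<n , factor< a≡ug a<n , factor< c≡wg c<n , factor< b≡hw b<n) ,
      trans a≡ug (*-comm u g) , trans b≡hw (*-comm h w) , trans c≡wg (*-comm w g) ,
      *-cancelˡ-≡ d (u * h) w (trans (sym (ub≡wd u w a≡ug c≡wg))
        (trans (cong (u *_) b≡hw) (rearrange u h w)))

energy : ℕ → ℕ
energy n = ∑[ a ∈ upTo n ] ∑[ c ∈ upTo n ] ∑[ b ∈ upTo n ] ∑[ d ∈ upTo n ] 𝟙 (a * b ≟ c * d)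

-- Of the four size conditions on a, b, c, d only g u = a < n and w h = b < n are kept. They involve
-- disjoint pairs of parameters, so the count splits into two divisor sums.
energy-bound : ∀ {n} → 1 < n → energy n ≤ divisorSum n * divisorSum n
energy-bound {n} 1<n = begin
  energy n
    ≡⟨ sym (∑-quadruples λ a c b d → 𝟙 (a * b ≟ c * d)) ⟩
  (∑[ q ∈ quadruples ] 𝟙 (solution? q))
    ≤⟨ ∑-transport {R = R} solution? R? {quadruples} {quadruples} weight parametrise (λ y → few y) ⟩
  ∑ quadruples weight
    ≡⟨ ∑-quadruples (λ g u w h → 𝟙 (g * u <? n) * 𝟙 (w * h <? n)) ⟩
  (∑[ g ∈ upTo n ] ∑[ u ∈ upTo n ] ∑[ w ∈ upTo n ] ∑[ h ∈ upTo n ] (𝟙 (g * u <? n) * 𝟙 (w * h <? n)))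
    ≡⟨ ∑-cong (upTo n) (λ g → ∑-cong (upTo n) λ u →
         trans (∑-cong (upTo n) λ w → ∑-*ˡ (upTo n) (𝟙 (g * u <? n)) _)
         (∑-*ˡ (upTo n) (𝟙 (g * u <? n)) _)) ⟩
  (∑[ g ∈ upTo n ] ∑[ u ∈ upTo n ] (𝟙 (g * u <? n) * divisorSum n))
    ≡⟨ trans (∑-cong (upTo n) λ g → ∑-*ʳ (upTo n) (divisorSum n) _) (∑-*ʳ (upTo n) (divisorSum n) _) ⟩
  divisorSum n * divisorSum n ∎
  where
  open ≤-Reasoning
  ℕ⁴ : Set
  ℕ⁴ = ℕ × ℕ × ℕ × ℕ
  _≟⁴_ : DecidableEquality ℕ⁴
  _≟⁴_ = ≡-dec _≟_ (≡-dec _≟_ (≡-dec _≟_ _≟_))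
  quadruples : List ℕ⁴
  quadruples = cartesianProduct (upTo n) (cartesianProduct (upTo n) (cartesianProduct (upTo n) (upTo n)))
  unique : Unique quadruples
  unique = cartesianProduct⁺ (upTo⁺ n)
    (cartesianProduct⁺ (upTo⁺ n) (cartesianProduct⁺ (upTo⁺ n) (upTo⁺ n)))
  ∑-quadruples : (f : ℕ → ℕ → ℕ → ℕ → ℕ) → ∑[ q ∈ quadruples ] (let (a , c , b , d) = q in f a c b d) ≡
    ∑[ a ∈ upTo n ] ∑[ c ∈ upTo n ] ∑[ b ∈ upTo n ] ∑[ d ∈ upTo n ] f a c b d
  ∑-quadruples f = trans (∑-× (upTo n) _ _) (∑-cong (upTo n) λ a →
    trans (∑-× (upTo n) _ _) (∑-cong (upTo n) λ c → ∑-× (upTo n) (upTo n) _))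
  ∈-quadruples : ∀ {a c b d} → a < n → c < n → b < n → d < n → (a , c , b , d) ∈ quadruples
  ∈-quadruples a< c< b< d< = ∈-cartesianProduct⁺ (∈-upTo⁺ a<) (∈-cartesianProduct⁺ (∈-upTo⁺ c<)
    (∈-cartesianProduct⁺ (∈-upTo⁺ b<) (∈-upTo⁺ d<)))
  solution? : Decidable λ ((a , c , b , d) : ℕ⁴) → a * b ≡ c * d
  solution? (a , c , b , d) = a * b ≟ c * d
  products : ℕ⁴ → ℕ⁴
  products (g , u , w , h) = g * u , g * w , w * h , u * h
  R : ℕ⁴ → ℕ⁴ → Set
  R q y@(g , u , w , h) = q ≡ products y × g * u < n × w * h < n
  R? : ∀ q y → Dec (R q y)
  R? q y@(g , u , w , h) = q ≟⁴ products y ×-dec (g * u <? n ×-dec w * h <? n)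
  weight : ℕ⁴ → ℕ
  weight (g , u , w , h) = 𝟙 (g * u <? n) * 𝟙 (w * h <? n)
  parametrise : ∀ {q} → q ∈ quadruples → (let (a , c , b , d) = q in a * b ≡ c * d) → ∃ λ y → y ∈ quadruples × R q y
  parametrise {a , c , b , d} q∈ ab≡cd
    with a∈ , q∈ ← ∈-cartesianProduct⁻ (upTo n) _ q∈
    with c∈ , q∈ ← ∈-cartesianProduct⁻ (upTo n) _ q∈
    with b∈ , d∈ ← ∈-cartesianProduct⁻ (upTo n) (upTo n) q∈
    with g , u , w , h , (g< , u< , w< , h<) , refl , refl , refl , refl
      ← factorisation 1<n (∈-upTo⁻ a∈) (∈-upTo⁻ b∈) (∈-upTo⁻ c∈) (∈-upTo⁻ d∈) ab≡cd
    = (g , u , w , h) , ∈-quadruples g< u< w< h< , refl , ∈-upTo⁻ a∈ , ∈-upTo⁻ b∈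
  few : ∀ y → ∑[ q ∈ quadruples ] 𝟙 (R? q y) ≤ weight y
  few y@(g , u , w , h) = begin
    (∑[ q ∈ quadruples ] 𝟙 (R? q y))
      ≡⟨ ∑-cong quadruples (λ q → trans (𝟙-× (q ≟⁴ products y) _)
           (cong (𝟙 (q ≟⁴ products y) *_) (𝟙-× (g * u <? n) (w * h <? n)))) ⟩
    (∑[ q ∈ quadruples ] (𝟙 (q ≟⁴ products y) * weight y))
      ≡⟨ ∑-*ʳ quadruples (weight y) _ ⟩
    (∑[ q ∈ quadruples ] 𝟙 (q ≟⁴ products y)) * weight y
      ≤⟨ *-monoˡ-≤ (weight y) (∑-𝟙-≡ _≟⁴_ unique (products y)) ⟩
    1 * weight y
      ≡⟨ *-identityˡ (weight y) ⟩
    weight y ∎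

-- Multiplicative energy of an interval modulo p.

∣+m-+n∣ : ∀ m n → ∣ + m ℤ.- + n ∣ ≡ ∣ m - n ∣
∣+m-+n∣ m n with ≤-total m n
... | inj₁ m≤n with d , refl ← m≤n⇒∃[o]m+o≡n m≤n =
  trans (cong ∣_∣ (lemma (+ m) (+ d))) (trans (ℤ.∣-i∣≡∣i∣ (+ d)) (sym (∣m-m+n∣≡n m d)))
  where
  lemma : ∀ m d → m ℤ.- (m ℤ.+ d) ≡ ℤ.- d
  lemma = ℤ.solve-∀
... | inj₂ n≤m with d , refl ← m≤n⇒∃[o]m+o≡n n≤m =
  trans (cong ∣_∣ (lemma (+ n) (+ d))) (sym (trans (∣-∣-comm (n + d) n) (∣m-m+n∣≡n n d)))
  where
  lemma : ∀ n d → n ℤ.+ d ℤ.- n ≡ d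
  lemma = ℤ.solve-∀

∈-interval⁻ : ∀ {H x} → x ∈ interval H → ∣ x ∣ ≤ H
∈-interval⁻ {H} x∈ with i , i∈ , refl ← ∈-map⁻ _ x∈ =
  subst (_≤ H) (sym (∣+m-+n∣ i H)) (distance (≤-total i H))
  where
  i≤2H : i ≤ 2 * H
  i≤2H = ≤-pred (∈-upTo⁻ i∈)
  distance : i ≤ H ⊎ H ≤ i → ∣ i - H ∣ ≤ H
  distance (inj₁ i≤H) = ≤-trans (≤-reflexive (m≤n⇒∣m-n∣≡n∸m i≤H)) (m∸n≤m H i)
  distance (inj₂ H≤i) = ≤-trans (≤-reflexive (m≤n⇒∣n-m∣≡n∸m H≤i))
    (m≤n+o⇒m∸n≤o i H (≤-trans i≤2H (≤-reflexive (cong (λ z → H + z) (+-identityʳ H)))))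

∈-interval⁺ : ∀ {H x} → ∣ x ∣ ≤ H → x ∈ interval H
∈-interval⁺ {H} {x} ∣x∣≤H = subst (_∈ interval H) (shift x ∣x∣≤H) (∈-map⁺ _ (∈-upTo⁺ (index< x ∣x∣≤H)))
  where
  index : ℤ → ℕ
  index (+ a)    = a + H
  index -[1+ a ] = H ∸ suc a
  index< : ∀ x → ∣ x ∣ ≤ H → index x < suc (2 * H)
  index< (+ a)    a≤H = s≤s (+-mono-≤ a≤H (≤-reflexive (sym (+-identityʳ H))))
  index< -[1+ a ] _   = s≤s (≤-trans (m∸n≤m H (suc a)) (m≤m+n H _))
  shift : ∀ x → ∣ x ∣ ≤ H → + index x ℤ.- + H ≡ x
  shift (+ a)    _   = lemma (+ a) (+ H)
    where
    lemma : ∀ a h → a ℤ.+ h ℤ.- h ≡ a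
    lemma = ℤ.solve-∀
  shift -[1+ a ] a<H = trans (cong (λ z → + (H ∸ suc a) ℤ.- + z) (sym (m+[n∸m]≡n a<H)))
    (lemma (+ (H ∸ suc a)) (+ suc a))
    where
    lemma : ∀ x a → x ℤ.- (a ℤ.+ x) ≡ ℤ.- a
    lemma = ℤ.solve-∀

unique-interval : ∀ H → Unique (interval H)
unique-interval H = map⁺ (λ {i} {j} eq → ℤ.+-injective
  (trans (sym (lemma (+ i) (+ H))) (trans (cong (ℤ._+ + H) eq) (lemma (+ j) (+ H)))))
    (upTo⁺ (suc (2 * H)))
  where
  lemma : ∀ i h → i ℤ.- h ℤ.+ h ≡ i
  lemma = ℤ.solve-∀

∑-interval-∣∣ : ∀ {H n} → H < n → (f : ℕ → ℕ) → ∑[ x ∈ interval H ] f ∣ x ∣ ≤ 2 * ∑ (upTo n) f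
∑-interval-∣∣ {H} {n} H<n f = begin
  (∑[ x ∈ interval H ] f ∣ x ∣)
    ≤⟨ ∑-mono∈ (interval H) (λ {x} x∈ → ≤-trans
         (≤-reflexive (trans (sym (*-identityˡ (f ∣ x ∣)))
           (cong (_* f ∣ x ∣) (sym (𝟙-true (∣ x ∣ ≟ ∣ x ∣) refl)))))
         (∑-≥-term (λ a → 𝟙 (∣ x ∣ ≟ a) * f a) (∈-upTo⁺ (≤-<-trans (∈-interval⁻ {H} x∈) H<n)))) ⟩
  (∑[ x ∈ interval H ] ∑[ a ∈ upTo n ] (𝟙 (∣ x ∣ ≟ a) * f a))
    ≡⟨ trans (∑-swap (interval H) (upTo n) _) (∑-cong (upTo n) λ a → ∑-*ʳ (interval H) (f a) λ x →
         𝟙 (∣ x ∣ ≟ a)) ⟩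
  (∑[ a ∈ upTo n ] ((∑[ x ∈ interval H ] 𝟙 (∣ x ∣ ≟ a)) * f a))
    ≤⟨ ∑-mono (upTo n) (λ a → *-monoˡ-≤ (f a) (fibre a)) ⟩
  (∑[ a ∈ upTo n ] (2 * f a))
    ≡⟨ ∑-*ˡ (upTo n) 2 f ⟩
  2 * ∑ (upTo n) f ∎
  where
  open ≤-Reasoning
  pointwise : ∀ x a → ∣ x ∣ ≡ a → 1 ≤ 𝟙 (x ℤ.≟ + a) + 𝟙 (x ℤ.≟ ℤ.- + a)
  pointwise x@(+ a) a refl = ≤-trans (≤-reflexive (sym (𝟙-true (x ℤ.≟ + a) refl))) (m≤m+n _ _)
  pointwise x@(-[1+ a ]) .(suc a) refl = ≤-trans (≤-reflexive (sym (𝟙-true (x ℤ.≟ -[1+ a ]) refl)))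
    (m≤n+m _ (𝟙 (x ℤ.≟ + suc a)))
  fibre : ∀ a → ∑[ x ∈ interval H ] 𝟙 (∣ x ∣ ≟ a) ≤ 2
  fibre a = begin
    (∑[ x ∈ interval H ] 𝟙 (∣ x ∣ ≟ a))
      ≤⟨ ∑-mono (interval H) (λ x → 𝟙-≤ (∣ x ∣ ≟ a) (pointwise x a)) ⟩
    (∑[ x ∈ interval H ] (𝟙 (x ℤ.≟ + a) + 𝟙 (x ℤ.≟ ℤ.- + a)))
      ≡⟨ ∑-+ (interval H) (λ x → 𝟙 (x ℤ.≟ + a)) (λ x → 𝟙 (x ℤ.≟ ℤ.- + a)) ⟩
    (∑[ x ∈ interval H ] 𝟙 (x ℤ.≟ + a)) + (∑[ x ∈ interval H ] 𝟙 (x ℤ.≟ ℤ.- + a))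
      ≤⟨ +-mono-≤ (∑-𝟙-≡ ℤ._≟_ (unique-interval H) (+ a)) (∑-𝟙-≡ ℤ._≟_ (unique-interval H) (ℤ.- + a)) ⟩
    2 ∎

-- The factor 16 is the cost of the signs: each of the four variables is recovered from its absolute
-- value in at most two ways.
integer-energy-bound : ∀ {H K n} → H < n → K < n →
  ∑[ a ∈ interval H ] ∑[ c ∈ interval H ] ∑[ b ∈ interval K ] ∑[ d ∈ interval K ]
    𝟙 (a ℤ.* b ℤ.≟ c ℤ.* d) ≤
  16 * energy n
integer-energy-bound {H} {K} {n} H<n K<n = begin
  (∑[ a ∈ interval H ] ∑[ c ∈ interval H ] ∑[ b ∈ interval K ] ∑[ d ∈ interval K ]
    𝟙 (a ℤ.* b ℤ.≟ c ℤ.* d))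
    ≤⟨ ∑-mono (interval H) (λ a → ∑-mono (interval H) λ c → ∑-mono (interval K) λ b →
         ∑-mono (interval K) λ d →
         𝟙-mono (a ℤ.* b ℤ.≟ c ℤ.* d) (∣ a ∣ * ∣ b ∣ ≟ ∣ c ∣ * ∣ d ∣) λ eq →
           trans (sym (ℤ.abs-* a b)) (trans (cong ∣_∣ eq) (ℤ.abs-* c d))) ⟩
  (∑[ a ∈ interval H ] ∑[ c ∈ interval H ] ∑[ b ∈ interval K ] ∑[ d ∈ interval K ] f₀ (∣ a ∣) (∣ c ∣)
    (∣ b ∣) (∣ d ∣))
    ≤⟨ ∑-mono (interval H) (λ a → ∑-mono (interval H) λ c → ∑-mono (interval K) λ b →
         ∑-interval-∣∣ K<n (f₀ (∣ a ∣) (∣ c ∣) (∣ b ∣))) ⟩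
  (∑[ a ∈ interval H ] ∑[ c ∈ interval H ] ∑[ b ∈ interval K ] f₁ (∣ a ∣) (∣ c ∣) (∣ b ∣))
    ≤⟨ ∑-mono (interval H) (λ a → ∑-mono (interval H) λ c → ∑-interval-∣∣ K<n (f₁ (∣ a ∣) (∣ c ∣))) ⟩
  (∑[ a ∈ interval H ] ∑[ c ∈ interval H ] f₂ (∣ a ∣) (∣ c ∣))
    ≤⟨ ∑-mono (interval H) (λ a → ∑-interval-∣∣ H<n (f₂ (∣ a ∣))) ⟩
  (∑[ a ∈ interval H ] f₃ (∣ a ∣))
    ≤⟨ ∑-interval-∣∣ H<n f₃ ⟩
  2 * (∑[ a ∈ upTo n ] (2 * (∑[ c ∈ upTo n ]
    (2 * (∑[ b ∈ upTo n ] (2 * (∑[ d ∈ upTo n ] f₀ a c b d)))))))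
    ≡⟨ cong (2 *_) (∑-cong (upTo n) λ a → trans (cong (2 *_) (∑-cong (upTo n) λ c →
         pull 2 λ b → ∑ (upTo n) (f₀ a c b))) (pull 4 λ c → ∑[ b ∈ upTo n ] ∑ (upTo n) (f₀ a c b))) ⟩
  2 * (∑[ a ∈ upTo n ] (8 * (∑[ c ∈ upTo n ] ∑[ b ∈ upTo n ] ∑ (upTo n) (f₀ a c b))))
    ≡⟨ pull 8 (λ a → ∑[ c ∈ upTo n ] ∑[ b ∈ upTo n ] ∑ (upTo n) (f₀ a c b)) ⟩
  16 * energy n ∎
  where
  open ≤-Reasoning
  f₀ : ℕ → ℕ → ℕ → ℕ → ℕ
  f₀ a c b d = 𝟙 (a * b ≟ c * d)
  pull : ∀ k (f : ℕ → ℕ) → 2 * (∑[ a ∈ upTo n ] (k * f a)) ≡ 2 * k * ∑ (upTo n) f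
  pull k f = trans (cong (2 *_) (∑-*ˡ (upTo n) k f)) (sym (*-assoc 2 k _))
  f₁ : ℕ → ℕ → ℕ → ℕ
  f₁ a c b = 2 * ∑ (upTo n) (f₀ a c b)
  f₂ : ℕ → ℕ → ℕ
  f₂ a c = 2 * ∑ (upTo n) (f₁ a c)
  f₃ : ℕ → ℕ
  f₃ a = 2 * ∑ (upTo n) (f₂ a)

-- The difference of two solutions solves the homogeneous equation.
∑-fibre-≤-kernel : ∀ H a c m →
  ∑[ b ∈ interval H ] ∑[ d ∈ interval H ] 𝟙 (a ℤ.* b ℤ.- c ℤ.* d ℤ.≟ m) ≤
  ∑[ b ∈ interval (2 * H) ] ∑[ d ∈ interval (2 * H) ] 𝟙 (a ℤ.* b ℤ.≟ c ℤ.* d)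
∑-fibre-≤-kernel H a c m = subst₂ _≤_ (∑-× (interval H) (interval H) _)
  (∑-× (interval (2 * H)) (interval (2 * H)) _) bound
  where
  pairs : ℕ → List (ℤ × ℤ)
  pairs K = cartesianProduct (interval K) (interval K)
  _≟²_ : DecidableEquality (ℤ × ℤ)
  _≟²_ = ≡-dec ℤ._≟_ ℤ._≟_
  P : ℤ × ℤ → Set
  P (b , d) = a ℤ.* b ℤ.- c ℤ.* d ≡ m
  P? : Decidable P
  P? (b , d) = a ℤ.* b ℤ.- c ℤ.* d ℤ.≟ m
  kernel : ℤ × ℤ → ℕ
  kernel (b , d) = 𝟙 (a ℤ.* b ℤ.≟ c ℤ.* d)
  bound : ∑[ x ∈ pairs H ] 𝟙 (P? x) ≤ ∑ (pairs (2 * H)) kernel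
  -- The translation needs a base solution; if there is none, the left side is 0.
  bound with ∑-≡0⊎∃ (pairs H) (λ x → 𝟙 (P? x))
  ... | inj₁ ≡0 = ≤-trans (≤-reflexive ≡0) z≤n
  ... | inj₂ ((b₀ , d₀) , x₀∈ , Px₀) = ∑-transport {R = R} P? R? kernel translate few
    where
    shifted : ℤ × ℤ → ℤ × ℤ
    shifted (b , d) = b ℤ.+ b₀ , d ℤ.+ d₀
    R : ℤ × ℤ → ℤ × ℤ → Set
    R x y = x ≡ shifted y × a ℤ.* proj₁ y ≡ c ℤ.* proj₂ y
    R? : ∀ x y → Dec (R x y)
    R? x y = x ≟² shifted y ×-dec a ℤ.* proj₁ y ℤ.≟ c ℤ.* proj₂ y
    few : ∀ y → ∑[ x ∈ pairs H ] 𝟙 (R? x y) ≤ kernel y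
    few y = begin
      (∑[ x ∈ pairs H ] 𝟙 (R? x y))
        ≡⟨ trans (∑-cong (pairs H) λ x → 𝟙-× (x ≟² shifted y) (a ℤ.* proj₁ y ℤ.≟ c ℤ.* proj₂ y))
             (∑-*ʳ (pairs H) (kernel y) λ x → 𝟙 (x ≟² shifted y)) ⟩
      (∑[ x ∈ pairs H ] 𝟙 (x ≟² shifted y)) * kernel y
        ≤⟨ *-monoˡ-≤ (kernel y) (∑-𝟙-≡ _≟²_ (cartesianProduct⁺ (unique-interval H) (unique-interval H))
             (shifted y)) ⟩
      1 * kernel y
        ≡⟨ *-identityˡ (kernel y) ⟩
      kernel y ∎
      where open ≤-Reasoning
    difference∈ : ∀ {x y} → x ∈ interval H → y ∈ interval H → x ℤ.- y ∈ interval (2 * H)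
    difference∈ {x} {y} x∈ y∈ = ∈-interval⁺ (≤-trans (ℤ.∣i-j∣≤∣i∣+∣j∣ x y)
      (≤-trans (+-mono-≤ (∈-interval⁻ {H} x∈) (∈-interval⁻ {H} y∈))
        (≤-reflexive (cong (λ z → H + z) (sym (+-identityʳ H))))))
    translate : ∀ {x} → x ∈ pairs H → P x → ∃ λ y → y ∈ pairs (2 * H) × R x y
    translate {b , d} x∈ Px
      with b∈ , d∈ ← ∈-cartesianProduct⁻ (interval H) _ x∈
         | b₀∈ , d₀∈ ← ∈-cartesianProduct⁻ (interval H) _ x₀∈
      = (b ℤ.- b₀ , d ℤ.- d₀) , ∈-cartesianProduct⁺ (difference∈ {b} {b₀} b∈ b₀∈)
        (difference∈ {d} {d₀} d∈ d₀∈) ,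
        cong₂ _,_ (lemma b b₀) (lemma d d₀) ,
        ℤ.i-j≡0⇒i≡j _ _ (trans (lemma′ a b c d b₀ d₀) (trans (cong₂ ℤ._-_ Px (𝟙≢0 (P? (b₀ , d₀)) Px₀))
          (ℤ.+-inverseʳ m)))
      where
      lemma : ∀ x y → x ≡ x ℤ.- y ℤ.+ y
      lemma = ℤ.solve-∀
      lemma′ : ∀ a b c d b₀ d₀ → a ℤ.* (b ℤ.- b₀) ℤ.- c ℤ.* (d ℤ.- d₀) ≡
        (a ℤ.* b ℤ.- c ℤ.* d) ℤ.- (a ℤ.* b₀ ℤ.- c ℤ.* d₀)
      lemma′ = ℤ.solve-∀

module Energy (p : ℕ) {{p≢0 : NonZero p}} where
  open Residues p

  -- A congruence lifts to a b - c d = k p over the integers with |k| ≤ 2 H² / p. Every k costs no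
  -- more than k = 0 once b and d range over the doubled interval, and 2 H + 1 exceeds all absolute
  -- values there.
  multiplicativeEnergy-≤-energy : ∀ {H} → 1 ≤ H →
    multiplicativeEnergy (interval H) ≤ (2 * (2 * (H * H) / p) + 1) * (16 * energy (2 * H + 1))
  multiplicativeEnergy-≤-energy {H} 1≤H = begin
    multiplicativeEnergy (interval H)
      ≡⟨ ∑-cong I (λ a → ∑-swap I I _) ⟩
    (∑[ a ∈ I ] ∑[ c ∈ I ] ∑[ b ∈ I ] ∑[ d ∈ I ] 𝟙 (a ℤ.* b ≋? c ℤ.* d))
      ≤⟨ ∑-mono∈ I (λ {a} a∈ → ∑-mono∈ I λ {c} c∈ → ∑-mono∈ I λ {b} b∈ → ∑-mono∈ I λ {d} d∈ →
           𝟙-≤ (a ℤ.* b ≋? c ℤ.* d) (multiple a∈ b∈ c∈ d∈)) ⟩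
    (∑[ a ∈ I ] ∑[ c ∈ I ] ∑[ b ∈ I ] ∑[ d ∈ I ] ∑[ k ∈ Ks ] 𝟙 (a ℤ.* b ℤ.- c ℤ.* d ℤ.≟ k ℤ.* + p))
      ≡⟨ ∑-cong I (λ a → ∑-cong I λ c → trans (∑-cong I λ b → ∑-swap I Ks _) (∑-swap I Ks _)) ⟩
    (∑[ a ∈ I ] ∑[ c ∈ I ] ∑[ k ∈ Ks ] ∑[ b ∈ I ] ∑[ d ∈ I ] 𝟙 (a ℤ.* b ℤ.- c ℤ.* d ℤ.≟ k ℤ.* + p))
      ≤⟨ ∑-mono I (λ a → ∑-mono I λ c → ∑-≤-const Ks (kernel a c) λ k →
           ∑-fibre-≤-kernel H a c (k ℤ.* + p)) ⟩
    (∑[ a ∈ I ] ∑[ c ∈ I ] (length Ks * kernel a c))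
      ≡⟨ trans (∑-cong I λ a → ∑-*ˡ I (length Ks) _) (∑-*ˡ I (length Ks) _) ⟩
    length Ks * (∑[ a ∈ I ] ∑[ c ∈ I ] kernel a c)
      ≤⟨ *-mono-≤ (≤-reflexive (length-interval K)) (integer-energy-bound H<n 2H<n) ⟩
    (2 * K + 1) * (16 * energy (2 * H + 1)) ∎
    where
    open ≤-Reasoning
    K = 2 * (H * H) / p
    I = interval H
    Ks = interval K
    kernel : ℤ → ℤ → ℕ
    kernel a c = ∑[ b ∈ interval (2 * H) ] ∑[ d ∈ interval (2 * H) ] 𝟙 (a ℤ.* b ℤ.≟ c ℤ.* d)
    2H<n : 2 * H < 2 * H + 1
    2H<n = ≤-reflexive (+-comm 1 (2 * H))
    H<n : H < 2 * H + 1
    H<n = ≤-<-trans (m≤m+n H _) 2H<n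
    multiple : ∀ {a b c d} → a ∈ I → b ∈ I → c ∈ I → d ∈ I → a ℤ.* b ≋ c ℤ.* d →
               1 ≤ ∑[ k ∈ Ks ] 𝟙 (a ℤ.* b ℤ.- c ℤ.* d ℤ.≟ k ℤ.* + p)
    multiple {a} {b} {c} {d} a∈ b∈ c∈ d∈ (mod (Signed.divides k eq)) =
      ≤-trans (≤-reflexive (sym (𝟙-true (a ℤ.* b ℤ.- c ℤ.* d ℤ.≟ k ℤ.* + p) eq)))
        (∑-≥-term (λ k → 𝟙 (a ℤ.* b ℤ.- c ℤ.* d ℤ.≟ k ℤ.* + p)) (∈-interval⁺ {K} {k} ∣k∣≤K))
      where
      product≤ : ∀ {x y} → x ∈ I → y ∈ I → ∣ x ℤ.* y ∣ ≤ H * H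
      product≤ {x} {y} x∈ y∈ = ≤-trans (≤-reflexive (ℤ.abs-* x y))
        (*-mono-≤ (∈-interval⁻ {H} x∈) (∈-interval⁻ {H} y∈))
      ∣k∣*p≤ : ∣ k ∣ * p ≤ 2 * (H * H)
      ∣k∣*p≤ = begin
        ∣ k ∣ * p                       ≡⟨ sym (ℤ.abs-* k (+ p)) ⟩
        ∣ k ℤ.* + p ∣                   ≡⟨ cong ∣_∣ (sym eq) ⟩
        ∣ a ℤ.* b ℤ.- c ℤ.* d ∣         ≤⟨ ℤ.∣i-j∣≤∣i∣+∣j∣ (a ℤ.* b) (c ℤ.* d) ⟩
        ∣ a ℤ.* b ∣ + ∣ c ℤ.* d ∣       ≤⟨ +-mono-≤ (product≤ {a} {b} a∈ b∈) (product≤ {c} {d} c∈ d∈) ⟩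
        H * H + H * H                   ≡⟨ cong (λ z → H * H + z) (sym (+-identityʳ (H * H))) ⟩
        2 * (H * H)                     ∎
      ∣k∣≤K : ∣ k ∣ ≤ K
      ∣k∣≤K = ≤-trans (≤-reflexive (sym (m*n/n≡m ∣ k ∣ p))) (/-monoˡ-≤ p ∣k∣*p≤)

  -- The constant is 2 · 16 · 12². The number of multiples of p satisfies p (2 K + 1) ≤ 2 n², where
  -- p ≤ n² pays for k = 0; 16 stands for the signs; and 12 = 2 + 10 adds the two axes to the ten
  -- blocks of the divisor sum.
  multiplicativeEnergy-bound : ∀ {H s} → 1 ≤ H → 1 ≤ s → 2 * H + 1 ≤ s ^ 10 → p ≤
    (2 * H + 1) * (2 * H + 1) →
    p * multiplicativeEnergy (interval H) ≤
      4608 * ((s * s) * ((2 * H + 1) * (2 * H + 1) * ((2 * H + 1) * (2 * H + 1))))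
  multiplicativeEnergy-bound {H} {s} 1≤H 1≤s n≤s¹⁰ p≤n² = begin
    p * multiplicativeEnergy (interval H)
      ≤⟨ *-monoʳ-≤ p (≤-trans (multiplicativeEnergy-≤-energy 1≤H)
           (*-monoʳ-≤ (2 * K + 1) (*-monoʳ-≤ 16 (energy-bound 1<n)))) ⟩
    p * ((2 * K + 1) * (16 * (divisorSum n * divisorSum n)))
      ≡⟨ sym (*-assoc p (2 * K + 1) _) ⟩
    p * (2 * K + 1) * (16 * (divisorSum n * divisorSum n))
      ≤⟨ *-mono-≤ multiples (*-monoʳ-≤ 16 (*-mono-≤ D≤ D≤)) ⟩
    2 * (n * n) * (16 * (12 * (s * n) * (12 * (s * n))))
      ≡⟨ lemma s n ⟩
    4608 * ((s * s) * (n * n * (n * n))) ∎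
    where
    open ≤-Reasoning
    K = 2 * (H * H) / p
    n = 2 * H + 1
    1<n : 1 < n
    1<n = ≤-trans (s≤s (≤-trans 1≤H (m≤m+n H _))) (≤-reflexive (+-comm 1 (2 * H)))
    lemma : ∀ s n → 2 * (n * n) * (16 * (12 * (s * n) * (12 * (s * n)))) ≡
      4608 * ((s * s) * (n * n * (n * n)))
    lemma = solve-∀
    D≤ : divisorSum n ≤ 12 * (s * n)
    D≤ = begin
      divisorSum n            ≤⟨ divisorSum-bound n s 10 n≤s¹⁰ ⟩
      2 * n + 10 * (s * n)    ≤⟨ +-monoˡ-≤ (10 * (s * n))
        (*-monoʳ-≤ 2 (≤-trans (≤-reflexive (sym (*-identityˡ n))) (*-monoˡ-≤ n 1≤s))) ⟩
      2 * (s * n) + 10 * (s * n) ≡⟨ sym (*-distribʳ-+ (s * n) 2 10) ⟩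
      12 * (s * n)            ∎
    multiples : p * (2 * K + 1) ≤ 2 * (n * n)
    multiples = begin
      p * (2 * K + 1)              ≡⟨ lemma₁ p K ⟩
      2 * (K * p) + p              ≤⟨ +-mono-≤ (*-monoʳ-≤ 2 (m/n*n≤m (2 * (H * H)) p)) p≤n² ⟩
      -- The summand 4 H + 1 completes 4 H² to n².
      2 * (2 * (H * H)) + n * n    ≤⟨ +-monoˡ-≤ (n * n) (m≤m+n _ (4 * H + 1)) ⟩
      2 * (2 * (H * H)) + (4 * H + 1) + n * n ≡⟨ lemma₂ H ⟩
      2 * (n * n)                  ∎
      where
      lemma₁ : ∀ p k → p * (2 * k + 1) ≡ 2 * (k * p) + p
      lemma₁ = solve-∀
      lemma₂ : ∀ h → 2 * (2 * (h * h)) + (4 * h + 1) + (2 * h + 1) * (2 * h + 1) ≡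
        2 * ((2 * h + 1) * (2 * h + 1))
      lemma₂ = solve-∀

-- Coincidences of 2 × 2 minors.

module Minors (p : ℕ) (p-prime : Prime p) (I : List ℤ) (distinct : Residues.Distinct p I) where
  open Residues p
  open Field p-prime
  open Incidence p p-prime

  n : ℕ
  n = length I

  ℤ² : Set
  ℤ² = ℤ × ℤ

  I² : List ℤ²
  I² = cartesianProduct I I

  I⁴ : List (ℤ² × ℤ²)
  I⁴ = cartesianProduct I² I²

  length-I² : length I² ≡ n * n
  length-I² = length-× I I

  length-I⁴ : length I⁴ ≡ n * n * (n * n)
  length-I⁴ = trans (length-× I² I²) (cong₂ _*_ length-I² length-I²)

  product : ℤ² → ℤ
  product (a , b) = a ℤ.* b

  minor : ℤ² → ℤ² → ℤ
  minor (x₂ , x₃) (y₂ , y₃) = x₂ ℤ.* y₃ ℤ.- x₃ ℤ.* y₂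

  -- The entries of the second minor are grouped by diagonals, not by columns or rows: `u` holds one
  -- diagonal and `v` the other, so that only their products occur.
  minorEnergy : ℕ
  minorEnergy = ∑[ x ∈ I² ] ∑[ y ∈ I² ] ∑[ u ∈ I² ] ∑[ v ∈ I² ] 𝟙 (minor x y ≋? product u ℤ.- product v)

  ∑-product-energy : ∑[ u ∈ I² ] ∑[ v ∈ I² ] 𝟙 (product u ≋? product v) ≡ multiplicativeEnergy I
  ∑-product-energy = trans (∑-× I I _) (∑-cong I λ a → ∑-cong I λ b → ∑-× I I _)

  ∑-𝟙-≋ : ∀ a → ∑[ b ∈ I ] 𝟙 (a ≋? b) ≤ 1
  ∑-𝟙-≋ a = ∑-𝟙-distinct distinct (a ≋?_) λ a≋b a≋c → ≋-trans (≋-sym a≋b) a≋c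

  ∑-𝟙-≋² : ∀ a b → ∑[ a′ ∈ I ] ∑[ b′ ∈ I ] (𝟙 (a ≋? a′) * 𝟙 (b ≋? b′)) ≤ 1
  ∑-𝟙-≋² a b = ≤-trans (≤-reflexive (∑-*-∑ I I (λ a′ → 𝟙 (a ≋? a′)) (λ b′ → 𝟙 (b ≋? b′))))
                       (*-mono-≤ (∑-𝟙-≋ a) (∑-𝟙-≋ b))

  -- A coincidence fixes the pair `x` modulo p, which leaves at most n² choices of `x` with its
  -- partner, but sees `u` only through its product. The pairs (u , v) are therefore counted by the
  -- multiplicative energy.
  coincidences-product : (f : ℤ² × ℤ² → ℤ³) →
    (∀ x u y v → f (x , u) ≋³ f (y , v) →
      product u ≋ product v × proj₁ x ≋ proj₁ y × proj₂ x ≋ proj₂ y) →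
    coincidences (map f I⁴) ≤ n * n * multiplicativeEnergy I
  coincidences-product f f⁻¹ = begin
    coincidences (map f I⁴)
      ≡⟨ trans (∑-map f I⁴ _) (∑-cong I⁴ λ s → ∑-map f I⁴ _) ⟩
    (∑[ s ∈ I⁴ ] ∑[ s′ ∈ I⁴ ] 𝟙 (f s ≋³? f s′))
      ≡⟨ trans (∑-× I² I² _) (∑-cong I² λ x → ∑-cong I² λ u → ∑-× I² I² _) ⟩
    (∑[ x ∈ I² ] ∑[ u ∈ I² ] ∑[ y ∈ I² ] ∑[ v ∈ I² ] 𝟙 (f (x , u) ≋³? f (y , v)))
      ≤⟨ ∑-mono I² (λ x → ∑-mono I² λ u → ∑-mono I² λ y → ∑-mono I² λ v →
           𝟙-≤ (f (x , u) ≋³? f (y , v)) λ h →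
           let uv , xy = f⁻¹ x u y v h in ≤-reflexive (sym (cong₂ _*_ (𝟙-true (same? x y) xy) (𝟙-true (product u ≋? product v) uv)))) ⟩
    (∑[ x ∈ I² ] ∑[ u ∈ I² ] ∑[ y ∈ I² ] ∑[ v ∈ I² ] (𝟙 (same? x y) * 𝟙 (product u ≋? product v)))
      ≡⟨ ∑-cong I² (λ x → ∑-cong I² λ u → ∑-*-∑ I² I² (λ y → 𝟙 (same? x y))
           (λ v → 𝟙 (product u ≋? product v))) ⟩
    (∑[ x ∈ I² ] ∑[ u ∈ I² ] ((∑[ y ∈ I² ] 𝟙 (same? x y)) * (∑[ v ∈ I² ] 𝟙 (product u ≋? product v))))
      ≡⟨ ∑-*-∑ I² I² (λ x → ∑[ y ∈ I² ] 𝟙 (same? x y)) (λ u → ∑[ v ∈ I² ] 𝟙 (product u ≋? product v)) ⟩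
    (∑[ x ∈ I² ] ∑[ y ∈ I² ] 𝟙 (same? x y)) * (∑[ u ∈ I² ] ∑[ v ∈ I² ] 𝟙 (product u ≋? product v))
      ≤⟨ *-mono-≤ (∑-≤-const I² 1 few) (≤-reflexive ∑-product-energy) ⟩
    length I² * 1 * multiplicativeEnergy I
      ≡⟨ cong (_* multiplicativeEnergy I) (trans (*-identityʳ _) length-I²) ⟩
    n * n * multiplicativeEnergy I ∎
    where
    open ≤-Reasoning
    same? : (x y : ℤ²) → Dec (proj₁ x ≋ proj₁ y × proj₂ x ≋ proj₂ y)
    same? x y = proj₁ x ≋? proj₁ y ×-dec proj₂ x ≋? proj₂ y
    few : ∀ x → ∑[ y ∈ I² ] 𝟙 (same? x y) ≤ 1
    few x = ≤-trans (≤-reflexive (trans (∑-× I I _) (∑-cong I λ a → ∑-cong I λ b →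
      𝟙-× (proj₁ x ≋? a) (proj₂ x ≋? b))))
                    (∑-𝟙-≋² (proj₁ x) (proj₂ x))

  -- The equation minor x y = product u - product v says that the point of (x , u)
  -- lies on the plane of (y , v).
  minorEnergy-bound : p * minorEnergy ≤ n * n * (n * n) * (n * n * (n * n)) +
    p * p * (n * n * multiplicativeEnergy I)
  minorEnergy-bound = ≤-trans (m≤n+∣m-n∣ (p * minorEnergy) _)
    (+-monoʳ-≤ (n * n * (n * n) * (n * n * (n * n)))
    -- Points and planes obey the same bound on coincidences, so the right side is a perfect square
    -- and the root is taken exactly.
    (m²≤n²⇒m≤n (begin
      D * D
        ≡⟨ cong (λ z → z * z) (cong₂ (λ i l → ∣ p * i - l ∣) (sym incidences≡)
             (sym (cong₂ _*_ (length-points point) (length-points plane)))) ⟩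
      ∣ p * incidences X Y - length X * length Y ∣ * ∣ p * incidences X Y - length X * length Y ∣
        ≤⟨ incidence-bound X Y ⟩
      p * p * (p * p) * (coincidences X * coincidences Y)
        ≤⟨ *-monoʳ-≤ (p * p * (p * p))
             (*-mono-≤ (coincidences-product point point⁻¹) (coincidences-product plane plane⁻¹)) ⟩
      p * p * (p * p) * (n * n * multiplicativeEnergy I * (n * n * multiplicativeEnergy I))
        ≡⟨ [m*n]*[o*p]≡[m*o]*[n*p] (p * p) (p * p) (n * n * multiplicativeEnergy I)
             (n * n * multiplicativeEnergy I) ⟩
      p * p * (n * n * multiplicativeEnergy I) * (p * p * (n * n * multiplicativeEnergy I)) ∎)))
    where
    open ≤-Reasoning
    D = ∣ p * minorEnergy - n * n * (n * n) * (n * n * (n * n)) ∣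
    -- The incidence reads - product u + x₂ y₃ - x₃ y₂ = - product v. The products sit in the two
    -- constant places, and the bilinear part is the minor.
    point plane : ℤ² × ℤ² → ℤ³
    point (x , u) = ℤ.- product u , proj₁ x , proj₂ x
    plane (y , v) = proj₂ y , ℤ.- proj₁ y , ℤ.- product v
    X = map point I⁴
    Y = map plane I⁴
    length-points : (f : ℤ² × ℤ² → ℤ³) → length (map f I⁴) ≡ n * n * (n * n)
    length-points f = trans (length-map f I⁴) length-I⁴
    ≋-neg⁻¹ : ∀ {a b} → ℤ.- a ≋ ℤ.- b → a ≋ b
    ≋-neg⁻¹ {a} {b} h = ≋-lin₁ h ℤ.-1ℤ (lemma a b)
      where
      lemma : ∀ a b → a ℤ.- b ≡ ℤ.-1ℤ ℤ.* (ℤ.- a ℤ.- ℤ.- b)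
      lemma = ℤ.solve-∀
    point⁻¹ : ∀ x u y v → point (x , u) ≋³ point (y , v) →
      product u ≋ product v × proj₁ x ≋ proj₁ y × proj₂ x ≋ proj₂ y
    point⁻¹ x u y v (uv , xy) = ≋-neg⁻¹ uv , xy
    plane⁻¹ : ∀ x u y v → plane (x , u) ≋³ plane (y , v) →
      product u ≋ product v × proj₁ x ≋ proj₁ y × proj₂ x ≋ proj₂ y
    plane⁻¹ x u y v (xy₂ , xy₁ , uv) = ≋-neg⁻¹ uv , ≋-neg⁻¹ xy₁ , xy₂
    lemma : ∀ x₂ x₃ y₂ y₃ u v → (ℤ.- u ℤ.+ x₂ ℤ.* y₃ ℤ.+ x₃ ℤ.* ℤ.- y₂) ℤ.- ℤ.- v ≡
      ℤ.1ℤ ℤ.* ((x₂ ℤ.* y₃ ℤ.- x₃ ℤ.* y₂) ℤ.- (u ℤ.- v))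
    lemma = ℤ.solve-∀
    lemma′ : ∀ x₂ x₃ y₂ y₃ u v → (x₂ ℤ.* y₃ ℤ.- x₃ ℤ.* y₂) ℤ.- (u ℤ.- v) ≡
      ℤ.1ℤ ℤ.* ((ℤ.- u ℤ.+ x₂ ℤ.* y₃ ℤ.+ x₃ ℤ.* ℤ.- y₂) ℤ.- ℤ.- v)
    lemma′ = ℤ.solve-∀
    incidences≡ : incidences X Y ≡ minorEnergy
    incidences≡ = begin-equality
      incidences X Y
        ≡⟨ trans (∑-map point I⁴ _) (∑-cong I⁴ λ s → ∑-map plane I⁴ _) ⟩
      (∑[ s ∈ I⁴ ] ∑[ s′ ∈ I⁴ ] 𝟙 (point s on? plane s′))
        ≡⟨ trans (∑-× I² I² _) (∑-cong I² λ x → ∑-cong I² λ u → ∑-× I² I² _) ⟩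
      (∑[ x ∈ I² ] ∑[ u ∈ I² ] ∑[ y ∈ I² ] ∑[ v ∈ I² ] 𝟙 (point (x , u) on? plane (y , v)))
        ≡⟨ ∑-cong I² (λ x → ∑-swap I² I² (λ u y → ∑[ v ∈ I² ] 𝟙 (point (x , u) on? plane (y , v)))) ⟩
      (∑[ x ∈ I² ] ∑[ y ∈ I² ] ∑[ u ∈ I² ] ∑[ v ∈ I² ] 𝟙 (point (x , u) on? plane (y , v)))
        ≡⟨ ∑-cong I² (λ x → ∑-cong I² λ y → ∑-cong I² λ u → ∑-cong I² λ v →
             𝟙-cong (point (x , u) on? plane (y , v)) (minor x y ≋? product u ℤ.- product v)
               (λ h → ≋-lin₁ h ℤ.1ℤ (lemma′ (proj₁ x) (proj₂ x) (proj₁ y) (proj₂ y) (product u)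
                 (product v)))
               (λ h → ≋-lin₁ h ℤ.1ℤ (lemma (proj₁ x) (proj₂ x) (proj₁ y) (proj₂ y) (product u)
                 (product v)))) ⟩
      minorEnergy ∎

  -- The four entries of the second minor run independently over I, so the columns (a , b) and (c ,
  -- d) may be traded for the diagonals (a , d) and (b , c).
  ∑-minor-energy : ∑[ x ∈ I² ] ∑[ y ∈ I² ] ∑[ x′ ∈ I² ] ∑[ y′ ∈ I² ] 𝟙 (minor x y ≋? minor x′ y′) ≡
    minorEnergy
  ∑-minor-energy = ∑-cong I² λ x → ∑-cong I² λ y → regroup λ a b c d →
    𝟙 (minor x y ≋? a ℤ.* d ℤ.- b ℤ.* c)
    where
    regroup : (f : ℤ → ℤ → ℤ → ℤ → ℕ) →
      ∑[ s ∈ I² ] ∑[ t ∈ I² ] f (proj₁ s) (proj₂ s) (proj₁ t) (proj₂ t) ≡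
      ∑[ s ∈ I² ] ∑[ t ∈ I² ] f (proj₁ s) (proj₁ t) (proj₂ t) (proj₂ s)
    regroup f = begin
      (∑[ s ∈ I² ] ∑[ t ∈ I² ] f (proj₁ s) (proj₂ s) (proj₁ t) (proj₂ t))
        ≡⟨ trans (∑-× I I _) (∑-cong I λ a → ∑-cong I λ b → ∑-× I I _) ⟩
      (∑[ a ∈ I ] ∑[ b ∈ I ] ∑[ c ∈ I ] ∑[ d ∈ I ] f a b c d)
        ≡⟨ ∑-cong I (λ a → trans (∑-cong I λ b → ∑-swap I I (f a b))
             (∑-swap I I (λ b d → ∑[ c ∈ I ] f a b c d))) ⟩
      (∑[ a ∈ I ] ∑[ d ∈ I ] ∑[ b ∈ I ] ∑[ c ∈ I ] f a b c d)
        ≡⟨ sym (trans (∑-× I I _) (∑-cong I λ a → ∑-cong I λ d → ∑-× I I _)) ⟩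
      (∑[ s ∈ I² ] ∑[ t ∈ I² ] f (proj₁ s) (proj₁ t) (proj₂ t) (proj₂ s)) ∎
      where open ≡-Reasoning

-- Determinants as linear forms in the first row.

module Determinants (p : ℕ) (p-prime : Prime p) (I : List ℤ) (distinct : Residues.Distinct p I)
                    (t : ℤ) (t≉0 : ¬ Residues._≋_ p t ℤ.0ℤ) where
  open Residues p
  open Field p-prime
  open Incidence p p-prime
  open Minors p p-prime I distinct

  I³ : List ℤ³
  I³ = cartesianProduct I I²

  length-I³ : length I³ ≡ n * (n * n)
  length-I³ = trans (length-× I I²) (cong (n *_) length-I²)

  ∑-I³ : (f : ℤ³ → ℕ) → ∑ I³ f ≡ ∑[ a ∈ I ] ∑[ b ∈ I ] ∑[ c ∈ I ] f (a , b , c)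
  ∑-I³ f = trans (∑-× I I² f) (∑-cong I λ a → ∑-× I I λ s → f (a , s))

  coincidences-I³ : coincidences I³ ≤ n * (n * n)
  coincidences-I³ = ≤-trans (∑-≤-const I³ 1 few) (≤-reflexive (trans (*-identityʳ _) length-I³))
    where
    open ≤-Reasoning
    few : ∀ x → ∑[ y ∈ I³ ] 𝟙 (x ≋³? y) ≤ 1
    few (a , b , c) = begin
      (∑[ y ∈ I³ ] 𝟙 ((a , b , c) ≋³? y))
        ≡⟨ ∑-I³ (λ y → 𝟙 ((a , b , c) ≋³? y)) ⟩
      (∑[ a′ ∈ I ] ∑[ b′ ∈ I ] ∑[ c′ ∈ I ] 𝟙 (a ≋? a′ ×-dec b ≋? b′ ×-dec c ≋? c′))
        ≡⟨ ∑-cong I (λ a′ → trans (∑-cong I λ b′ → trans (∑-cong I λ c′ →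
             trans (𝟙-× (a ≋? a′) _) (cong (𝟙 (a ≋? a′) *_) (𝟙-× (b ≋? b′) (c ≋? c′))))
             (∑-*ˡ I (𝟙 (a ≋? a′)) (λ c′ → 𝟙 (b ≋? b′) * 𝟙 (c ≋? c′))))
             (∑-*ˡ I (𝟙 (a ≋? a′)) (λ b′ → ∑[ c′ ∈ I ] (𝟙 (b ≋? b′) * 𝟙 (c ≋? c′))))) ⟩
      (∑[ a′ ∈ I ] (𝟙 (a ≋? a′) * (∑[ b′ ∈ I ] ∑[ c′ ∈ I ] (𝟙 (b ≋? b′) * 𝟙 (c ≋? c′)))))
        ≡⟨ ∑-*ʳ I (∑[ b′ ∈ I ] ∑[ c′ ∈ I ] (𝟙 (b ≋? b′) * 𝟙 (c ≋? c′))) (λ a′ → 𝟙 (a ≋? a′)) ⟩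
      (∑[ a′ ∈ I ] 𝟙 (a ≋? a′)) * (∑[ b′ ∈ I ] ∑[ c′ ∈ I ] (𝟙 (b ≋? b′) * 𝟙 (c ≋? c′)))
        ≤⟨ *-mono-≤ (∑-𝟙-≋ a) (∑-𝟙-≋² b c) ⟩
      1 ∎

  -- The last two rows of a matrix: their first entries, then the two pairs of remaining entries.
  Rows : Set
  Rows = ℤ² × ℤ² × ℤ²

  rows : List Rows
  rows = cartesianProduct I² I⁴

  ∑-rows : (f : Rows → ℕ) → ∑ rows f ≡ ∑[ e ∈ I² ] ∑[ x ∈ I² ] ∑[ y ∈ I² ] f (e , x , y)
  ∑-rows f = trans (∑-× I² I⁴ f) (∑-cong I² λ e → ∑-× I² I² λ s → f (e , s))

  -- The coordinates of the cross product of the two rows. The sign of the second cofactor is built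
  -- in, so the determinant is a plain scalar product and both rows are orthogonal to this vector.
  minor₁ minor₂ minor₃ : Rows → ℤ
  minor₁ (_ , x , y) = minor x y
  minor₂ ((x₁ , y₁) , (_ , x₃) , (_ , y₃)) = x₃ ℤ.* y₁ ℤ.- x₁ ℤ.* y₃
  minor₃ ((x₁ , y₁) , (x₂ , _) , (y₂ , _)) = x₁ ℤ.* y₂ ℤ.- x₂ ℤ.* y₁

  determinant : ℤ³ → Rows → ℤ
  determinant (a , b , c) q = a ℤ.* minor₁ q ℤ.+ b ℤ.* minor₂ q ℤ.+ c ℤ.* minor₃ q

  -- A coefficient that is nonzero modulo p determines its variable from the other two. If all three
  -- vanish, the form is 0 and misses t, as t ≠ 0. This covers the rows with v₁ = 0, for which no
  -- plane is defined.
  linear-form-bound : ∀ v₁ v₂ v₃ →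
    ∑[ a ∈ I ] ∑[ b ∈ I ] ∑[ c ∈ I ] 𝟙 (a ℤ.* v₁ ℤ.+ b ℤ.* v₂ ℤ.+ c ℤ.* v₃ ≋? t) ≤ n * n
  linear-form-bound v₁ v₂ v₃ = cases (v₁ ≋? ℤ.0ℤ) (v₂ ≋? ℤ.0ℤ) (v₃ ≋? ℤ.0ℤ)
    where
    form? : ∀ a b c → Dec (a ℤ.* v₁ ℤ.+ b ℤ.* v₂ ℤ.+ c ℤ.* v₃ ≋ t)
    form? a b c = a ℤ.* v₁ ℤ.+ b ℤ.* v₂ ℤ.+ c ℤ.* v₃ ≋? t
    ∑∑-≤ : {f : ℤ → ℤ → ℕ} → (∀ x y → f x y ≤ 1) → ∑[ x ∈ I ] ∑[ y ∈ I ] f x y ≤ n * n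
    ∑∑-≤ f≤1 = ∑-≤-const I n λ x → ≤-trans (∑-≤-const I 1 (f≤1 x)) (≤-reflexive (*-identityʳ n))
    solve-for : ∀ {v w} {P : ℤ → Set} (P? : Decidable P) → ¬ v ≋ ℤ.0ℤ →
                (∀ {x} → P x → v ℤ.* x ≋ w) → ∑[ x ∈ I ] 𝟙 (P? x) ≤ 1
    solve-for {v} {w} P? v≉0 P⇒ = ≤-trans (∑-mono I λ x → 𝟙-mono (P? x) (v ℤ.* x ≋? w) P⇒)
                                          (∑-𝟙-linear distinct v w v≉0)
    lemma₁ : ∀ a b c v₁ v₂ v₃ t → v₁ ℤ.* a ℤ.- (t ℤ.- (b ℤ.* v₂ ℤ.+ c ℤ.* v₃)) ≡
      ℤ.1ℤ ℤ.* (a ℤ.* v₁ ℤ.+ b ℤ.* v₂ ℤ.+ c ℤ.* v₃ ℤ.- t)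
    lemma₁ = ℤ.solve-∀
    lemma₂ : ∀ a b c v₁ v₂ v₃ t → v₂ ℤ.* b ℤ.- (t ℤ.- (a ℤ.* v₁ ℤ.+ c ℤ.* v₃)) ≡
      ℤ.1ℤ ℤ.* (a ℤ.* v₁ ℤ.+ b ℤ.* v₂ ℤ.+ c ℤ.* v₃ ℤ.- t)
    lemma₂ = ℤ.solve-∀
    lemma₃ : ∀ a b c v₁ v₂ v₃ t → v₃ ℤ.* c ℤ.- (t ℤ.- (a ℤ.* v₁ ℤ.+ b ℤ.* v₂)) ≡
      ℤ.1ℤ ℤ.* (a ℤ.* v₁ ℤ.+ b ℤ.* v₂ ℤ.+ c ℤ.* v₃ ℤ.- t)
    lemma₃ = ℤ.solve-∀
    lemma₀ : ∀ a b c → a ℤ.* ℤ.0ℤ ℤ.+ b ℤ.* ℤ.0ℤ ℤ.+ c ℤ.* ℤ.0ℤ ≡ ℤ.0ℤ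
    lemma₀ = ℤ.solve-∀
    cases : Dec (v₁ ≋ ℤ.0ℤ) → Dec (v₂ ≋ ℤ.0ℤ) → Dec (v₃ ≋ ℤ.0ℤ) →
            ∑[ a ∈ I ] ∑[ b ∈ I ] ∑[ c ∈ I ] 𝟙 (form? a b c) ≤ n * n
    cases _ _ (no v₃≉0) = ∑∑-≤ λ a b → solve-for {v₃} (form? a b) v₃≉0
      λ {c} h → ≋-lin₁ h ℤ.1ℤ (lemma₃ a b c v₁ v₂ v₃ t)
    cases _ (no v₂≉0) _ = ≤-trans
      (≤-reflexive (∑-cong I λ a → ∑-swap I I (λ b c → 𝟙 (form? a b c))))
      (∑∑-≤ λ a c → solve-for {v₂} (λ b → form? a b c) v₂≉0
        λ {b} h → ≋-lin₁ h ℤ.1ℤ (lemma₂ a b c v₁ v₂ v₃ t))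
    cases (no v₁≉0) _ _ = ≤-trans
      (≤-reflexive (trans (∑-swap I I (λ a b → ∑[ c ∈ I ] 𝟙 (form? a b c)))
                          (∑-cong I λ b → ∑-swap I I (λ a c → 𝟙 (form? a b c)))))
      (∑∑-≤ λ b c → solve-for {v₁} (λ a → form? a b c) v₁≉0
        λ {a} h → ≋-lin₁ h ℤ.1ℤ (lemma₁ a b c v₁ v₂ v₃ t))
    cases (yes v₁≋0) (yes v₂≋0) (yes v₃≋0) = ∑∑-≤ λ a b → ≤-trans
      (∑-≤-const I 0 λ c → ≤-reflexive (𝟙-false (form? a b c) λ h → t≉0 (≋-trans (≋-sym h) (≋-trans
        (≋-+ (≋-+ (≋-* (≋-refl {a}) v₁≋0) (≋-* (≋-refl {b}) v₂≋0)) (≋-* (≋-refl {c}) v₃≋0))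
        (≋-reflexive (lemma₀ a b c))))))
      (≤-trans (≤-reflexive (*-zeroʳ n)) z≤n)

  zeroMinors : ℕ
  zeroMinors = ∑[ x ∈ I² ] ∑[ y ∈ I² ] 𝟙 (minor x y ≋? ℤ.0ℤ)

  -- If a ≠ 0 modulo p, then d follows from a, b and c, which gives n³. At most one a in I vanishes
  -- modulo p, and it adds at most another n³.
  zeroMinors-bound : zeroMinors ≤ 2 * (n * (n * n))
  zeroMinors-bound = begin
    zeroMinors
      ≡⟨ trans (∑-× I I _) (∑-cong I λ a → ∑-cong I λ b → ∑-× I I _) ⟩
    (∑[ a ∈ I ] ∑[ b ∈ I ] ∑[ c ∈ I ] ∑[ d ∈ I ] 𝟙 (a ℤ.* d ℤ.- b ℤ.* c ≋? ℤ.0ℤ))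
      ≤⟨ ∑-mono I (λ a → ∑-≤-const I (n * (1 + n * 𝟙 (ℤ.0ℤ ≋? a))) λ b →
           ∑-≤-const I (1 + n * 𝟙 (ℤ.0ℤ ≋? a)) λ c → solutions a b c) ⟩
    (∑[ a ∈ I ] (n * (n * (1 + n * 𝟙 (ℤ.0ℤ ≋? a)))))
      ≡⟨ trans (∑-*ˡ I n (λ a → n * (1 + n * 𝟙 (ℤ.0ℤ ≋? a))))
           (cong (n *_) (trans (∑-*ˡ I n (λ a → 1 + n * 𝟙 (ℤ.0ℤ ≋? a)))
           (cong (n *_) (trans (∑-+ I (λ _ → 1) (λ a → n * 𝟙 (ℤ.0ℤ ≋? a)))
             (cong₂ _+_ (∑-const I 1) (∑-*ˡ I n (λ a → 𝟙 (ℤ.0ℤ ≋? a)))))))) ⟩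
    n * (n * (n * 1 + n * (∑[ a ∈ I ] 𝟙 (ℤ.0ℤ ≋? a))))
      ≤⟨ *-monoʳ-≤ n (*-monoʳ-≤ n (+-monoʳ-≤ (n * 1) (*-monoʳ-≤ n (∑-𝟙-≋ ℤ.0ℤ)))) ⟩
    n * (n * (n * 1 + n * 1))
      ≡⟨ lemma n ⟩
    2 * (n * (n * n)) ∎
    where
    open ≤-Reasoning
    lemma : ∀ n → n * (n * (n * 1 + n * 1)) ≡ 2 * (n * (n * n))
    lemma = solve-∀
    lemma′ : ∀ a b c d → a ℤ.* d ℤ.- b ℤ.* c ≡ ℤ.1ℤ ℤ.* (a ℤ.* d ℤ.- b ℤ.* c ℤ.- ℤ.0ℤ)
    lemma′ = ℤ.solve-∀
    solutions : ∀ a b c → ∑[ d ∈ I ] 𝟙 (a ℤ.* d ℤ.- b ℤ.* c ≋? ℤ.0ℤ) ≤ 1 + n * 𝟙 (ℤ.0ℤ ≋? a)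
    solutions a b c with ℤ.0ℤ ≋? a
    ... | yes _  = ≤-trans (∑-≤-const I 1 λ d → 𝟙≤1 (a ℤ.* d ℤ.- b ℤ.* c ≋? ℤ.0ℤ)) (n≤1+n (n * 1))
    ... | no 0≉a = ≤-trans
      (∑-mono I λ d → 𝟙-mono (a ℤ.* d ℤ.- b ℤ.* c ≋? ℤ.0ℤ) (a ℤ.* d ≋? b ℤ.* c) λ h →
        ≋-lin₁ h ℤ.1ℤ (lemma′ a b c d))
      (≤-trans (∑-𝟙-linear distinct a (b ℤ.* c) λ a≋0 → 0≉a (≋-sym a≋0)) (m≤m+n 1 _))

  -- The default 0 makes `plane` total on rows; it is evaluated only after filtering for v₁ ≠ 0.
  recip : ℤ → ℤ
  recip c with c ≋? ℤ.0ℤ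
  ... | yes _  = ℤ.0ℤ
  ... | no c≉0 = proj₁ (inverse c c≉0)

  recip-inverse : ∀ c → ¬ c ≋ ℤ.0ℤ → c ℤ.* recip c ≋ ℤ.1ℤ
  recip-inverse c c≉0 with c ≋? ℤ.0ℤ
  ... | yes c≋0 = contradiction c≋0 c≉0
  ... | no c≉0′ = proj₂ (inverse c c≉0′)

  minor₁≉0? : Decidable λ q → ¬ minor₁ q ≋ ℤ.0ℤ
  minor₁≉0? q = ¬? (minor₁ q ≋? ℤ.0ℤ)

  regularRows : List Rows
  regularRows = filter minor₁≉0? rows

  -- r · v = t becomes r₁ + r₂ (v₂ / v₁) + r₃ (v₃ / v₁) = t / v₁; since t ≠ 0, this
  -- plane determines v.
  plane : Rows → ℤ³
  plane q = minor₂ q ℤ.* recip (minor₁ q) , minor₃ q ℤ.* recip (minor₁ q) , t ℤ.* recip (minor₁ q)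

  on-plane⇔ : ∀ r q → ¬ minor₁ q ≋ ℤ.0ℤ → (r on plane q → determinant r q ≋ t) × (determinant r q ≋ t →
    r on plane q)
  on-plane⇔ (a , b , c) q v₁≉0 =
      (λ h → ≋-lin₂ h inv v₁ (t ℤ.- (b ℤ.* v₂ ℤ.+ c ℤ.* v₃)) (lemma a b c v₁ v₂ v₃ u t))
    , (λ h → ≋-lin₂ h inv u (ℤ.- a) (lemma′ a b c v₁ v₂ v₃ u t))
    where
    v₁ = minor₁ q
    v₂ = minor₂ q
    v₃ = minor₃ q
    u = recip v₁
    inv : v₁ ℤ.* u ≋ ℤ.1ℤ
    inv = recip-inverse v₁ v₁≉0
    lemma : ∀ a b c v₁ v₂ v₃ u t → (a ℤ.* v₁ ℤ.+ b ℤ.* v₂ ℤ.+ c ℤ.* v₃) ℤ.- t ≡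
      v₁ ℤ.* ((a ℤ.+ b ℤ.* (v₂ ℤ.* u) ℤ.+ c ℤ.* (v₃ ℤ.* u)) ℤ.- t ℤ.* u) ℤ.+
      (t ℤ.- (b ℤ.* v₂ ℤ.+ c ℤ.* v₃)) ℤ.* (v₁ ℤ.* u ℤ.- ℤ.1ℤ)
    lemma = ℤ.solve-∀
    lemma′ : ∀ a b c v₁ v₂ v₃ u t → (a ℤ.+ b ℤ.* (v₂ ℤ.* u) ℤ.+ c ℤ.* (v₃ ℤ.* u)) ℤ.- t ℤ.* u ≡
      u ℤ.* ((a ℤ.* v₁ ℤ.+ b ℤ.* v₂ ℤ.+ c ℤ.* v₃) ℤ.- t) ℤ.+ ℤ.- a ℤ.* (v₁ ℤ.* u ℤ.- ℤ.1ℤ)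
    lemma′ = ℤ.solve-∀

  SameMinors : Rows → Rows → Set
  SameMinors q q′ = minor₁ q ≋ minor₁ q′ × minor₂ q ≋ minor₂ q′ × minor₃ q ≋ minor₃ q′

  sameMinors? : ∀ q q′ → Dec (SameMinors q q′)
  sameMinors? q q′ = minor₁ q ≋? minor₁ q′ ×-dec minor₂ q ≋? minor₂ q′ ×-dec minor₃ q ≋? minor₃ q′

  -- Cancelling t in the constant term t / v₁ gives equal reciprocals, hence equal v₁. Clearing this
  -- common denominator from the other two coefficients gives v₂ and v₃.
  plane-injective : ∀ q q′ → ¬ minor₁ q ≋ ℤ.0ℤ → ¬ minor₁ q′ ≋ ℤ.0ℤ → plane q ≋³ plane q′ →
    SameMinors q q′
  plane-injective q q′ v₁≉0 v₁′≉0 (e₂ , e₃ , eₜ) = e₁ , numerators (minor₂ q) (minor₂ q′) e₂ ,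
    numerators (minor₃ q) (minor₃ q′) e₃
    where
    v = minor₁ q
    v′ = minor₁ q′
    u = recip v
    u′ = recip v′
    inv : v ℤ.* u ≋ ℤ.1ℤ
    inv = recip-inverse v v₁≉0
    inv′ : v′ ℤ.* u′ ≋ ℤ.1ℤ
    inv′ = recip-inverse v′ v₁′≉0
    u≋u′ : u ≋ u′
    u≋u′ = *-cancelˡ-≋ t≉0 eₜ
    e₁ : v ≋ v′
    e₁ = ≋-trans (≋-lin₂ inv′ u≋u′ (ℤ.- v) (ℤ.- (v ℤ.* v′)) (lemma v v′ u u′))
      (≋-lin₁ inv v′ (lemma′ v v′ u))
      where
      lemma : ∀ v v′ u u′ → v ℤ.- v ℤ.* u ℤ.* v′ ≡ ℤ.- v ℤ.* (v′ ℤ.* u′ ℤ.- ℤ.1ℤ) ℤ.+ ℤ.-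
        (v ℤ.* v′) ℤ.* (u ℤ.- u′)
      lemma = ℤ.solve-∀
      lemma′ : ∀ v v′ u → v ℤ.* u ℤ.* v′ ℤ.- v′ ≡ v′ ℤ.* (v ℤ.* u ℤ.- ℤ.1ℤ)
      lemma′ = ℤ.solve-∀
    numerators : ∀ a a′ → a ℤ.* u ≋ a′ ℤ.* u′ → a ≋ a′
    numerators a a′ h = ≋-trans (≋-lin₂ inv h (ℤ.- a) v (lemma a a′ v u u′))
      (≋-trans (≋-* (≋-refl {a′ ℤ.* v}) (≋-sym u≋u′)) (≋-lin₁ inv a′ (lemma′ a′ v u)))
      where
      lemma : ∀ a a′ v u u′ → a ℤ.- a′ ℤ.* v ℤ.* u′ ≡ ℤ.- a ℤ.* (v ℤ.* u ℤ.- ℤ.1ℤ) ℤ.+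
        v ℤ.* (a ℤ.* u ℤ.- a′ ℤ.* u′)
      lemma = ℤ.solve-∀
      lemma′ : ∀ a v u → a ℤ.* v ℤ.* u ℤ.- a ≡ a ℤ.* (v ℤ.* u ℤ.- ℤ.1ℤ)
      lemma′ = ℤ.solve-∀

-- Regular and singular matrices.

module Counting (p : ℕ) (p-prime : Prime p) (I : List ℤ) (distinct : Residues.Distinct p I)
                    (t : ℤ) (t≉0 : ¬ Residues._≋_ p t ℤ.0ℤ) where
  open Residues p
  open Field p-prime
  open Incidence p p-prime
  open Minors p p-prime I distinct
  open Determinants p p-prime I distinct t t≉0

  -- The row (x₁ , x₂ , x₃) is orthogonal to the vector of minors, so that
  -- x₁ = - (x₂ v₂ + x₃ v₃) / v₁; likewise for y₁.
  first-entries-unique : ∀ q′ x y →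
    ∑[ e ∈ I² ] 𝟙 (minor₁≉0? (e , x , y) ×-dec sameMinors? (e , x , y) q′) ≤ 𝟙 (minor x y ≋? minor₁ q′)
  first-entries-unique q′ x@(x₂ , x₃) y@(y₂ , y₃) = cases (v₁ ≋? ℤ.0ℤ) (v₁ ≋? minor₁ q′)
    where
    open ≤-Reasoning
    v₁ = minor x y
    v₂ = minor₂ q′
    v₃ = minor₃ q′
    form : ℤ → ℤ → ℤ
    form r s = ℤ.- (r ℤ.* v₂ ℤ.+ s ℤ.* v₃)
    lemma₁ : ∀ x₁ y₁ x₂ x₃ y₂ y₃ v₂ v₃ → (x₂ ℤ.* y₃ ℤ.- x₃ ℤ.* y₂) ℤ.* x₁ ℤ.- ℤ.-
      (x₂ ℤ.* v₂ ℤ.+ x₃ ℤ.* v₃) ≡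
      ℤ.- x₂ ℤ.* ((x₃ ℤ.* y₁ ℤ.- x₁ ℤ.* y₃) ℤ.- v₂) ℤ.+ ℤ.- x₃ ℤ.* ((x₁ ℤ.* y₂ ℤ.- x₂ ℤ.* y₁) ℤ.- v₃)
    lemma₁ = ℤ.solve-∀
    lemma₂ : ∀ x₁ y₁ x₂ x₃ y₂ y₃ v₂ v₃ → (x₂ ℤ.* y₃ ℤ.- x₃ ℤ.* y₂) ℤ.* y₁ ℤ.- ℤ.-
      (y₂ ℤ.* v₂ ℤ.+ y₃ ℤ.* v₃) ≡
      ℤ.- y₂ ℤ.* ((x₃ ℤ.* y₁ ℤ.- x₁ ℤ.* y₃) ℤ.- v₂) ℤ.+ ℤ.- y₃ ℤ.* ((x₁ ℤ.* y₂ ℤ.- x₂ ℤ.* y₁) ℤ.- v₃)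
    lemma₂ = ℤ.solve-∀
    compatible? : ∀ e → Dec (¬ v₁ ≋ ℤ.0ℤ × SameMinors (e , x , y) q′)
    compatible? e = minor₁≉0? (e , x , y) ×-dec sameMinors? (e , x , y) q′
    none : (∀ e → ¬ (¬ v₁ ≋ ℤ.0ℤ × SameMinors (e , x , y) q′)) → ∑[ e ∈ I² ] 𝟙 (compatible? e) ≤
      𝟙 (v₁ ≋? minor₁ q′)
    none ¬compatible = ≤-trans (∑-≤-const I² 0 λ e →
      ≤-reflexive (𝟙-false (compatible? e) (¬compatible e)))
      (≤-trans (≤-reflexive (*-zeroʳ (length I²))) z≤n)
    cases : Dec (v₁ ≋ ℤ.0ℤ) → Dec (v₁ ≋ minor₁ q′) → ∑[ e ∈ I² ] 𝟙 (compatible? e) ≤ 𝟙 (v₁ ≋? minor₁ q′)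
    cases (yes v₁≋0) _            = none λ { e (v₁≉0 , _) → v₁≉0 v₁≋0 }
    cases (no _)     (no v₁≉v₁′)  = none λ { e (_ , e₁ , _) → v₁≉v₁′ e₁ }
    cases (no v₁≉0)  (yes v₁≋v₁′) = begin
      (∑[ e ∈ I² ] 𝟙 (compatible? e))
        ≤⟨ ∑-mono I² (λ e → 𝟙-≤ (compatible? e) λ { (_ , _ , e₂ , e₃) →
             ≤-reflexive (sym (cong₂ _*_ (𝟙-true (v₁ ℤ.* proj₁ e ≋? form x₂ x₃)
               (≋-lin₂ e₂ e₃ (ℤ.- x₂) (ℤ.- x₃) (lemma₁ (proj₁ e) (proj₂ e) x₂ x₃ y₂ y₃ v₂ v₃)))
                                         (𝟙-true (v₁ ℤ.* proj₂ e ≋? form y₂ y₃)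
                                           (≋-lin₂ e₂ e₃ (ℤ.- y₂) (ℤ.- y₃)
                                           (lemma₂ (proj₁ e) (proj₂ e) x₂ x₃ y₂ y₃ v₂ v₃))))) }) ⟩
      (∑[ e ∈ I² ] (𝟙 (v₁ ℤ.* proj₁ e ≋? form x₂ x₃) * 𝟙 (v₁ ℤ.* proj₂ e ≋? form y₂ y₃)))
        ≡⟨ trans (∑-× I I _) (∑-*-∑ I I (λ x₁ → 𝟙 (v₁ ℤ.* x₁ ≋? form x₂ x₃))
             (λ y₁ → 𝟙 (v₁ ℤ.* y₁ ≋? form y₂ y₃))) ⟩
      (∑[ x₁ ∈ I ] 𝟙 (v₁ ℤ.* x₁ ≋? form x₂ x₃)) * (∑[ y₁ ∈ I ] 𝟙 (v₁ ℤ.* y₁ ≋? form y₂ y₃))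
        ≤⟨ *-mono-≤ (∑-𝟙-linear distinct v₁ (form x₂ x₃) v₁≉0)
             (∑-𝟙-linear distinct v₁ (form y₂ y₃) v₁≉0) ⟩
      1
        ≡⟨ sym (𝟙-true (v₁ ≋? minor₁ q′) v₁≋v₁′) ⟩
      𝟙 (v₁ ≋? minor₁ q′) ∎

  coincidences-planes : coincidences (map plane regularRows) ≤ n * n * minorEnergy
  coincidences-planes = begin
    coincidences (map plane regularRows)
      ≡⟨ trans (∑-map plane regularRows _) (trans (∑-filter minor₁≉0? rows _)
           (∑-cong rows λ q → cong (𝟙 (minor₁≉0? q) *_)
             (trans (∑-map plane regularRows _) (∑-filter minor₁≉0? rows _)))) ⟩
    (∑[ q ∈ rows ] (𝟙 (minor₁≉0? q) * (∑[ q′ ∈ rows ] (𝟙 (minor₁≉0? q′) * 𝟙 (plane q ≋³? plane q′)))))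
      ≡⟨ ∑-cong rows (λ q → sym (∑-*ˡ rows (𝟙 (minor₁≉0? q))
           (λ q′ → 𝟙 (minor₁≉0? q′) * 𝟙 (plane q ≋³? plane q′)))) ⟩
    (∑[ q ∈ rows ] ∑[ q′ ∈ rows ] (𝟙 (minor₁≉0? q) * (𝟙 (minor₁≉0? q′) * 𝟙 (plane q ≋³? plane q′))))
      ≤⟨ ∑-mono rows (λ q → ∑-mono rows λ q′ → pointwise q q′) ⟩
    (∑[ q ∈ rows ] ∑[ q′ ∈ rows ] same q q′)
      ≡⟨ trans (∑-swap rows rows same) (∑-cong rows λ q′ → ∑-rows (λ q → same q q′)) ⟩
    (∑[ q′ ∈ rows ] ∑[ e ∈ I² ] ∑[ x ∈ I² ] ∑[ y ∈ I² ] same (e , x , y) q′)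
      ≡⟨ ∑-cong rows (λ q′ → trans (∑-swap I² I² (λ e x → ∑[ y ∈ I² ] same (e , x , y) q′))
           (∑-cong I² λ x → ∑-swap I² I² (λ e y → same (e , x , y) q′))) ⟩
    (∑[ q′ ∈ rows ] ∑[ x ∈ I² ] ∑[ y ∈ I² ] ∑[ e ∈ I² ] same (e , x , y) q′)
      ≤⟨ ∑-mono rows (λ q′ → ∑-mono I² λ x → ∑-mono I² λ y → first-entries-unique q′ x y) ⟩
    (∑[ q′ ∈ rows ] ∑[ x ∈ I² ] ∑[ y ∈ I² ] 𝟙 (minor x y ≋? minor₁ q′))
      -- The summand no longer involves the first entries of `q′`; they run freely, which is the
      -- factor n².
      ≡⟨ trans (∑-rows (λ q′ → ∑[ x ∈ I² ] ∑[ y ∈ I² ] 𝟙 (minor x y ≋? minor₁ q′))) (∑-const I² _) ⟩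
    length I² * (∑[ x′ ∈ I² ] ∑[ y′ ∈ I² ] ∑[ x ∈ I² ] ∑[ y ∈ I² ] 𝟙 (minor x y ≋? minor x′ y′))
      ≡⟨ cong₂ _*_ length-I² (trans (∑-cong I² λ x′ → ∑-cong I² λ y′ → ∑-cong I² λ x → ∑-cong I² λ y →
           𝟙-cong (minor x y ≋? minor x′ y′) (minor x′ y′ ≋? minor x y) ≋-sym ≋-sym) ∑-minor-energy) ⟩
    n * n * minorEnergy ∎
    where
    open ≤-Reasoning
    same : Rows → Rows → ℕ
    same q q′ = 𝟙 (minor₁≉0? q ×-dec sameMinors? q q′)
    pointwise : ∀ q q′ → 𝟙 (minor₁≉0? q) * (𝟙 (minor₁≉0? q′) * 𝟙 (plane q ≋³? plane q′)) ≤ same q q′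
    pointwise q q′ = ≤-trans
      (≤-reflexive (sym (trans (𝟙-× (minor₁≉0? q) (minor₁≉0? q′ ×-dec plane q ≋³? plane q′))
        (cong (𝟙 (minor₁≉0? q) *_) (𝟙-× (minor₁≉0? q′) (plane q ≋³? plane q′))))))
      (𝟙-mono (minor₁≉0? q ×-dec (minor₁≉0? q′ ×-dec plane q ≋³? plane q′))
        (minor₁≉0? q ×-dec sameMinors? q q′)
        λ { (v₁≉0 , v₁′≉0 , e) → v₁≉0 , plane-injective q q′ v₁≉0 v₁′≉0 e })

  completions : Rows → ℕ
  completions q = ∑[ r ∈ I³ ] 𝟙 (determinant r q ≋? t)

  matrices regularMatrices singularMatrices : ℕ
  matrices = ∑[ q ∈ rows ] completions q
  regularMatrices = ∑[ q ∈ rows ] (𝟙 (minor₁≉0? q) * completions q)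
  singularMatrices = ∑[ q ∈ rows ] (𝟙 (minor₁ q ≋? ℤ.0ℤ) * completions q)

  𝟙-complement : {P : Set} (P? : Dec P) → 𝟙 (¬? P?) + 𝟙 P? ≡ 1
  𝟙-complement (yes _) = refl
  𝟙-complement (no _)  = refl

  matrices-split : matrices ≡ regularMatrices + singularMatrices
  matrices-split = trans (∑-cong rows λ q →
    sym (trans (sym (*-distribʳ-+ (completions q) (𝟙 (minor₁≉0? q)) (𝟙 (minor₁ q ≋? ℤ.0ℤ))))
      (trans (cong (_* completions q) (𝟙-complement (minor₁ q ≋? ℤ.0ℤ))) (*-identityˡ (completions q)))))
    (∑-+ rows (λ q → 𝟙 (minor₁≉0? q) * completions q) (λ q → 𝟙 (minor₁ q ≋? ℤ.0ℤ) * completions q))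

  ∑-singular : ∑[ q ∈ rows ] 𝟙 (minor₁ q ≋? ℤ.0ℤ) ≡ n * n * zeroMinors
  ∑-singular = trans (∑-rows (λ q → 𝟙 (minor₁ q ≋? ℤ.0ℤ)))
    (trans (∑-const I² zeroMinors) (cong (_* zeroMinors) length-I²))

  singularMatrices-bound : singularMatrices ≤ n * n * zeroMinors * (n * n)
  singularMatrices-bound = begin
    singularMatrices
      ≤⟨ ∑-mono rows (λ q → *-monoʳ-≤ (𝟙 (minor₁ q ≋? ℤ.0ℤ))
           (≤-trans (≤-reflexive (∑-I³ (λ r → 𝟙 (determinant r q ≋? t))))
           (linear-form-bound (minor₁ q) (minor₂ q) (minor₃ q)))) ⟩
    (∑[ q ∈ rows ] (𝟙 (minor₁ q ≋? ℤ.0ℤ) * (n * n)))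
      ≡⟨ trans (∑-*ʳ rows (n * n) (λ q → 𝟙 (minor₁ q ≋? ℤ.0ℤ))) (cong (_* (n * n)) ∑-singular) ⟩
    n * n * zeroMinors * (n * n) ∎
    where open ≤-Reasoning

  incidences-planes : incidences I³ (map plane regularRows) ≡ regularMatrices
  incidences-planes = begin
    (∑[ r ∈ I³ ] ∑[ w ∈ map plane regularRows ] 𝟙 (r on? w))
      ≡⟨ ∑-swap I³ (map plane regularRows) (λ r w → 𝟙 (r on? w)) ⟩
    (∑[ w ∈ map plane regularRows ] ∑[ r ∈ I³ ] 𝟙 (r on? w))
      ≡⟨ trans (∑-map plane regularRows _) (∑-filter minor₁≉0? rows _) ⟩
    (∑[ q ∈ rows ] (𝟙 (minor₁≉0? q) * (∑[ r ∈ I³ ] 𝟙 (r on? plane q))))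
      ≡⟨ ∑-cong rows pointwise ⟩
    regularMatrices ∎
    where
    open ≡-Reasoning
    pointwise : ∀ q → 𝟙 (minor₁≉0? q) * (∑[ r ∈ I³ ] 𝟙 (r on? plane q)) ≡ 𝟙 (minor₁≉0? q) * completions q
    pointwise q = cases (minor₁ q ≋? ℤ.0ℤ)
      where
      cases : (d : Dec (minor₁ q ≋ ℤ.0ℤ)) → 𝟙 (¬? d) * (∑[ r ∈ I³ ] 𝟙 (r on? plane q)) ≡
        𝟙 (¬? d) * completions q
      cases (yes _)   = refl
      cases (no v₁≉0) = cong (1 *_) (∑-cong I³ λ r → let to , from = on-plane⇔ r q v₁≉0 in
                          𝟙-cong (r on? plane q) (determinant r q ≋? t) to from)

  length-regularRows : length regularRows + n * n * zeroMinors ≡ n * n * (n * n * (n * n))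
  length-regularRows = begin
    length regularRows + n * n * zeroMinors
      ≡⟨ cong₂ _+_ (length-filter minor₁≉0? rows) (sym ∑-singular) ⟩
    (∑[ q ∈ rows ] 𝟙 (minor₁≉0? q)) + (∑[ q ∈ rows ] 𝟙 (minor₁ q ≋? ℤ.0ℤ))
      ≡⟨ sym (∑-+ rows (λ q → 𝟙 (minor₁≉0? q)) (λ q → 𝟙 (minor₁ q ≋? ℤ.0ℤ))) ⟩
    (∑[ q ∈ rows ] (𝟙 (minor₁≉0? q) + 𝟙 (minor₁ q ≋? ℤ.0ℤ)))
      ≡⟨ trans (∑-cong rows λ q → 𝟙-complement (minor₁ q ≋? ℤ.0ℤ))
           (trans (∑-const rows 1) (*-identityʳ _)) ⟩
    length rows
      ≡⟨ trans (length-× I² I⁴) (cong₂ _*_ length-I² length-I⁴) ⟩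
    n * n * (n * n * (n * n)) ∎
    where open ≡-Reasoning

  deviation : ℕ
  deviation = ∣ p * regularMatrices - n * (n * n) * length regularRows ∣

  deviation-bound : deviation * deviation ≤ p * p * (p * p) * (n * (n * n) * (n * n * minorEnergy))
  deviation-bound = begin
    deviation * deviation
      ≡⟨ cong (λ z → z * z) (cong₂ (λ i l → ∣ p * i - l ∣) (sym incidences-planes)
           (sym (cong₂ _*_ length-I³ (length-map plane regularRows)))) ⟩
    ∣ p * incidences I³ Y - length I³ * length Y ∣ * ∣ p * incidences I³ Y - length I³ * length Y ∣
      ≤⟨ incidence-bound I³ Y ⟩
    p * p * (p * p) * (coincidences I³ * coincidences Y)
      ≤⟨ *-monoʳ-≤ (p * p * (p * p)) (*-mono-≤ coincidences-I³ coincidences-planes) ⟩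
    p * p * (p * p) * (n * (n * n) * (n * n * minorEnergy)) ∎
    where
    open ≤-Reasoning
    Y = map plane regularRows

  ∣a+b-c+d∣≤ : ∀ a b c d → ∣ a + b - c + d ∣ ≤ ∣ a - c ∣ + (b + d)
  ∣a+b-c+d∣≤ a b c d = begin
    ∣ a + b - c + d ∣                       ≤⟨ ∣-∣-triangle (a + b) a (c + d) ⟩
    ∣ a + b - a ∣ + ∣ a - c + d ∣           ≤⟨ +-monoʳ-≤ ∣ a + b - a ∣ (∣-∣-triangle a c (c + d)) ⟩
    ∣ a + b - a ∣ + (∣ a - c ∣ + ∣ c - c + d ∣)
      ≡⟨ cong₂ (λ x y → x + (∣ a - c ∣ + y)) (trans (∣-∣-comm (a + b) a) (∣m-m+n∣≡n a b))
      (∣m-m+n∣≡n c d) ⟩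
    b + (∣ a - c ∣ + d)                     ≡⟨ lemma b ∣ a - c ∣ d ⟩
    ∣ a - c ∣ + (b + d)                     ∎
    where
    open ≤-Reasoning
    lemma : ∀ b x d → b + (x + d) ≡ x + (b + d)
    lemma = solve-∀

  -- Rows with v₁ = 0 number at most 2 n⁵ and err twice: with at most n² completions each they
  -- contribute 2 p n⁷ on the left, and their absence from the n³ · |`regularRows`| of the main term
  -- costs 2 n⁸.
  matrices-bound : ∣ p * matrices - n ^ 9 ∣ ≤ deviation + (2 * (p * n ^ 7) + 2 * n ^ 8)
  matrices-bound = begin
    ∣ p * matrices - n ^ 9 ∣
      ≡⟨ cong₂ ∣_-_∣ (trans (cong (p *_) matrices-split)
           (*-distribˡ-+ p regularMatrices singularMatrices))
                     (trans (lemma₁ n) (trans (cong (n * (n * n) *_) (sym length-regularRows))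
                       (*-distribˡ-+ (n * (n * n)) (length regularRows) _))) ⟩
    ∣ p * regularMatrices + p * singularMatrices - n * (n * n) * length regularRows +
      n * (n * n) * (n * n * zeroMinors) ∣
      ≤⟨ ∣a+b-c+d∣≤ (p * regularMatrices) (p * singularMatrices) (n * (n * n) * length regularRows)
           (n * (n * n) * (n * n * zeroMinors)) ⟩
    deviation + (p * singularMatrices + n * (n * n) * (n * n * zeroMinors))
      ≤⟨ +-monoʳ-≤ deviation (+-mono-≤
           (*-monoʳ-≤ p (≤-trans singularMatrices-bound
           (*-monoˡ-≤ (n * n) (*-monoʳ-≤ (n * n) zeroMinors-bound))))
           (*-monoʳ-≤ (n * (n * n)) (*-monoʳ-≤ (n * n) zeroMinors-bound))) ⟩
    deviation + (p * (n * n * (2 * (n * (n * n))) * (n * n)) +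
      n * (n * n) * (n * n * (2 * (n * (n * n)))))
      ≡⟨ cong (λ z → deviation + z) (lemma₂ p n) ⟩
    deviation + (2 * (p * n ^ 7) + 2 * n ^ 8) ∎
    where
    open ≤-Reasoning
    lemma₁ : ∀ n → n * (n * (n * (n * (n * (n * (n * (n * (n * 1)))))))) ≡
      n * (n * n) * (n * n * (n * n * (n * n)))
    lemma₁ = solve-∀
    lemma₂ : ∀ p n → p * (n * n * (2 * (n * (n * n))) * (n * n)) +
      n * (n * n) * (n * n * (2 * (n * (n * n)))) ≡
      2 * (p * (n * (n * (n * (n * (n * (n * (n * 1)))))))) +
      2 * (n * (n * (n * (n * (n * (n * (n * (n * 1))))))))
    lemma₂ = solve-∀

-- The summand is given through the three values of its argument, so that functions are never
-- compared with each other.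
∑-allFuns₃ : (xs : List A) (f : (Fin 3 → A) → ℕ) (g : A → A → A → ℕ) →
  (∀ h → f h ≡ g (h i0) (h i1) (h i2)) →
             ∑ (allFuns xs 3) f ≡ ∑[ x ∈ xs ] ∑[ y ∈ xs ] ∑[ z ∈ xs ] g x y z
∑-allFuns₃ xs f g f≡g = trans (∑-cong (allFuns xs 3) f≡g)
  (trans (∑-concatMap _ xs _) (∑-cong xs λ x → trans (∑-map _ (allFuns xs 2) _)
  (trans (∑-concatMap _ xs _) (∑-cong xs λ y → trans (∑-map _ (allFuns xs 1) _)
  (trans (∑-concatMap _ xs _) (∑-cong xs λ z → +-identityʳ (g x y z)))))))

-- Consequences of the size of H and the total error.

^-distribʳ-* : ∀ k m n → (m * n) ^ k ≡ m ^ k * n ^ k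
^-distribʳ-* zero    m n = refl
^-distribʳ-* (suc k) m n = trans (cong (m * n *_) (^-distribʳ-* k m n))
  ([m*n]*[o*p]≡[m*o]*[n*p] m n (m ^ k) (n ^ k))

-- With s of order p^(1/10), ten blocks suffice in divisorSum-bound, and the
-- resulting factor s² ≪ p^(1/5) is absorbed by n² ≥ C² p^(6/5).
tenth-root : ∀ p → 1 ≤ p → ∃ λ s → 1 ≤ s × p ≤ s ^ 10 × s ^ 10 ≤ 4 ^ 5 * p
tenth-root p@(suc p-1) 1≤p = search p-1 (m≤m*n p (p ^ 9) {{m^n≢0 p 9}})
  where
  open ≤-Reasoning
  search : ∀ m → p ≤ suc m ^ 10 → ∃ λ s → 1 ≤ s × p ≤ s ^ 10 × s ^ 10 ≤ 4 ^ 5 * p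
  search zero    p≤1 = 1 , ≤-refl , p≤1 , ≤-trans 1≤p (m≤n*m p (4 ^ 5))
  search (suc m) p≤ with p ≤? suc m ^ 10
  ... | yes p≤′ = search m p≤′
  -- Since m + 1 is too small and m + 2 ≤ 2 (m + 1), the overshoot is at most 2^10. It is written
  -- 4^5 because it is later merged into a fifth power.
  ... | no p≰   = suc (suc m) , s≤s z≤n , p≤ , (begin
    suc (suc m) ^ 10        ≤⟨ ^-monoˡ-≤ 10
      (s≤s (≤-trans (s≤s (m≤m+n m (m + 0))) (≤-reflexive (sym (+-suc m (m + 0)))))) ⟩
    (2 * suc m) ^ 10        ≡⟨ ^-distribʳ-* 10 2 (suc m) ⟩
    4 ^ 5 * suc m ^ 10      ≤⟨ *-monoʳ-≤ (4 ^ 5) (<⇒≤ (≰⇒> p≰)) ⟩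
    4 ^ 5 * p               ∎)

^5-cancel-≤ : ∀ {m n} → m ^ 5 ≤ n ^ 5 → m ≤ n
^5-cancel-≤ {m} {n} m⁵≤n⁵ with m ≤? n
... | yes m≤n = m≤n
... | no m≰n  = contradiction m⁵≤n⁵ (<⇒≱ (^-monoˡ-< 5 (≰⇒> m≰n)))

module _ {C p H n : ℕ} (H≤n : H ≤ n) (1≤p : 1 ≤ p) (large : C ^ 5 * p ^ 3 ≤ H ^ 5) where
  open ≤-Reasoning

  large⇒C⁵p³≤n⁵ : C ^ 5 * p ^ 3 ≤ n ^ 5
  large⇒C⁵p³≤n⁵ = ≤-trans large (^-monoˡ-≤ 5 H≤n)

  large⇒C≤n : C ≤ n
  large⇒C≤n = ^5-cancel-≤ (begin
    C ^ 5         ≡⟨ sym (*-identityʳ (C ^ 5)) ⟩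
    C ^ 5 * 1     ≤⟨ *-monoʳ-≤ (C ^ 5) (^-monoˡ-≤ 3 1≤p) ⟩
    C ^ 5 * p ^ 3 ≤⟨ large⇒C⁵p³≤n⁵ ⟩
    n ^ 5         ∎)

  -- The square of the hypothesis n ≥ C p^(3/5), cleared of roots. Writing p⁶ as p · p⁵ sets aside
  -- one factor p, which absorbs s^10 ≤ 4^5 p before fifth roots are taken.
  large⇒C¹⁰p⁶≤n¹⁰ : (C * C) ^ 5 * (p * p ^ 5) ≤ (n * n) ^ 5
  large⇒C¹⁰p⁶≤n¹⁰ = begin
    (C * C) ^ 5 * (p * p ^ 5)           ≡⟨ cong (_* (p * p ^ 5)) (^-distribʳ-* 5 C C) ⟩
    C ^ 5 * C ^ 5 * (p * p ^ 5)         ≡⟨ cong (C ^ 5 * C ^ 5 *_) (^-distribˡ-+-* p 3 3) ⟩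
    C ^ 5 * C ^ 5 * (p ^ 3 * p ^ 3)     ≡⟨ [m*n]*[o*p]≡[m*o]*[n*p] (C ^ 5) (C ^ 5) (p ^ 3) (p ^ 3) ⟩
    C ^ 5 * p ^ 3 * (C ^ 5 * p ^ 3)     ≤⟨ *-mono-≤ large⇒C⁵p³≤n⁵ large⇒C⁵p³≤n⁵ ⟩
    n ^ 5 * n ^ 5                       ≡⟨ sym (^-distribʳ-* 5 n n) ⟩
    (n * n) ^ 5                         ∎

  large⇒C²p≤n² : C * C * p ≤ n * n
  large⇒C²p≤n² = ^5-cancel-≤ (begin
    (C * C * p) ^ 5               ≡⟨ ^-distribʳ-* 5 (C * C) p ⟩
    (C * C) ^ 5 * p ^ 5           ≤⟨ *-monoʳ-≤ ((C * C) ^ 5)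
      (≤-trans (≤-reflexive (sym (*-identityˡ (p ^ 5)))) (*-monoˡ-≤ (p ^ 5) 1≤p)) ⟩
    (C * C) ^ 5 * (p * p ^ 5)     ≤⟨ large⇒C¹⁰p⁶≤n¹⁰ ⟩
    (n * n) ^ 5                   ∎)

  large⇒cs²p≤n² : ∀ {c s} → 4 * c ≤ C * C → s ^ 10 ≤ 4 ^ 5 * p → c * (s * s) * p ≤ n * n
  large⇒cs²p≤n² {c} {s} 4c≤C² s¹⁰≤ = ^5-cancel-≤ (begin
    (c * (s * s) * p) ^ 5                
      ≡⟨ trans (^-distribʳ-* 5 (c * (s * s)) p) (cong (_* p ^ 5) (^-distribʳ-* 5 c (s * s))) ⟩
    c ^ 5 * (s * s) ^ 5 * p ^ 5          
      ≡⟨ cong (λ z → c ^ 5 * z * p ^ 5) (trans (^-distribʳ-* 5 s s) (sym (^-distribˡ-+-* s 5 5))) ⟩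
    c ^ 5 * s ^ 10 * p ^ 5                ≤⟨ *-monoˡ-≤ (p ^ 5) (*-monoʳ-≤ (c ^ 5) s¹⁰≤) ⟩
    c ^ 5 * (4 ^ 5 * p) * p ^ 5           ≡⟨ lemma (c ^ 5) (4 ^ 5) p (p ^ 5) ⟩
    4 ^ 5 * c ^ 5 * (p * p ^ 5)           ≡⟨ cong (_* (p * p ^ 5)) (sym (^-distribʳ-* 5 4 c)) ⟩
    (4 * c) ^ 5 * (p * p ^ 5)             ≤⟨ *-monoˡ-≤ (p * p ^ 5) (^-monoˡ-≤ 5 4c≤C²) ⟩
    (C * C) ^ 5 * (p * p ^ 5)             ≤⟨ large⇒C¹⁰p⁶≤n¹⁰ ⟩
    (n * n) ^ 5                           ∎)
    where
    lemma : ∀ a b p q → a * (b * p) * q ≡ b * a * (p * q)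
    lemma = solve-∀

-- Each of the three error terms receives one third of n⁹. For the last two this means 6 K p ≤ n²
-- and 6 K ≤ n; for the deviation, squared, it means 18 K² p³ ≤ n⁵, with 18 = 3² · 2 and the 2
-- coming from p E ≤ 2 n⁸.
error-bound : ∀ {c p n s K E M dev} .{{_ : NonZero p}} →
  c * (s * s) * p ≤ n * n →
  p * M ≤ c * ((s * s) * (n * n * (n * n))) →
  p * E ≤ n * n * (n * n) * (n * n * (n * n)) + p * p * (n * n * M) →
  dev * dev ≤ p * p * (p * p) * (n * (n * n) * (n * n * E)) →
  18 * (K * K) * p ^ 3 ≤ n ^ 5 → 6 * K * p ≤ n * n → 6 * K ≤ n →
  K * (dev + (2 * (p * n ^ 7) + 2 * n ^ 8)) ≤ n ^ 9
error-bound {c} {p} {n} {s} {K} {E} {M} {dev} cs²p≤n² M-bound E-bound dev-bound 18K²p³≤n⁵ 6Kp≤n² 6K≤n =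
  *-cancelˡ-≤ 3 (begin
    3 * (K * (dev + (2 * (p * n ^ 7) + 2 * n ^ 8)))
      ≡⟨ lemma₁ K dev p (n ^ 7) (n ^ 8) ⟩
    3 * K * dev + (6 * K * p * n ^ 7 + 6 * K * n ^ 8)
      ≤⟨ +-mono-≤ 3Kdev≤n⁹ (+-mono-≤ (*-monoˡ-≤ (n ^ 7) 6Kp≤n²) (*-monoˡ-≤ (n ^ 8) 6K≤n)) ⟩
    n ^ 9 + (n * n * n ^ 7 + n * n ^ 8)
      ≡⟨ lemma₂ (n ^ 7) n ⟩
    3 * n ^ 9 ∎)
  where
  open ≤-Reasoning
  n⁸ = n * n * (n * n) * (n * n * (n * n))
  lemma₁ : ∀ k d p x y → 3 * (k * (d + (2 * (p * x) + 2 * y))) ≡ 3 * k * d + (6 * k * p * x + 6 * k * y)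
  lemma₁ = solve-∀
  lemma₂ : ∀ x n → n * (n * x) + (n * n * x + n * (n * x)) ≡ 3 * (n * (n * x))
  lemma₂ = solve-∀

  pE≤2n⁸ : p * E ≤ 2 * n⁸
  pE≤2n⁸ = begin
    p * E                                                ≤⟨ E-bound ⟩
    n⁸ + p * p * (n * n * M)                             ≡⟨ cong (λ z → n⁸ + z) (lemma₃ p n M) ⟩
    n⁸ + p * (n * n) * (p * M)                          
      ≤⟨ +-monoʳ-≤ n⁸ (*-monoʳ-≤ (p * (n * n)) M-bound) ⟩
    n⁸ + p * (n * n) * (c * ((s * s) * (n * n * (n * n)))) ≡⟨ cong (λ z → n⁸ + z) (lemma₄ c p n s) ⟩
    n⁸ + c * (s * s) * p * (n * n * (n * n * (n * n)))  
      ≤⟨ +-monoʳ-≤ n⁸ (*-monoˡ-≤ (n * n * (n * n * (n * n))) cs²p≤n²) ⟩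
    n⁸ + n * n * (n * n * (n * n * (n * n)))             ≡⟨ lemma₅ n ⟩
    2 * n⁸                                               ∎
    where
    lemma₃ : ∀ p n m → p * p * (n * n * m) ≡ p * (n * n) * (p * m)
    lemma₃ = solve-∀
    lemma₄ : ∀ c p n s → p * (n * n) * (c * ((s * s) * (n * n * (n * n)))) ≡
      c * (s * s) * p * (n * n * (n * n * (n * n)))
    lemma₄ = solve-∀
    lemma₅ : ∀ n → n * n * (n * n) * (n * n * (n * n)) + n * n * (n * n * (n * n * (n * n))) ≡
      2 * (n * n * (n * n) * (n * n * (n * n)))
    lemma₅ = solve-∀

  -- E is controlled only in the form p E, so the inequality is proved after multiplication by p;
  -- this is how p⁴ drops to p³.
  dev²≤2p³n¹³ : dev * dev ≤ 2 * p ^ 3 * (n ^ 5 * n⁸)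
  dev²≤2p³n¹³ = *-cancelˡ-≤ p (begin
    p * (dev * dev)                                           ≤⟨ *-monoʳ-≤ p dev-bound ⟩
    p * (p * p * (p * p) * (n * (n * n) * (n * n * E)))       ≡⟨ lemma₃ p n E ⟩
    p * p * (p * p) * (n * (n * (n * (n * n)))) * (p * E)    
      ≤⟨ *-monoʳ-≤ (p * p * (p * p) * (n * (n * (n * (n * n))))) pE≤2n⁸ ⟩
    p * p * (p * p) * (n * (n * (n * (n * n)))) * (2 * n⁸)    ≡⟨ lemma₄ p n n⁸ ⟩
    p * (2 * p ^ 3 * (n ^ 5 * n⁸))                            ∎)
    where
    lemma₃ : ∀ p n e → p * (p * p * (p * p) * (n * (n * n) * (n * n * e))) ≡
      p * p * (p * p) * (n * (n * (n * (n * n)))) * (p * e)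
    lemma₃ = solve-∀
    lemma₄ : ∀ p n x → p * p * (p * p) * (n * (n * (n * (n * n)))) * (2 * x) ≡
      p * (2 * (p * (p * (p * 1))) * ((n * (n * (n * (n * (n * 1))))) * x))
    lemma₄ = solve-∀

  3Kdev≤n⁹ : 3 * K * dev ≤ n ^ 9
  3Kdev≤n⁹ = m²≤n²⇒m≤n (begin
    3 * K * dev * (3 * K * dev)                     ≡⟨ lemma₃ K dev ⟩
    9 * (K * K) * (dev * dev)                       ≤⟨ *-monoʳ-≤ (9 * (K * K)) dev²≤2p³n¹³ ⟩
    9 * (K * K) * (2 * p ^ 3 * (n ^ 5 * n⁸))        ≡⟨ lemma₄ K (p ^ 3) (n ^ 5) n⁸ ⟩
    18 * (K * K) * p ^ 3 * (n ^ 5 * n⁸)             ≤⟨ *-monoˡ-≤ (n ^ 5 * n⁸) 18K²p³≤n⁵ ⟩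
    n ^ 5 * (n ^ 5 * n⁸)                            ≡⟨ lemma₅ n ⟩
    n ^ 9 * n ^ 9                                   ∎)
    where
    lemma₃ : ∀ k d → 3 * k * d * (3 * k * d) ≡ 9 * (k * k) * (d * d)
    lemma₃ = solve-∀
    lemma₄ : ∀ k p n x → 9 * (k * k) * (2 * p * (n * x)) ≡ 18 * (k * k) * p * (n * x)
    lemma₄ = solve-∀
    lemma₅ : ∀ n → (n * (n * (n * (n * (n * 1))))) *
      ((n * (n * (n * (n * (n * 1))))) * (n * n * (n * n) * (n * n * (n * n)))) ≡
      (n * (n * (n * (n * (n * (n * (n * (n * (n * 1))))))))) *
      (n * (n * (n * (n * (n * (n * (n * (n * (n * 1)))))))))
    lemma₅ = solve-∀

-- From the count of matrices to the asymptotic formula.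

detCount : ℕ → List ℤ → ℤ → ℕ
detCount p I t = length (filter (λ M → p ∣? ∣ det3 M ℤ.- t ∣) (matrices3 I))

module Bridge (p : ℕ) (p-prime : Prime p) (I : List ℤ) (distinct : Residues.Distinct p I)
              (t : ℤ) (t≉0 : ¬ Residues._≋_ p t ℤ.0ℤ) where
  open Residues p
  open Minors p p-prime I distinct
  open Determinants p p-prime I distinct t t≉0
  open Counting p p-prime I distinct t t≉0

  -- A matrix is enumerated row by row, while `rows` lists the first entries of the last two rows
  -- before the rest. The swaps of sums reconcile the two orders, and the final identity moves the
  -- minus sign of the middle cofactor into `minor₂`.
  matrices3-count : detCount p I t ≡ matrices
  matrices3-count = begin
    detCount p I t
      ≡⟨ length-filter _ (matrices3 I) ⟩
    (∑[ M ∈ matrices3 I ] 𝟙 (p ∣? ∣ det3 M ℤ.- t ∣))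
      ≡⟨ ∑-cong (matrices3 I) (λ M → 𝟙-cong (p ∣? ∣ det3 M ℤ.- t ∣) (det3 M ≋? t)
           (λ d → mod (Signed.∣ᵤ⇒∣ d)) (λ { (mod d) → Signed.∣⇒∣ᵤ d })) ⟩
    (∑[ M ∈ matrices3 I ] 𝟙 (det3 M ≋? t))
      ≡⟨ ∑-allFuns₃ (allFuns I 3) (λ M → 𝟙 (det3 M ≋? t))
           (λ r x y → F (r i0) (r i1) (r i2) (x i0) (x i1) (x i2) (y i0) (y i1) (y i2)) (λ M → refl) ⟩
    (∑[ r ∈ allFuns I 3 ] ∑[ x ∈ allFuns I 3 ] ∑[ y ∈ allFuns I 3 ]
      F (r i0) (r i1) (r i2) (x i0) (x i1) (x i2) (y i0) (y i1) (y i2))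
      ≡⟨ trans (∑-swap (allFuns I 3) (allFuns I 3) _) (∑-cong (allFuns I 3) λ x →
           ∑-swap (allFuns I 3) (allFuns I 3) _) ⟩
    (∑[ x ∈ allFuns I 3 ] ∑[ y ∈ allFuns I 3 ] ∑[ r ∈ allFuns I 3 ]
      F (r i0) (r i1) (r i2) (x i0) (x i1) (x i2) (y i0) (y i1) (y i2))
      ≡⟨ ∑-cong (allFuns I 3) (λ x → ∑-cong (allFuns I 3) λ y → ∑-allFuns₃ I
           (λ r → F (r i0) (r i1) (r i2) (x i0) (x i1) (x i2) (y i0) (y i1) (y i2))
           (λ a b c → F a b c (x i0) (x i1) (x i2) (y i0) (y i1) (y i2)) (λ _ → refl)) ⟩
    (∑[ x ∈ allFuns I 3 ] ∑[ y ∈ allFuns I 3 ] G (x i0) (x i1) (x i2) (y i0) (y i1) (y i2))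
      ≡⟨ ∑-cong (allFuns I 3) (λ x → ∑-allFuns₃ I (λ y → G (x i0) (x i1) (x i2) (y i0) (y i1) (y i2))
           (G (x i0) (x i1) (x i2)) (λ _ → refl)) ⟩
    (∑[ x ∈ allFuns I 3 ] ∑[ y₁ ∈ I ] ∑[ y₂ ∈ I ] ∑[ y₃ ∈ I ] G (x i0) (x i1) (x i2) y₁ y₂ y₃)
      ≡⟨ ∑-allFuns₃ I (λ x → ∑[ y₁ ∈ I ] ∑[ y₂ ∈ I ] ∑[ y₃ ∈ I ] G (x i0) (x i1) (x i2) y₁ y₂ y₃)
           (λ x₁ x₂ x₃ → ∑[ y₁ ∈ I ] ∑[ y₂ ∈ I ] ∑[ y₃ ∈ I ] G x₁ x₂ x₃ y₁ y₂ y₃) (λ _ → refl) ⟩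
    (∑[ x₁ ∈ I ] ∑[ x₂ ∈ I ] ∑[ x₃ ∈ I ] ∑[ y₁ ∈ I ] ∑[ y₂ ∈ I ] ∑[ y₃ ∈ I ] G x₁ x₂ x₃ y₁ y₂ y₃)
      ≡⟨ ∑-cong I (λ x₁ → trans (∑-cong I λ x₂ →
           ∑-swap I I (λ x₃ y₁ → ∑[ y₂ ∈ I ] ∑[ y₃ ∈ I ] G x₁ x₂ x₃ y₁ y₂ y₃))
           (∑-swap I I (λ x₂ y₁ → ∑[ x₃ ∈ I ] ∑[ y₂ ∈ I ] ∑[ y₃ ∈ I ] G x₁ x₂ x₃ y₁ y₂ y₃))) ⟩
    (∑[ x₁ ∈ I ] ∑[ y₁ ∈ I ] ∑[ x₂ ∈ I ] ∑[ x₃ ∈ I ] ∑[ y₂ ∈ I ] ∑[ y₃ ∈ I ] G x₁ x₂ x₃ y₁ y₂ y₃)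
      ≡⟨ ∑-cong I (λ x₁ → ∑-cong I λ y₁ → ∑-cong I λ x₂ → ∑-cong I λ x₃ → ∑-cong I λ y₂ → ∑-cong I λ y₃ →
           trans (∑-cong I λ a → ∑-cong I λ b → ∑-cong I λ c →
             cong (λ z → 𝟙 (z ≋? t)) (lemma a b c x₁ x₂ x₃ y₁ y₂ y₃))
           (sym (∑-I³ (λ r → 𝟙 (determinant r ((x₁ , y₁) , (x₂ , x₃) , (y₂ , y₃)) ≋? t))))) ⟩
    (∑[ x₁ ∈ I ] ∑[ y₁ ∈ I ] ∑[ x₂ ∈ I ] ∑[ x₃ ∈ I ] ∑[ y₂ ∈ I ] ∑[ y₃ ∈ I ]
      completions ((x₁ , y₁) , (x₂ , x₃) , (y₂ , y₃)))
      ≡⟨ sym (trans (∑-rows completions) (trans (∑-× I I _) (∑-cong I λ x₁ → ∑-cong I λ y₁ →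
           trans (∑-× I I _) (∑-cong I λ x₂ → ∑-cong I λ x₃ →
             ∑-× I I (λ y → completions ((x₁ , y₁) , (x₂ , x₃) , y)))))) ⟩
    matrices ∎
    where
    open ≡-Reasoning
    F : (a b c x₁ x₂ x₃ y₁ y₂ y₃ : ℤ) → ℕ
    F a b c x₁ x₂ x₃ y₁ y₂ y₃ = 𝟙 (a ℤ.* (x₂ ℤ.* y₃ ℤ.- x₃ ℤ.* y₂) ℤ.- b ℤ.* (x₁ ℤ.* y₃ ℤ.- x₃ ℤ.* y₁)
                                     ℤ.+ c ℤ.* (x₁ ℤ.* y₂ ℤ.- x₂ ℤ.* y₁) ≋? t)
    G : (x₁ x₂ x₃ y₁ y₂ y₃ : ℤ) → ℕ
    G x₁ x₂ x₃ y₁ y₂ y₃ = ∑[ a ∈ I ] ∑[ b ∈ I ] ∑[ c ∈ I ] F a b c x₁ x₂ x₃ y₁ y₂ y₃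
    lemma : ∀ a b c x₁ x₂ x₃ y₁ y₂ y₃ →
      a ℤ.* (x₂ ℤ.* y₃ ℤ.- x₃ ℤ.* y₂) ℤ.- b ℤ.* (x₁ ℤ.* y₃ ℤ.- x₃ ℤ.* y₁) ℤ.+
        c ℤ.* (x₁ ℤ.* y₂ ℤ.- x₂ ℤ.* y₁) ≡
      a ℤ.* (x₂ ℤ.* y₃ ℤ.- x₃ ℤ.* y₂) ℤ.+ b ℤ.* (x₃ ℤ.* y₁ ℤ.- x₁ ℤ.* y₃) ℤ.+
        c ℤ.* (x₁ ℤ.* y₂ ℤ.- x₂ ℤ.* y₁)
    lemma = ℤ.solve-∀

-- Stated for abstract N and n so that interval H is never unfolded in the conclusion.
asymptotics : ∀ {C K p H s t N n} (p-prime : Prime p) (I : List ℤ) → Residues.Distinct p I →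
  detCount p I t ≡ N → length I ≡ n → H ≤ n →
  ¬ Residues._≋_ p t ℤ.0ℤ → C ^ 5 * p ^ 3 ≤ H ^ 5 →
  4 * 4608 ≤ C * C → 6 * K ≤ C → 18 * (K * K) ≤ C ^ 5 →
  s ^ 10 ≤ 4 ^ 5 * p →
  p * Residues.multiplicativeEnergy p I ≤ 4608 * ((s * s) * (n * n * (n * n))) →
  K * ∣ N * p - n ^ 9 ∣ ≤ n ^ 9
asymptotics {C} {K} {p} {H} {s} {t} p-prime I distinct refl refl H≤n t≉0 large 4c≤C² 6K≤C 18K²≤C⁵ s¹⁰≤
  energy-bound = begin
  K * ∣ detCount p I t * p - n ^ 9 ∣
    ≡⟨ cong (λ z → K * ∣ z - n ^ 9 ∣) (trans (cong (_* p) matrices3-count) (*-comm matrices p)) ⟩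
  K * ∣ p * matrices - n ^ 9 ∣
    ≤⟨ *-monoʳ-≤ K matrices-bound ⟩
  K * (deviation + (2 * (p * n ^ 7) + 2 * n ^ 8))
    ≤⟨ error-bound {4608} {p} {n} {s} {K} {minorEnergy} {Residues.multiplicativeEnergy p I} {deviation}
         (large⇒cs²p≤n² {C} H≤n 1≤p large {4608} {s} 4c≤C² s¹⁰≤)
         energy-bound minorEnergy-bound deviation-bound
         (≤-trans (*-monoˡ-≤ (p ^ 3) 18K²≤C⁵) (large⇒C⁵p³≤n⁵ {C} H≤n 1≤p large))
         (≤-trans (*-monoˡ-≤ p (≤-trans 6K≤C C≤C²)) (large⇒C²p≤n² {C} H≤n 1≤p large))
         (≤-trans 6K≤C (large⇒C≤n {C} H≤n 1≤p large)) ⟩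
  n ^ 9 ∎
  where
  open ≤-Reasoning
  open Minors p p-prime I distinct using (minorEnergy; minorEnergy-bound)
  open Counting p p-prime I distinct t t≉0 using (matrices; matrices-bound; deviation; deviation-bound)
  open Bridge p p-prime I distinct t t≉0 using (matrices3-count)
  instance
    p≢0 : NonZero p
    p≢0 = prime⇒nonZero p-prime
  n : ℕ
  n = length I
  1≤p : 1 ≤ p
  1≤p = >-nonZero⁻¹ p
  C≤C² : C ≤ C * C
  C≤C² = m≤m*m C
    where
    m≤m*m : ∀ m → m ≤ m * m
    m≤m*m zero        = z≤n
    m≤m*m m@(suc _) = m≤m*n m m

theorem5 : (k : ℕ) → Σ ℕ λ C → Σ ℕ λ P₀ →
    (p H t : ℕ) → Prime p → p % 2 ≡ 1 → P₀ ≤ p →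
    1 ≤ H → 2 * H + 1 ≤ p → C ^ 5 * p ^ 3 ≤ H ^ 5 →
    1 ≤ t → t < p →
    suc k * ∣ N3 p H t * p - (2 * H + 1) ^ 9 ∣ ≤ (2 * H + 1) ^ 9
-- With K = `suc k` the relative error is at most 1 / K, and C may be taken linear in K. The witness
-- 0 for `P₀` suffices because H < p and C^5 p^3 ≤ H^5 already force p² > C^5.
theorem5 k = 136 * suc k , 0 , λ p H t p-prime _ _ 1≤H n≤p large 1≤t t<p →
  bound {136 * suc k} {suc k} (4c≤C² (suc k) (s≤s z≤n)) (6K≤C (suc k)) (18K²≤C⁵ (suc k) (s≤s z≤n))
    (s≤s z≤n) p H t p-prime 1≤H n≤p large 1≤t t<p
  where
  -- 136² = 18496 ≥ 4 · 4608, where 4608 = 2 · 16 · 12² comes from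
  -- multiplicativeEnergy-bound.
  C²≡ : ∀ K → 136 * K * (136 * K) ≡ 18496 * (K * K)
  C²≡ K = [m*n]*[o*p]≡[m*o]*[n*p] 136 K 136 K
  4c≤C² : ∀ K → 1 ≤ K → 4 * 4608 ≤ 136 * K * (136 * K)
  4c≤C² K 1≤K = ≤-trans (*-mono-≤ (≤ᵇ⇒≤ 18432 18496 _) (*-mono-≤ 1≤K 1≤K)) (≤-reflexive (sym (C²≡ K)))
  6K≤C : ∀ K → 6 * K ≤ 136 * K
  6K≤C K = *-monoˡ-≤ K (≤ᵇ⇒≤ 6 136 _)
  18K²≤C⁵ : ∀ K → 1 ≤ K → 18 * (K * K) ≤ (136 * K) ^ 5
  18K²≤C⁵ K 1≤K = ≤-trans (*-monoˡ-≤ (K * K) (≤ᵇ⇒≤ 18 18496 _))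
    (≤-trans (≤-reflexive (trans (sym (C²≡ K)) (cong (136 * K *_) (sym (*-identityʳ (136 * K))))))
    (^-monoʳ-≤ (136 * K) {{m*n≢0 136 K {{_}} {{>-nonZero 1≤K}}}} (≤ᵇ⇒≤ 2 5 _)))

  bound : ∀ {C K} → 4 * 4608 ≤ C * C → 6 * K ≤ C → 18 * (K * K) ≤ C ^ 5 → 1 ≤ C →
    ∀ p H t → Prime p → 1 ≤ H → 2 * H + 1 ≤ p → C ^ 5 * p ^ 3 ≤ H ^ 5 → 1 ≤ t → t < p →
    K * ∣ N3 p H t * p - (2 * H + 1) ^ 9 ∣ ≤ (2 * H + 1) ^ 9
  bound {C} {K} 4c≤C² 6K≤C 18K²≤C⁵ 1≤C p H t p-prime 1≤H n≤p large 1≤t t<p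
    with s , 1≤s , p≤s¹⁰ , s¹⁰≤ ← tenth-root p (≤-trans 1≤t (<⇒≤ t<p)) =
    asymptotics {C} {K} {p} {H} {s} p-prime (interval H) (Residues.distinct-interval p {H} n≤p)
      N3≡ (length-interval H) H≤n t≉0 large 4c≤C² 6K≤C 18K²≤C⁵ s¹⁰≤
      (Energy.multiplicativeEnergy-bound p {{prime⇒nonZero p-prime}} 1≤H 1≤s (≤-trans n≤p p≤s¹⁰) p≤n²)
    where
    N3≡ : detCount p (interval H) (+ t) ≡ N3 p H t
    N3≡ = refl
    t≉0 : ¬ Residues._≋_ p (+ t) ℤ.0ℤ
    t≉0 (Residues.mod d) = <⇒≱ t<p
      (∣⇒≤ {{>-nonZero 1≤t}} (subst (p ℕ.∣_) (cong ∣_∣ (ℤ.+-identityʳ (+ t))) (Signed.∣⇒∣ᵤ d)))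
    H≤n : H ≤ 2 * H + 1
    H≤n = ≤-trans (m≤m+n H (H + 0)) (m≤m+n (2 * H) 1)
    p≤n² : p ≤ (2 * H + 1) * (2 * H + 1)
    p≤n² = ≤-trans (≤-trans (≤-reflexive (sym (*-identityˡ p))) (*-monoˡ-≤ p (*-mono-≤ 1≤C 1≤C)))
      (large⇒C²p≤n² {C} H≤n (≤-trans 1≤t (<⇒≤ t<p)) large)
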